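{- Let $n \geq 4$ and $k$ be integers with $1 \leq k \leq n/2$, and let $P(n,k)$ be the generalised Petersen graph, with spectrum (the eigenvalues of its adjacency matrix, listed with multiplicity) $$3=\lambda_1 > \lambda_2 \geq \cdots \geq \lambda_{2n}.$$ Then $$\lambda_1 - \lambda_2 < \frac{4 \pi}{[n^{1/2}]-1},$$ where $[x]$ denotes the integer part of $x$.
   Context: For positive integers $n \geq 3$ and $k \leq n/2$, the generalised Petersen graph $P(n,k)$ is the graph with vertex set $\{a_i, b_i : 0 \leq i \leq n-1\}$ (so $2n$ vertices) and edges $a_i a_{i+1}$, $a_i b_i$, $b_i b_{i+k}$ for $0 \leq i \leq n-1$, with subscripts read modulo $n$. When $k=n/2$, the edges $b_ib_{i+k}$ and $b_{i+k}b_{i+2k}=b_{i+k}b_i$ are counted separately, so that $b_i$ and $b_{i+k}$ are joined by a double edge (adjacency matrix entry $2$). With this convention $P(n,k)$ is always connected and cubic ($3$-regular). -}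

module Defs where

open import Algebra.Bundles using (RawRing; CommutativeRing)
import Algebra.Definitions.RawMonoid as RawMonoidDefs
import Algebra.Definitions.RawSemiring as RawSemiringDefs
open import Data.Bool.Base using (if_then_else_)
open import Data.Fin.Base as Fin using (Fin; zero; suc; toℕ; punchIn; _↑ˡ_; _↑ʳ_)
import Data.Fin.Properties as Fin
open import Data.Integer.Base as ℤ using (+_)
import Data.Integer.Properties as ℤ
open import Data.List.Base using (List; _++_; tabulate; filter; length)
open import Data.Nat.Base as ℕ using (ℕ; zero; suc; NonZero; z≤n; s≤s)
open import Data.Nat.DivMod using (_mod_)
import Data.Nat.Properties as ℕ
open import Data.Product.Base using (_×_; _,_; ∃-syntax; proj₁; proj₂)
open import Data.Product.Properties using (≡-dec)
open import Data.Rational.Base as ℚ using (ℚ; 0ℚ; 1ℚ; ½; ∣_∣)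
import Data.Rational.Properties as ℚ
import Data.Rational.Unnormalised.Base as ℚᵘ
import Data.Rational.Unnormalised.Properties as ℚᵘ
open import Data.Rational.Solver using (module +-*-Solver)
open import Data.Sum.Base using (_⊎_; inj₁; inj₂)
open import Level using (0ℓ)
open import Relation.Binary.PropositionalEquality
  using (_≡_; refl; sym; trans; cong; cong₂; subst; subst₂)
open import Relation.Nullary.Decidable using (Dec; does; yes; no; _⊎-dec_)
open import Relation.Nullary.Negation using (¬_)

private
  next : ℕ → ℕ → ℕ
  next n r with suc r ℕ.* suc r ℕ.≤? n
  ... | yes _ = suc r
  ... | no  _ = r

-- The largest r with r * r ≤ n; see ⌊√⌋-lower and ⌊√⌋-upper.
⌊√_⌋ : ℕ → ℕ
⌊√ zero ⌋  = zero
⌊√ suc n ⌋ = next (suc n) ⌊√ n ⌋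

⌊√⌋-lower : ∀ n → ⌊√ n ⌋ ℕ.* ⌊√ n ⌋ ℕ.≤ n
⌊√⌋-lower zero    = z≤n
⌊√⌋-lower (suc n) = go ⌊√ n ⌋ (⌊√⌋-lower n)
  where
  go : ∀ r → r ℕ.* r ℕ.≤ n → next (suc n) r ℕ.* next (suc n) r ℕ.≤ suc n
  go r h with suc r ℕ.* suc r ℕ.≤? suc n
  ... | yes p = p
  ... | no  _ = ℕ.m≤n⇒m≤1+n h

⌊√⌋-upper : ∀ n → n ℕ.< suc ⌊√ n ⌋ ℕ.* suc ⌊√ n ⌋
⌊√⌋-upper zero    = s≤s z≤n
⌊√⌋-upper (suc n) = go ⌊√ n ⌋ (⌊√⌋-upper n)
  where
  go : ∀ r → n ℕ.< suc r ℕ.* suc r →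
       suc n ℕ.< suc (next (suc n) r) ℕ.* suc (next (suc n) r)
  go r h with suc r ℕ.* suc r ℕ.≤? suc n
  ... | yes _ = ℕ.≤-<-trans h
    (ℕ.*-mono-< {suc r} {suc (suc r)} {suc r} {suc (suc r)} (ℕ.n<1+n _) (ℕ.n<1+n _))
  ... | no ¬p = ℕ.≰⇒> ¬p

⌊√⌋∸1-nonZero : ∀ {n} → 4 ℕ.≤ n → NonZero (⌊√ n ⌋ ℕ.∸ 1)
⌊√⌋∸1-nonZero {n} 4≤n = go ⌊√ n ⌋ (ℕ.≤-<-trans 4≤n (⌊√⌋-upper n))
  where
  go : ∀ r → 4 ℕ.< suc r ℕ.* suc r → NonZero (r ℕ.∸ 1)
  go zero (s≤s ())
  go (suc zero) (s≤s (s≤s (s≤s (s≤s ()))))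
  go (suc (suc r)) _ = _

module Matrices {c ℓ} (R : RawRing c ℓ) where
  open RawRing R
  open RawSemiringDefs rawSemiring using (sum; _^_) public
  open RawMonoidDefs *-rawMonoid using () renaming (sum to product) public

  Matrix : ℕ → Set c
  Matrix n = Fin n → Fin n → Carrier

  -- Laplace expansion along the first row.
  det : ∀ {n} → Matrix n → Carrier
  det {zero}  M = 1#
  det {suc n} M =
    sum λ j → (- 1#) ^ toℕ j * (M zero j * det λ p q → M (suc p) (punchIn j q))

  scalar : ∀ {n} → Carrier → Matrix n
  scalar x i j = if does (i Fin.≟ j) then x else 0#

  charPoly : ∀ {n} → Matrix n → Carrier → Carrier
  charPoly M x = det λ i j → scalar x i j + - M i j

-- Loops are not excluded here, but P n k has none for 1 ≤ k < n.
record Multigraph : Set where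
  field
    order : ℕ
    edges : List (Fin order × Fin order)

open Multigraph public

-- The number of listed edges joining u and v in either direction; a loop would
-- be counted once.
multiplicity : (G : Multigraph) → Fin (order G) → Fin (order G) → ℕ
multiplicity G u v = length (filter joins? (edges G))
  where
  _≟_ = ≡-dec Fin._≟_ Fin._≟_

  joins? : ∀ e → Dec (e ≡ (u , v) ⊎ e ≡ (v , u))
  joins? e = (e ≟ (u , v)) ⊎-dec (e ≟ (v , u))

infixl 6 _⊕_

_⊕_ : ∀ {n} → Fin n → ℕ → Fin n
_⊕_ {suc n} i k = (toℕ i ℕ.+ k) mod suc n

-- The generalised Petersen graph P(n,k). For 2k = n the edges b_i b_{i+k} and
-- b_{i+k} b_i are both listed, giving a double edge.
P : ℕ → ℕ → Multigraph
P n k = record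
  { order = n ℕ.+ n
  ; edges = tabulate (λ i → a i , a (i ⊕ 1))
         ++ tabulate (λ i → a i , b i)
         ++ tabulate (λ i → b i , b (i ⊕ k))
  }
  where
  a b : Fin n → Fin (n ℕ.+ n)
  a i = i ↑ˡ n
  b i = n ↑ʳ i

Eventually : (ℕ → Set) → Set
Eventually Q = ∃[ N ] (∀ m → N ℕ.≤ m → Q m)

IsCauchy : (ℕ → ℚ) → Set
IsCauchy x = ∀ ε → 0ℚ ℚ.< ε →
  ∃[ N ] (∀ m n → N ℕ.≤ m → N ℕ.≤ n → ∣ x m ℚ.- x n ∣ ℚ.≤ ε)

-- Cauchy sequences of rationals; equality of reals is _≈_.
record ℝ : Set where
  no-eta-equality
  constructor mkℝ
  field
    seq    : ℕ → ℚ
    cauchy : IsCauchy seq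

open ℝ public

infix 4 _≈_ _<_ _≤_

_≈_ : ℝ → ℝ → Set
x ≈ y = ∀ ε → 0ℚ ℚ.< ε → Eventually λ m → ∣ seq x m ℚ.- seq y m ∣ ℚ.≤ ε

_<_ : ℝ → ℝ → Set
x < y = ∃[ ε ] (0ℚ ℚ.< ε × Eventually λ m → seq x m ℚ.+ ε ℚ.≤ seq y m)

_≤_ : ℝ → ℝ → Set
x ≤ y = ¬ (y < x)

private
  open +-*-Solver using (solve; con; _:=_; _:+_; _:*_; _:-_; :-_)

  0<+ : ∀ p q → 0ℚ ℚ.≤ p → 0ℚ ℚ.< q → 0ℚ ℚ.< p ℚ.+ q
  0<+ p q 0≤p 0<q = subst (ℚ._< p ℚ.+ q) (ℚ.+-identityˡ 0ℚ)
    (ℚ.+-mono-≤-< {0ℚ} {p} {0ℚ} {q} 0≤p 0<q)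

  0<½* : ∀ {ε} → 0ℚ ℚ.< ε → 0ℚ ℚ.< ½ ℚ.* ε
  0<½* {ε} 0<ε = subst (ℚ._< ½ ℚ.* ε) (ℚ.*-zeroʳ ½) (ℚ.*-monoʳ-<-pos ½ 0<ε)

  ½*+½* : ∀ ε → ½ ℚ.* ε ℚ.+ ½ ℚ.* ε ≡ ε
  ½*+½* ε = trans (sym (ℚ.*-distribʳ-+ ε ½ ½)) (ℚ.*-identityˡ ε)

  ∣p-p∣≤ : ∀ p {ε} → 0ℚ ℚ.< ε → ∣ p ℚ.- p ∣ ℚ.≤ ε
  ∣p-p∣≤ p {ε} 0<ε = subst (λ z → ∣ z ∣ ℚ.≤ ε) (sym (ℚ.+-inverseʳ p)) (ℚ.<⇒≤ 0<ε)

  ∣-∣-sym : ∀ p q → ∣ p ℚ.- q ∣ ≡ ∣ q ℚ.- p ∣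
  ∣-∣-sym p q = trans (sym (ℚ.∣-p∣≡∣p∣ (p ℚ.- q)))
    (cong ∣_∣ (solve 2 (λ p q → :- (p :- q) := q :- p) refl p q))

  ∣-∣-triangle : ∀ p q r {δ ε} → ∣ p ℚ.- q ∣ ℚ.≤ δ → ∣ q ℚ.- r ∣ ℚ.≤ ε →
                 ∣ p ℚ.- r ∣ ℚ.≤ δ ℚ.+ ε
  ∣-∣-triangle p q r {δ} {ε} p≤ q≤ = subst (λ z → ∣ z ∣ ℚ.≤ δ ℚ.+ ε)
    (solve 3 (λ p q r → (p :- q) :+ (q :- r) := p :- r) refl p q r)
    (ℚ.≤-trans (ℚ.∣p+q∣≤∣p∣+∣q∣ (p ℚ.- q) (q ℚ.- r)) (ℚ.+-mono-≤ p≤ q≤))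

  +-dist : ∀ p p′ q q′ {δ ε} → ∣ p ℚ.- p′ ∣ ℚ.≤ δ → ∣ q ℚ.- q′ ∣ ℚ.≤ ε →
           ∣ (p ℚ.+ q) ℚ.- (p′ ℚ.+ q′) ∣ ℚ.≤ δ ℚ.+ ε
  +-dist p p′ q q′ {δ} {ε} p≤ q≤ = subst (λ z → ∣ z ∣ ℚ.≤ δ ℚ.+ ε)
    (solve 4 (λ p p′ q q′ → (p :- p′) :+ (q :- q′) := (p :+ q) :- (p′ :+ q′))
      refl p p′ q q′)
    (ℚ.≤-trans (ℚ.∣p+q∣≤∣p∣+∣q∣ (p ℚ.- p′) (q ℚ.- q′)) (ℚ.+-mono-≤ p≤ q≤))

  neg-dist : ∀ p p′ → ∣ (ℚ.- p) ℚ.- (ℚ.- p′) ∣ ≡ ∣ p ℚ.- p′ ∣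
  neg-dist p p′ = trans
    (cong ∣_∣ (solve 2 (λ p p′ → (:- p) :- (:- p′) := p′ :- p) refl p p′))
    (∣-∣-sym p′ p)

  *-bound : ∀ {p q δ ε} → ∣ p ∣ ℚ.≤ δ → ∣ q ∣ ℚ.≤ ε → ∣ p ℚ.* q ∣ ℚ.≤ δ ℚ.* ε
  *-bound {p} {q} {δ} {ε} p≤ q≤ = ℚ.≤-trans
    (ℚ.≤-reflexive (ℚ.∣p*q∣≡∣p∣*∣q∣ p q))
    (ℚ.≤-trans
      (ℚ.*-monoʳ-≤-nonNeg ∣ q ∣ {{ℚ.nonNegative (ℚ.0≤∣p∣ q)}} p≤)
      (ℚ.*-monoˡ-≤-nonNeg δ {{ℚ.nonNegative (ℚ.≤-trans (ℚ.0≤∣p∣ p) p≤)}} q≤))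

  *-dist : ∀ p p′ q q′ {K δ} → ∣ p ∣ ℚ.≤ K → ∣ q′ ∣ ℚ.≤ K →
           ∣ p ℚ.- p′ ∣ ℚ.≤ δ → ∣ q ℚ.- q′ ∣ ℚ.≤ δ →
           ∣ p ℚ.* q ℚ.- p′ ℚ.* q′ ∣ ℚ.≤ K ℚ.* δ ℚ.+ K ℚ.* δ
  *-dist p p′ q q′ {K} {δ} p≤ q′≤ pp qq = ℚ.≤-trans
    (subst (λ z → ∣ z ∣ ℚ.≤ K ℚ.* δ ℚ.+ δ ℚ.* K)
      (solve 4 (λ p p′ q q′ →
          p :* (q :- q′) :+ (p :- p′) :* q′ := p :* q :- p′ :* q′) refl p p′ q q′)
      (ℚ.≤-trans
        (ℚ.∣p+q∣≤∣p∣+∣q∣ (p ℚ.* (q ℚ.- q′)) ((p ℚ.- p′) ℚ.* q′))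
        (ℚ.+-mono-≤ (*-bound {p} {q ℚ.- q′} p≤ qq) (*-bound {p ℚ.- p′} {q′} pp q′≤))))
    (ℚ.≤-reflexive (cong (K ℚ.* δ ℚ.+_) (ℚ.*-comm δ K)))

  -- A common eventual bound K for two reals, and for each ε a δ with 2Kδ = ε.
  record Bound (x y : ℝ) : Set where
    field
      K     : ℚ
      0<K   : 0ℚ ℚ.< K
      from  : ℕ
      x≤K   : ∀ m → from ℕ.≤ m → ∣ seq x m ∣ ℚ.≤ K
      y≤K   : ∀ m → from ℕ.≤ m → ∣ seq y m ∣ ℚ.≤ K

    instance
      2K-pos : ℚ.Positive (K ℚ.+ K)
      2K-pos = ℚ.positive (0<+ K K (ℚ.<⇒≤ 0<K) 0<K)

      2K-nonZero : ℚ.NonZero (K ℚ.+ K)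
      2K-nonZero = ℚ.pos⇒nonZero (K ℚ.+ K)

    δ : ℚ → ℚ
    δ ε = ℚ.1/ (K ℚ.+ K) ℚ.* ε

    0<δ : ∀ {ε} → 0ℚ ℚ.< ε → 0ℚ ℚ.< δ ε
    0<δ {ε} 0<ε = subst (ℚ._< δ ε) (ℚ.*-zeroʳ (ℚ.1/ (K ℚ.+ K)))
      (ℚ.*-monoʳ-<-pos (ℚ.1/ (K ℚ.+ K)) {{ℚ.1/pos⇒pos (K ℚ.+ K)}} 0<ε)

    2Kδ : ∀ ε → K ℚ.* δ ε ℚ.+ K ℚ.* δ ε ≡ ε
    2Kδ ε = trans (sym (ℚ.*-distribʳ-+ (δ ε) K K))
      (trans (sym (ℚ.*-assoc (K ℚ.+ K) (ℚ.1/ (K ℚ.+ K)) ε))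
        (trans (cong (ℚ._* ε) (ℚ.*-inverseʳ (K ℚ.+ K))) (ℚ.*-identityˡ ε)))

  0<1 : 0ℚ ℚ.< 1ℚ
  0<1 = ℚ.positive⁻¹ 1ℚ

  cancel : ∀ p q → q ℚ.+ (p ℚ.- q) ≡ p
  cancel = solve 2 (λ p q → q :+ (p :- q) := p) refl

  ∣-∣-bound : ∀ p q {ε} → ∣ p ℚ.- q ∣ ℚ.≤ ε → ∣ p ∣ ℚ.≤ ∣ q ∣ ℚ.+ ε
  ∣-∣-bound p q {ε} p≤ = subst (λ z → ∣ z ∣ ℚ.≤ ∣ q ∣ ℚ.+ ε) (cancel p q)
    (ℚ.≤-trans (ℚ.∣p+q∣≤∣p∣+∣q∣ q (p ℚ.- q)) (ℚ.+-monoʳ-≤ ∣ q ∣ p≤))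

  Bounded : ℝ → Set
  Bounded x = ∃[ K ] (0ℚ ℚ.< K × Eventually λ m → ∣ seq x m ∣ ℚ.≤ K)

  bounded : ∀ x → Bounded x
  bounded x with cauchy x 1ℚ 0<1
  ... | N , h = ∣ seq x N ∣ ℚ.+ 1ℚ
              , 0<+ ∣ seq x N ∣ 1ℚ (ℚ.0≤∣p∣ (seq x N)) 0<1
              , N , λ m N≤m → ∣-∣-bound (seq x m) (seq x N) (h m N N≤m ℕ.≤-refl)

  p≤p+q : ∀ p q → 0ℚ ℚ.≤ q → p ℚ.≤ p ℚ.+ q
  p≤p+q p q 0≤q = ℚ.≤-trans (ℚ.≤-reflexive (sym (ℚ.+-identityʳ p)))
    (ℚ.+-monoʳ-≤ p {0ℚ} {q} 0≤q)

  bound : ∀ x y → Bound x y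
  bound x y = go (bounded x) (bounded y)
    where
    go : Bounded x → Bounded y → Bound x y
    go (K , 0<K , M , hx) (L , 0<L , N , hy) = record
      { K    = K ℚ.+ L
      ; 0<K  = 0<+ K L (ℚ.<⇒≤ 0<K) 0<L
      ; from = M ℕ.⊔ N
      ; x≤K  = λ m le → ℚ.≤-trans (hx m (ℕ.m⊔n≤o⇒m≤o M N le))
          (p≤p+q K L (ℚ.<⇒≤ 0<L))
      ; y≤K  = λ m le → ℚ.≤-trans (hy m (ℕ.m⊔n≤o⇒n≤o M N le))
          (subst (L ℚ.≤_) (ℚ.+-comm L K) (p≤p+q L K (ℚ.<⇒≤ 0<K)))
      }

fromℚ : ℚ → ℝ
fromℚ q = mkℝ (λ _ → q) λ ε 0<ε → 0 , λ _ _ _ _ → ∣p-p∣≤ q 0<ε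

fromℕ : ℕ → ℝ
fromℕ n = fromℚ (+ n ℚ./ 1)

infixl 6 _+_ _-_
infixl 7 _*_ _/_
infix  8 -_

_+_ : ℝ → ℝ → ℝ
x + y = mkℝ (λ m → seq x m ℚ.+ seq y m) λ ε 0<ε →
  let M , hx = cauchy x (½ ℚ.* ε) (0<½* 0<ε)
      N , hy = cauchy y (½ ℚ.* ε) (0<½* 0<ε)
  in M ℕ.⊔ N , λ m n m≥ n≥ → subst (_ ℚ.≤_) (½*+½* ε)
       (+-dist (seq x m) (seq x n) (seq y m) (seq y n)
         (hx m n (ℕ.m⊔n≤o⇒m≤o M N m≥) (ℕ.m⊔n≤o⇒m≤o M N n≥))
         (hy m n (ℕ.m⊔n≤o⇒n≤o M N m≥) (ℕ.m⊔n≤o⇒n≤o M N n≥)))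

-_ : ℝ → ℝ
- x = mkℝ (λ m → ℚ.- seq x m) λ ε 0<ε →
  let N , h = cauchy x ε 0<ε
  in N , λ m n m≥ n≥ →
       subst (ℚ._≤ ε) (sym (neg-dist (seq x m) (seq x n))) (h m n m≥ n≥)

_-_ : ℝ → ℝ → ℝ
x - y = x + - y

_*_ : ℝ → ℝ → ℝ
x * y = mkℝ (λ m → seq x m ℚ.* seq y m) λ ε 0<ε →
  let open Bound (bound x y)
      M , hx = cauchy x (δ ε) (0<δ 0<ε)
      N , hy = cauchy y (δ ε) (0<δ 0<ε)
      M⊔N = M ℕ.⊔ N
  in from ℕ.⊔ M⊔N , λ m n m≥ n≥ →
       let m≥′ = ℕ.m⊔n≤o⇒n≤o from M⊔N m≥
           n≥′ = ℕ.m⊔n≤o⇒n≤o from M⊔N n≥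
       in subst (_ ℚ.≤_) (2Kδ ε)
            (*-dist (seq x m) (seq x n) (seq y m) (seq y n)
              (x≤K m (ℕ.m⊔n≤o⇒m≤o from M⊔N m≥))
              (y≤K n (ℕ.m⊔n≤o⇒m≤o from M⊔N n≥))
              (hx m n (ℕ.m⊔n≤o⇒m≤o M N m≥′) (ℕ.m⊔n≤o⇒m≤o M N n≥′))
              (hy m n (ℕ.m⊔n≤o⇒n≤o M N m≥′) (ℕ.m⊔n≤o⇒n≤o M N n≥′)))

_/_ : ℝ → (d : ℕ) .{{_ : NonZero d}} → ℝ
x / d = x * fromℚ (+ 1 ℚ./ d)

private
  pointwise : ∀ {x y} → (∀ m → seq x m ≡ seq y m) → x ≈ y
  pointwise {x} {y} h ε 0<ε = 0 , λ m _ →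
    subst (λ z → ∣ seq x m ℚ.- z ∣ ℚ.≤ ε) (h m) (∣p-p∣≤ (seq x m) 0<ε)

  ≈-refl : ∀ {x} → x ≈ x
  ≈-refl {x} = pointwise {x} {x} λ _ → refl

  ≈-sym : ∀ {x y} → x ≈ y → y ≈ x
  ≈-sym {x} {y} h ε 0<ε = let N , e = h ε 0<ε in
    N , λ m m≥ → subst (ℚ._≤ ε) (∣-∣-sym (seq x m) (seq y m)) (e m m≥)

  ≈-trans : ∀ {x y z} → x ≈ y → y ≈ z → x ≈ z
  ≈-trans {x} {y} {z} h h′ ε 0<ε =
    let M , e  = h  (½ ℚ.* ε) (0<½* 0<ε)
        N , e′ = h′ (½ ℚ.* ε) (0<½* 0<ε)
    in M ℕ.⊔ N , λ m m≥ → subst (_ ℚ.≤_) (½*+½* ε)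
         (∣-∣-triangle (seq x m) (seq y m) (seq z m)
           (e m (ℕ.m⊔n≤o⇒m≤o M N m≥)) (e′ m (ℕ.m⊔n≤o⇒n≤o M N m≥)))

  +-cong : ∀ {x x′ y y′} → x ≈ x′ → y ≈ y′ → x + y ≈ x′ + y′
  +-cong {x} {x′} {y} {y′} h h′ ε 0<ε =
    let M , e  = h  (½ ℚ.* ε) (0<½* 0<ε)
        N , e′ = h′ (½ ℚ.* ε) (0<½* 0<ε)
    in M ℕ.⊔ N , λ m m≥ → subst (_ ℚ.≤_) (½*+½* ε)
         (+-dist (seq x m) (seq x′ m) (seq y m) (seq y′ m)
           (e m (ℕ.m⊔n≤o⇒m≤o M N m≥)) (e′ m (ℕ.m⊔n≤o⇒n≤o M N m≥)))

  -‿cong : ∀ {x x′} → x ≈ x′ → - x ≈ - x′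
  -‿cong {x} {x′} h ε 0<ε = let N , e = h ε 0<ε in
    N , λ m m≥ → subst (ℚ._≤ ε) (sym (neg-dist (seq x m) (seq x′ m))) (e m m≥)

  *-cong : ∀ {x x′ y y′} → x ≈ x′ → y ≈ y′ → x * y ≈ x′ * y′
  *-cong {x} {x′} {y} {y′} h h′ ε 0<ε =
    let open Bound (bound x y′)
        M , e  = h  (δ ε) (0<δ 0<ε)
        N , e′ = h′ (δ ε) (0<δ 0<ε)
        M⊔N = M ℕ.⊔ N
    in from ℕ.⊔ M⊔N , λ m m≥ →
         let m≥′ = ℕ.m⊔n≤o⇒n≤o from M⊔N m≥
             m≥″ = ℕ.m⊔n≤o⇒m≤o from M⊔N m≥
         in subst (_ ℚ.≤_) (2Kδ ε)
              (*-dist (seq x m) (seq x′ m) (seq y m) (seq y′ m)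
                (x≤K m m≥″) (y≤K m m≥″)
                (e m (ℕ.m⊔n≤o⇒m≤o M N m≥′)) (e′ m (ℕ.m⊔n≤o⇒n≤o M N m≥′)))

ℝ-commutativeRing : CommutativeRing 0ℓ 0ℓ
ℝ-commutativeRing = record
  { Carrier = ℝ ; _≈_ = _≈_ ; _+_ = _+_ ; _*_ = _*_ ; -_ = -_
  ; 0# = fromℚ 0ℚ ; 1# = fromℚ 1ℚ
  ; isCommutativeRing = record
    { isRing = record
      { +-isAbelianGroup = record
        { isGroup = record
          { isMonoid = record
            { isSemigroup = record
              { isMagma = record
                { isEquivalence = record
                  { refl  = λ {x} → ≈-refl {x}
                  ; sym   = λ {x} {y} → ≈-sym {x} {y}
                  ; trans = λ {x} {y} {z} → ≈-trans {x} {y} {z}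
                  }
                ; ∙-cong = λ {x} {x′} {y} {y′} → +-cong {x} {x′} {y} {y′}
                }
              ; assoc = λ x y z → pointwise {(x + y) + z} {x + (y + z)}
                  λ m → ℚ.+-assoc (seq x m) (seq y m) (seq z m)
              }
            ; identity =
                (λ x → pointwise {fromℚ 0ℚ + x} {x} λ m → ℚ.+-identityˡ (seq x m))
              , (λ x → pointwise {x + fromℚ 0ℚ} {x} λ m → ℚ.+-identityʳ (seq x m))
            }
          ; inverse =
              (λ x → pointwise { - x + x } {fromℚ 0ℚ} λ m → ℚ.+-inverseˡ (seq x m))
            , (λ x → pointwise {x + - x} {fromℚ 0ℚ} λ m → ℚ.+-inverseʳ (seq x m))
          ; ⁻¹-cong = λ {x} {x′} → -‿cong {x} {x′}
          }
        ; comm = λ x y → pointwise {x + y} {y + x}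
            λ m → ℚ.+-comm (seq x m) (seq y m)
        }
      ; *-cong = λ {x} {x′} {y} {y′} → *-cong {x} {x′} {y} {y′}
      ; *-assoc = λ x y z → pointwise {(x * y) * z} {x * (y * z)}
          λ m → ℚ.*-assoc (seq x m) (seq y m) (seq z m)
      ; *-identity =
          (λ x → pointwise {fromℚ 1ℚ * x} {x} λ m → ℚ.*-identityˡ (seq x m))
        , (λ x → pointwise {x * fromℚ 1ℚ} {x} λ m → ℚ.*-identityʳ (seq x m))
      ; distrib =
          (λ x y z → pointwise {x * (y + z)} {x * y + x * z}
            λ m → ℚ.*-distribˡ-+ (seq x m) (seq y m) (seq z m))
        , (λ x y z → pointwise {(y + z) * x} {y * x + z * x}
            λ m → ℚ.*-distribʳ-+ (seq x m) (seq y m) (seq z m))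
      }
    ; *-comm = λ x y → pointwise {x * y} {y * x}
        λ m → ℚ.*-comm (seq x m) (seq y m)
    }
  }

odd⁻¹ : ℕ → ℚ
odd⁻¹ k = + 1 ℚ./ suc (2 ℕ.* k)

-- leibniz k m = Σ_{j<m} (-1)^j / (2(k+j)+1), so that leibniz 0 m is the m-th
-- partial sum of 1 - 1/3 + 1/5 - ⋯ = π/4.
leibniz : ℕ → ℕ → ℚ
leibniz k zero    = 0ℚ
leibniz k (suc m) = odd⁻¹ k ℚ.- leibniz (suc k) m

private
  1/-≤ : ∀ m a b → 1 ℕ.* suc b ℕ.≤ a ℕ.* suc m →
         ℚᵘ.mkℚᵘ (+ 1) m ℚᵘ.≤ ℚᵘ.mkℚᵘ (+ a) b
  1/-≤ m a b h = ℚᵘ.*≤* (subst₂ ℤ._≤_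
    (ℤ.pos-* 1 (suc b)) (ℤ.pos-* a (suc m)) (ℤ.+≤+ h))

  odd⁻¹ᵘ : ∀ k → ℚ.toℚᵘ (odd⁻¹ k) ℚᵘ.≃ ℚᵘ.mkℚᵘ (+ 1) (2 ℕ.* k)
  odd⁻¹ᵘ k = ℚ.toℚᵘ-fromℚᵘ (ℚᵘ.mkℚᵘ (+ 1) (2 ℕ.* k))

  odd⁻¹-anti : ∀ {k l} → k ℕ.≤ l → odd⁻¹ l ℚ.≤ odd⁻¹ k
  odd⁻¹-anti {k} {l} k≤l = ℚ.toℚᵘ-cancel-≤
    (ℚᵘ.≤-respʳ-≃ (ℚᵘ.≃-sym (odd⁻¹ᵘ k)) (ℚᵘ.≤-respˡ-≃ (ℚᵘ.≃-sym (odd⁻¹ᵘ l))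
      (1/-≤ (2 ℕ.* l) 1 (2 ℕ.* k)
        (ℕ.*-monoʳ-≤ 1 (s≤s (ℕ.*-monoʳ-≤ 2 k≤l))))))

  0≤odd⁻¹ : ∀ k → 0ℚ ℚ.≤ odd⁻¹ k
  0≤odd⁻¹ k = ℚ.toℚᵘ-cancel-≤ (ℚᵘ.≤-respʳ-≃ (ℚᵘ.≃-sym (odd⁻¹ᵘ k))
    (ℚᵘ.*≤* (ℤ.+≤+ z≤n)))

  odd⁻¹-archimedean : ∀ ε → 0ℚ ℚ.< ε → ∃[ k ] odd⁻¹ k ℚ.≤ ε
  odd⁻¹-archimedean (ℚ.mkℚ (+ zero) _ _) (ℚ.*<* (ℤ.+<+ ()))
  odd⁻¹-archimedean ε@(ℚ.mkℚ (+ suc a) b _) 0<ε = b , ℚ.toℚᵘ-cancel-≤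
    (ℚᵘ.≤-respˡ-≃ (ℚᵘ.≃-sym (odd⁻¹ᵘ b)) (1/-≤ (2 ℕ.* b) (suc a) b
      (ℕ.*-mono-≤ {1} {suc a} {suc b} (s≤s z≤n) (s≤s (ℕ.m≤m+n b (b ℕ.+ 0))))))

  leibniz-bounds : ∀ k m → 0ℚ ℚ.≤ leibniz k m × leibniz k m ℚ.≤ odd⁻¹ k
  leibniz-bounds k zero = ℚ.≤-refl , 0≤odd⁻¹ k
  leibniz-bounds k (suc m) =
    let 0≤t , t≤ = leibniz-bounds (suc k) m
    in lower (odd⁻¹ k) (leibniz (suc k) m)
         (ℚ.≤-trans t≤ (odd⁻¹-anti (ℕ.n≤1+n k)))
     , upper (odd⁻¹ k) (leibniz (suc k) m) 0≤t
    where
    lower : ∀ a t → t ℚ.≤ a → 0ℚ ℚ.≤ a ℚ.- t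
    lower a t t≤a = subst (ℚ._≤ a ℚ.- t) (ℚ.+-inverseʳ t)
      (ℚ.+-monoˡ-≤ (ℚ.- t) {t} {a} t≤a)
    upper : ∀ a t → 0ℚ ℚ.≤ t → a ℚ.- t ℚ.≤ a
    upper a t 0≤t = subst (a ℚ.- t ℚ.≤_) (ℚ.+-identityʳ a)
      (ℚ.+-monoʳ-≤ a {ℚ.- t} {0ℚ} (ℚ.neg-antimono-≤ 0≤t))

  leibniz-tail : ∀ k m l →
    ∣ leibniz k (m ℕ.+ l) ℚ.- leibniz k m ∣ ℚ.≤ odd⁻¹ (k ℕ.+ m)
  leibniz-tail k zero l = subst₂ ℚ._≤_
    (sym (trans (cong ∣_∣ (ℚ.+-identityʳ (leibniz k l)))
      (ℚ.0≤p⇒∣p∣≡p (proj₁ (leibniz-bounds k l)))))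
    (cong odd⁻¹ (sym (ℕ.+-identityʳ k)))
    (proj₂ (leibniz-bounds k l))
  leibniz-tail k (suc m) l = subst₂ ℚ._≤_
    (flip (odd⁻¹ k) (leibniz (suc k) (m ℕ.+ l)) (leibniz (suc k) m))
    (cong odd⁻¹ (sym (ℕ.+-suc k m)))
    (leibniz-tail (suc k) m l)
    where
    flip : ∀ a s t → ∣ s ℚ.- t ∣ ≡ ∣ (a ℚ.- s) ℚ.- (a ℚ.- t) ∣
    flip a s t = trans (∣-∣-sym s t) (cong ∣_∣
      (solve 3 (λ a s t → t :- s := (a :- s) :- (a :- t)) refl a s t))

  leibniz-dist : ∀ m l ε → odd⁻¹ m ℚ.≤ ε →
    ∣ leibniz 0 m ℚ.- leibniz 0 (m ℕ.+ l) ∣ ℚ.≤ ε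
  leibniz-dist m l ε m≤ε = ℚ.≤-trans
    (ℚ.≤-reflexive (∣-∣-sym (leibniz 0 m) (leibniz 0 (m ℕ.+ l))))
    (ℚ.≤-trans (leibniz-tail 0 m l) m≤ε)

  leibniz-dist-≤ : ∀ m n ε → m ℕ.≤ n → odd⁻¹ m ℚ.≤ ε →
    ∣ leibniz 0 m ℚ.- leibniz 0 n ∣ ℚ.≤ ε
  leibniz-dist-≤ m n ε m≤n m≤ε =
    subst (λ l → ∣ leibniz 0 m ℚ.- leibniz 0 l ∣ ℚ.≤ ε) (ℕ.m+[n∸m]≡n m≤n)
      (leibniz-dist m (n ℕ.∸ m) ε m≤ε)

  leibniz-cauchy : IsCauchy (leibniz 0)
  leibniz-cauchy ε 0<ε = go (odd⁻¹-archimedean ε 0<ε)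
    where
    Close : ℕ → ℕ → Set
    Close m n = ∣ leibniz 0 m ℚ.- leibniz 0 n ∣ ℚ.≤ ε

    cases : ∀ m n → odd⁻¹ m ℚ.≤ ε → odd⁻¹ n ℚ.≤ ε → m ℕ.≤ n ⊎ n ℕ.≤ m → Close m n
    cases m n m≤ε n≤ε (inj₁ m≤n) = leibniz-dist-≤ m n ε m≤n m≤ε
    cases m n m≤ε n≤ε (inj₂ n≤m) = ℚ.≤-trans
      (ℚ.≤-reflexive (∣-∣-sym (leibniz 0 m) (leibniz 0 n)))
      (leibniz-dist-≤ n m ε n≤m n≤ε)

    go : (∃[ k ] odd⁻¹ k ℚ.≤ ε) → ∃[ N ] (∀ m n → N ℕ.≤ m → N ℕ.≤ n → Close m n)
    go (N , N≤ε) = N , λ m n N≤m N≤n → cases m n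
      (ℚ.≤-trans (odd⁻¹-anti {N} {m} N≤m) N≤ε)
      (ℚ.≤-trans (odd⁻¹-anti {N} {n} N≤n) N≤ε)
      (ℕ.≤-total m n)

π : ℝ
π = fromℕ 4 * mkℝ (leibniz 0) leibniz-cauchy

open Matrices (CommutativeRing.rawRing ℝ-commutativeRing) public
  using (Matrix; det; charPoly; product)

adjacencyMatrix : (G : Multigraph) → Matrix (order G)
adjacencyMatrix G u v = fromℕ (multiplicity G u v)

-- μ lists the eigenvalues of M with (algebraic) multiplicity in descending
-- order. Since ℝ is infinite, equality of the values at every real x amounts to
-- equality of the polynomials det (xI - M) and ∏ᵢ (x - μᵢ).
IsSpectrum : ∀ {n} → Matrix n → (Fin n → ℝ) → Set
IsSpectrum M μ =
  (∀ i j → i Fin.≤ j → μ j ≤ μ i) ×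
  (∀ x → charPoly M x ≈ product (λ i → x - μ i))

{-# OPTIONS --safe #-}

-- Let A be the adjacency matrix, p its characteristic polynomial over ℚ and Q = [√n]. The terms of
-- the Cauchy sequences satisfy p(xₘ) ≈ ∏ᵢ (xₘ - μᵢₘ) eventually, so it suffices to study p on ℚ.
-- For z > 3 the matrix z I - A is an M-matrix, so p(z) ≥ (z - 3)²ⁿ and no μᵢ exceeds 3. Moreover
-- p(3) = 0, and for some y < 3 with 3 - y ≤ 48/Q² the value p(y) can be made arbitrarily small,
-- so two of the μᵢ are almost ≥ y. The gap is therefore at most 48/Q² ≤ 12/(Q - 1) < 4π/(Q - 1).
--
-- With θ = 2π/n, y is the larger eigenvalue of ((2 cos jθ, 1), (1, 2 cos jkθ)), hence at least
-- 1 + cos jθ + cos jkθ. By Dirichlet's theorem j ≤ Q can be chosen with jk ≡ ±d (mod n), d ≤ n/Q,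
-- and 1 - cos tθ = 2 sin²(πt/n) ≤ 2 t² sin²(π/n) gives 3 - y ≤ 2 (j² + d²) sin²(π/n). The remaining
-- estimate sin²(π/n) ≤ 12/n² follows by comparing the sine with a quartic polynomial.
-- Throughout, cos (π/n) is replaced by a rational c at which sin (nψ) / sin ψ, ψ = arccos c, is
-- tiny, and the eigenvectors by approximate ones; their residuals bound p(y).
module Submission where

import Defs as D
open import Algebra.Bundles using (RawRing; CommutativeRing)
open import Data.Bool.Base using (true; false; if_then_else_)
open import Data.Empty using (⊥-elim)
open import Data.Fin.Base as Fin
  using (Fin; zero; suc; toℕ; fromℕ<; punchIn; splitAt; _↑ˡ_; _↑ʳ_)
import Data.Fin.Properties as Fin
open import Data.Integer.Base as ℤ using (+_; +[1+_]; -[1+_])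
import Data.Integer.Properties as ℤ
open import Data.List.Base using (List; []; _∷_; _++_; tabulate; filter; length)
import Data.List.Properties as List
open import Data.List.Relation.Unary.All using (All; []; _∷_)
import Data.List.Relation.Unary.All.Properties as All
open import Data.Nat.Base as ℕ using (ℕ; zero; suc; s≤s; z≤n)
open import Data.Nat.DivMod
  using (m≡m%n+[m/n]*n; m%n<n; m<n*o⇒m/o<n; m<n⇒m%n≡m; m%n%n≡m%n; [m+n]%n≡m%n; %-distribˡ-+)
import Data.Nat.Properties as ℕ
import Data.Nat.Tactic.RingSolver as ℕ-Solver
open import Data.Product.Base using (_×_; _,_; ∃-syntax; proj₁; proj₂)
import Data.Rational.Base as ℚ
import Data.Rational.Properties as ℚ
import Data.Rational.Unnormalised.Base as ℚᵘ
import Data.Rational.Unnormalised.Properties as ℚᵘ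
open import Data.Sum.Base as Sum using (_⊎_; inj₁; inj₂; [_,_]′)
open import Data.Unit.Base using (tt)
open import Function.Base using (_∘_; _$_)
open import Relation.Binary.PropositionalEquality
open import Relation.Nullary.Decidable using (Dec; yes; no; does)
open import Relation.Nullary.Negation using (¬_)
open import Relation.Unary using (Decidable)

-- The order on `ℝ` is not decidable and the spectrum is known only through values of a polynomial,
-- so cos (2π/n) and exact eigenvectors are never formed and every case distinction is made on
-- rationals. This forces an order of choices. An approximate root `y` says something about a second
-- eigenvalue only if it cannot be an approximation of the root 3 itself. Hence 3 - y is bounded
-- below by some `θ` depending on n alone, fixed before the accuracy of `y`. The constant 12 is a
-- crude substitute for π² in n² sin²(π/n) ≤ π². The factor 2 and the two frequencies j and d, each
-- with product at most n with Q, turn it into 48 = 2 · 2 · 12. Such waste is affordable because Q²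
-- ≥ 4 (Q - 1) leaves only 12 < 4π to be checked, that is, π > 3. The case k = n/2 needs no separate
-- treatment: a vertex then meets the same neighbour once as head and once as tail of an edge.

-- Dirichlet approximation modulo n

module Dirichlet where

  open import Data.Nat.Base
  open import Data.Nat.Properties
  open import Data.Nat.DivMod using (_/_; _%_)
  open import Data.Nat.Tactic.RingSolver using (solve-∀)

  -- x ≡ ± d (mod n), without subtraction.
  Near : ℕ → ℕ → ℕ → Set
  Near n x d = ∃[ p ] ∃[ q ] (x + p * n ≡ d + q * n ⊎ x + d + p * n ≡ q * n)

  module _ (n k Q : ℕ) .{{_ : NonZero n}} where

    private
      r q : ℕ → ℕ
      r t = t * k % n
      q t = t * k / n

      rq : ∀ t → t * k ≡ r t + q t * n
      rq t = m≡m%n+[m/n]*n (t * k) n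

      box : ℕ → ℕ
      box t = r t * Q / n

      box< : 1 ≤ Q → ∀ t → box t < Q
      box< 1≤Q t = m<n*o⇒m/o<n (subst (r t * Q <_) (*-comm n Q)
        (*-monoˡ-< Q {{>-nonZero 1≤Q}} (m%n<n (t * k) n)))

      -- Equal boxes put r t · Q and r s · Q into one interval of length n between consecutive
      -- multiples of n, so their difference d · Q cannot exceed n.
      sameBox : ∀ t s d → box t ≡ box s → r s ≡ r t + d → d * Q ≤ n
      sameBox t s d eq eq′ = ≤-trans (+-cancelʳ-≤ (r t * Q) (d * Q) (r s * Q % n)
        (≤-trans (≤-reflexive (trans (sym (*-distribʳ-+ Q d (r t)))
            (trans (cong (_* Q) (trans (+-comm d (r t)) (sym eq′)))
              (trans (m≡m%n+[m/n]*n (r s * Q) n) (cong (λ b → r s * Q % n + b * n) (sym eq))))))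
          (+-monoʳ-≤ (r s * Q % n) (≤-trans (m≤n+m (box t * n) (r t * Q % n))
            (≤-reflexive (sym (m≡m%n+[m/n]*n (r t * Q) n)))))))
        (<⇒≤ (m%n<n (r s * Q) n))

      -- Which of the two colliding residues is larger decides the sign in `Near`; the quotients of
      -- the two divisions serve as its witnesses p and q.
      assemble : ∀ t j → box t ≡ box (t + j) → r t ≤ r (t + j) ⊎ r (t + j) ≤ r t →
        ∃[ d ] (d * Q ≤ n × Near n (j * k) d)
      assemble t j eq (inj₁ le) = d , sameBox t (t + j) d eq (sym (m+[n∸m]≡n le))
        , q t , q (t + j) , inj₁ (+-cancelˡ-≡ (r t) _ _ (begin
            r t + (j * k + q t * n)    ≡⟨ shuffle (r t) (j * k) (q t * n) ⟩
            (r t + q t * n) + j * k    ≡⟨ cong (_+ j * k) (rq t) ⟨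
            t * k + j * k              ≡⟨ *-distribʳ-+ k t j ⟨
            (t + j) * k                ≡⟨ rq (t + j) ⟩
            r (t + j) + q (t + j) * n  ≡⟨ cong (_+ q (t + j) * n) (m+[n∸m]≡n le) ⟨
            r t + d + q (t + j) * n    ≡⟨ +-assoc (r t) d _ ⟩
            r t + (d + q (t + j) * n)  ∎))
        where
        open ≡-Reasoning
        d = r (t + j) ∸ r t
        shuffle : ∀ a b c → a + (b + c) ≡ (a + c) + b
        shuffle = solve-∀
      assemble t j eq (inj₂ le) = d , sameBox (t + j) t d (sym eq) (sym (m+[n∸m]≡n le))
        , q t , q (t + j) , inj₂ (+-cancelˡ-≡ (r (t + j)) _ _ (begin
            r (t + j) + (j * k + d + q t * n)    ≡⟨ shuffle (r (t + j)) d (j * k) (q t * n) ⟩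
            (r (t + j) + d + q t * n) + j * k    ≡⟨ cong (λ z → z + q t * n + j * k) (m+[n∸m]≡n le) ⟩
            (r t + q t * n) + j * k              ≡⟨ cong (_+ j * k) (rq t) ⟨
            t * k + j * k                        ≡⟨ *-distribʳ-+ k t j ⟨
            (t + j) * k                          ≡⟨ rq (t + j) ⟩
            r (t + j) + q (t + j) * n            ∎))
        where
        open ≡-Reasoning
        d = r t ∸ r (t + j)
        shuffle : ∀ a d b c → a + (b + d + c) ≡ (a + d + c) + b
        shuffle = solve-∀

    -- Pigeonhole: the Q + 1 multiples t k with 0 ≤ t ≤ Q have their residues in Q boxes, and j is
    -- the difference of two colliding values of t.
    dirichlet : 1 ≤ Q → ∃[ j ] ∃[ d ] (1 ≤ j × j ≤ Q × d * Q ≤ n × Near n (j * k) d)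
    dirichlet 1≤Q =
      let s , t , s<t , eq = Fin.pigeonhole (n<1+n Q) (λ i → fromℕ< (box< 1≤Q (toℕ i)))
          box≡ = trans (sym (Fin.toℕ-fromℕ< (box< 1≤Q (toℕ s))))
                   (trans (cong toℕ eq) (Fin.toℕ-fromℕ< (box< 1≤Q (toℕ t))))
          j = toℕ t ∸ toℕ s
          s+j≡t = m+[n∸m]≡n (<⇒≤ s<t)
          d , d≤ , near = assemble (toℕ s) j (trans box≡ (cong box (sym s+j≡t))) (≤-total _ _)
      in j , d , m<n⇒0<n∸m s<t
       , ≤-trans (m∸n≤m (toℕ t) (toℕ s)) (Fin.toℕ≤pred[n] t) , d≤ , near

module Bounds where

  open import Data.Rational.Base
  open import Data.Rational.Solver using (module +-*-Solver)
  open +-*-Solver using (solve; con; _:=_; _:+_; _:*_; _:-_; :-_)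
  open Dirichlet
  open D
    using (ℝ; seq; cauchy; Eventually; IsSpectrum; ℝ-commutativeRing; Multigraph; order; edges;
           multiplicity; P; _⊕_; leibniz; odd⁻¹; module Matrices)
  open Matrices (CommutativeRing.rawRing ℚ.+-*-commutativeRing)
  import Algebra.Properties.CommutativeMonoid.Sum ℚ.+-0-commutativeMonoid as Sums
  import Algebra.Properties.Semiring.Sum (CommutativeRing.semiring ℚ.+-*-commutativeRing) as ScaledSums

  -- Rational arithmetic

  0≤+ : ∀ {p q} → 0ℚ ≤ p → 0ℚ ≤ q → 0ℚ ≤ p + q
  0≤+ {p} {q} = ℚ.+-mono-≤ {0ℚ} {p} {0ℚ} {q}

  0<+≤ : ∀ {p q} → 0ℚ < p → 0ℚ ≤ q → 0ℚ < p + q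
  0<+≤ {p} {q} = ℚ.+-mono-<-≤ {0ℚ} {p} {0ℚ} {q}

  0<+ : ∀ {p q} → 0ℚ < p → 0ℚ < q → 0ℚ < p + q
  0<+ 0<p 0<q = 0<+≤ 0<p (ℚ.<⇒≤ 0<q)

  0≤* : ∀ {p q} → 0ℚ ≤ p → 0ℚ ≤ q → 0ℚ ≤ p * q
  0≤* {p} {q} 0≤p 0≤q = subst (_≤ p * q) (ℚ.*-zeroʳ p)
    (ℚ.*-monoˡ-≤-nonNeg p {{nonNegative 0≤p}} 0≤q)

  0<* : ∀ {p q} → 0ℚ < p → 0ℚ < q → 0ℚ < p * q
  0<* {p} {q} 0<p 0<q = subst (_< p * q) (ℚ.*-zeroʳ p)
    (ℚ.*-monoʳ-<-pos p {{positive 0<p}} 0<q)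

  ≤⇒0≤ : ∀ {p q} → p ≤ q → 0ℚ ≤ q - p
  ≤⇒0≤ {p} {q} p≤q = subst (_≤ q - p) (ℚ.+-inverseʳ p) (ℚ.+-monoˡ-≤ (- p) p≤q)

  <⇒0< : ∀ {p q} → p < q → 0ℚ < q - p
  <⇒0< {p} {q} p<q = subst (_< q - p) (ℚ.+-inverseʳ p) (ℚ.+-monoˡ-< (- p) p<q)

  -- Inequalities are proved by exhibiting q - p as an expression e that is visibly nonnegative.
  ≤-by : ∀ {p q e} → 0ℚ ≤ e → p + e ≡ q → p ≤ q
  ≤-by {p} {q} {e} 0≤e eq = subst₂ _≤_ (ℚ.+-identityʳ p) eq (ℚ.+-monoʳ-≤ p 0≤e)

  <-by : ∀ {p q e} → 0ℚ < e → p + e ≡ q → p < q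
  <-by {p} {q} {e} 0<e eq = subst₂ _<_ (ℚ.+-identityʳ p) eq (ℚ.+-monoʳ-< p 0<e)

  0≤-by : ∀ {p q} → 0ℚ ≤ p → p ≡ q → 0ℚ ≤ q
  0≤-by 0≤p refl = 0≤p

  0≤sq : ∀ p → 0ℚ ≤ p * p
  0≤sq p with ℚ.≤-total 0ℚ p
  ... | inj₁ 0≤p = 0≤* 0≤p 0≤p
  ... | inj₂ p≤0 = 0≤-by (0≤* (≤⇒0≤ p≤0) (≤⇒0≤ p≤0))
    (solve 1 (λ p → (con 0ℚ :- p) :* (con 0ℚ :- p) := p :* p) refl p)

  <⇒≱ : ∀ {p q} → p < q → ¬ q ≤ p
  <⇒≱ p<q q≤p = ℚ.<-irrefl refl (ℚ.<-≤-trans p<q q≤p)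

  0<1 : 0ℚ < 1ℚ
  0<1 = ℚ.positive⁻¹ 1ℚ

  0≤1 : 0ℚ ≤ 1ℚ
  0≤1 = ℚ.<⇒≤ 0<1

  0<½ : 0ℚ < ½
  0<½ = ℚ.positive⁻¹ ½

  *-cancel-≤ : ∀ {r p q} → 0ℚ < r → r * p ≤ r * q → p ≤ q
  *-cancel-≤ {r} 0<r = ℚ.*-cancelˡ-≤-pos r {{positive 0<r}}

  *-mono-≤ : ∀ {p q r s} → 0ℚ ≤ p → 0ℚ ≤ r → p ≤ q → r ≤ s → p * r ≤ q * s
  *-mono-≤ {p} {q} {r} {s} 0≤p 0≤r p≤q r≤s = ℚ.≤-trans
    (ℚ.*-monoˡ-≤-nonNeg p {{nonNegative 0≤p}} r≤s)
    (ℚ.*-monoʳ-≤-nonNeg s {{nonNegative (ℚ.≤-trans 0≤r r≤s)}} p≤q)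

  p≤∣p∣ : ∀ p → p ≤ ∣ p ∣
  p≤∣p∣ p with ℚ.≤-total 0ℚ p
  ... | inj₁ 0≤p = ℚ.≤-reflexive (sym (ℚ.0≤p⇒∣p∣≡p 0≤p))
  ... | inj₂ p≤0 = ℚ.≤-trans p≤0 (ℚ.0≤∣p∣ p)

  ∣-∣≤⇒≤ : ∀ {p q ε} → ∣ p - q ∣ ≤ ε → p ≤ q + ε
  ∣-∣≤⇒≤ {p} {q} {ε} h = ≤-by (≤⇒0≤ (ℚ.≤-trans (p≤∣p∣ (p - q)) h))
    (solve 3 (λ p q ε → p :+ (ε :- (p :- q)) := q :+ ε) refl p q ε)

  ∣-∣≤⇒≥ : ∀ {p q ε} → ∣ p - q ∣ ≤ ε → q ≤ p + ε
  ∣-∣≤⇒≥ {p} {q} {ε} h = ∣-∣≤⇒≤ (subst (_≤ ε) (trans (sym (ℚ.∣-p∣≡∣p∣ (p - q)))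
    (cong ∣_∣ (solve 2 (λ p q → :- (p :- q) := q :- p) refl p q))) h)

  ∣∣≤-intro : ∀ {p b} → p ≤ b → - p ≤ b → ∣ p ∣ ≤ b
  ∣∣≤-intro {p} {b} p≤b -p≤b with ℚ.∣p∣≡p∨∣p∣≡-p p
  ... | inj₁ eq = subst (_≤ b) (sym eq) p≤b
  ... | inj₂ eq = subst (_≤ b) (sym eq) -p≤b

  ∣∣-+ : ∀ {p q b c} → ∣ p ∣ ≤ b → ∣ q ∣ ≤ c → ∣ p + q ∣ ≤ b + c
  ∣∣-+ {p} {q} h h′ = ℚ.≤-trans (ℚ.∣p+q∣≤∣p∣+∣q∣ p q) (ℚ.+-mono-≤ h h′)

  ∣∣-* : ∀ {p q b c} → ∣ p ∣ ≤ b → ∣ q ∣ ≤ c → ∣ p * q ∣ ≤ b * c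
  ∣∣-* {p} {q} h h′ = ℚ.≤-trans (ℚ.≤-reflexive (ℚ.∣p*q∣≡∣p∣*∣q∣ p q))
    (*-mono-≤ (ℚ.0≤∣p∣ p) (ℚ.0≤∣p∣ q) h h′)

  ∣∣-neg : ∀ {p b} → ∣ p ∣ ≤ b → ∣ - p ∣ ≤ b
  ∣∣-neg {p} {b} = subst (_≤ b) (sym (ℚ.∣-p∣≡∣p∣ p))

  ∣∣≤1-of-sq : ∀ p → p * p ≤ 1ℚ → ∣ p ∣ ≤ 1ℚ
  ∣∣≤1-of-sq p h = ℚ.≮⇒≥ λ 1<∣p∣ → ℚ.<-irrefl refl (ℚ.<-≤-trans
    (<-by (0<+ (0<* (<⇒0< 1<∣p∣) (ℚ.<-trans 0<1 1<∣p∣)) (<⇒0< 1<∣p∣))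
      (solve 1 (λ a → con 1ℚ :+ ((a :- con 1ℚ) :* a :+ (a :- con 1ℚ)) := a :* a) refl ∣ p ∣))
    (subst (_≤ 1ℚ) ∣p∣² h))
    where
    ∣p∣² : p * p ≡ ∣ p ∣ * ∣ p ∣
    ∣p∣² = trans (sym (ℚ.0≤p⇒∣p∣≡p (0≤sq p))) (ℚ.∣p*q∣≡∣p∣*∣q∣ p p)

  ι : ℕ → ℚ
  ι n = + n / 1

  ιᵘ : ∀ n → toℚᵘ (ι n) ℚᵘ.≃ ℚᵘ.mkℚᵘ (+ n) 0
  ιᵘ n = ℚ.toℚᵘ-fromℚᵘ (ℚᵘ.mkℚᵘ (+ n) 0)

  ι-+ : ∀ m n → ι (m ℕ.+ n) ≡ ι m + ι n
  ι-+ m n = ℚ.toℚᵘ-injective (ℚᵘ.≃-trans (ιᵘ (m ℕ.+ n)) (ℚᵘ.≃-trans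
    (ℚᵘ.*≡* (cong (ℤ._* + 1) (trans (ℤ.pos-+ m n)
      (sym (cong₂ ℤ._+_ (ℤ.*-identityʳ (+ m)) (ℤ.*-identityʳ (+ n)))))))
    (ℚᵘ.≃-sym (ℚᵘ.≃-trans (ℚ.toℚᵘ-homo-+ (ι m) (ι n)) (ℚᵘ.+-cong (ιᵘ m) (ιᵘ n))))))

  ι-* : ∀ m n → ι (m ℕ.* n) ≡ ι m * ι n
  ι-* m n = ℚ.toℚᵘ-injective (ℚᵘ.≃-trans (ιᵘ (m ℕ.* n)) (ℚᵘ.≃-trans
    (ℚᵘ.*≡* (cong (ℤ._* + 1) (ℤ.pos-* m n)))
    (ℚᵘ.≃-sym (ℚᵘ.≃-trans (ℚ.toℚᵘ-homo-* (ι m) (ι n)) (ℚᵘ.*-cong (ιᵘ m) (ιᵘ n))))))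

  ι-suc : ∀ n → ι (suc n) ≡ 1ℚ + ι n
  ι-suc n = ι-+ 1 n

  0≤ι : ∀ n → 0ℚ ≤ ι n
  0≤ι n = ℚ.nonNegative⁻¹ (ι n) {{ℚ.normalize-nonNeg n 1}}

  ι-mono : ∀ {m n} → m ℕ.≤ n → ι m ≤ ι n
  ι-mono {m} {n} m≤n = ≤-by (0≤ι (n ℕ.∸ m))
    (trans (sym (ι-+ m (n ℕ.∸ m))) (cong ι (ℕ.m+[n∸m]≡n m≤n)))

  1≤ι : ∀ {n} → 1 ℕ.≤ n → 1ℚ ≤ ι n
  1≤ι = ι-mono

  0<ι : ∀ {n} → 1 ℕ.≤ n → 0ℚ < ι n
  0<ι 1≤n = ℚ.<-≤-trans 0<1 (1≤ι 1≤n)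

  1/d*d : ∀ d .{{_ : ℕ.NonZero d}} → (+ 1 / d) * ι d ≡ 1ℚ
  1/d*d d@(suc d′) = ℚ.toℚᵘ-injective (ℚᵘ.≃-trans (ℚ.toℚᵘ-homo-* (+ 1 / d) (ι d))
    (ℚᵘ.≃-trans (ℚᵘ.*-cong (ℚ.toℚᵘ-fromℚᵘ (ℚᵘ.mkℚᵘ (+ 1) d′)) (ιᵘ d))
      (ℚᵘ.*≡* (trans (ℤ.*-identityʳ _) (trans (ℤ.*-identityˡ (+ d))
        (sym (trans (ℤ.*-identityˡ _) (cong +_ (ℕ.*-identityʳ d)))))))))

  -- Determinants: alternation, M-matrices and residual bounds

  module Determinant where

    private variable
      n : ℕ

    Row : ℕ → Set
    Row n = Fin n → ℚ

    sum-cong : {f g : Row n} → f ≗ g → sum f ≡ sum g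
    sum-cong = Sums.sum-cong-≗

    *-sum : (a : ℚ) (f : Row n) → a * sum f ≡ sum λ i → a * f i
    *-sum = ScaledSums.*-distribˡ-sum

    sum-* : (f : Row n) (a : ℚ) → sum f * a ≡ sum λ i → f i * a
    sum-* f a = ScaledSums.*-distribʳ-sum a f

    sum-comm : ∀ {m} (f : Fin m → Fin n → ℚ) → sum (λ i → sum (f i)) ≡ sum λ j → sum λ i → f i j
    sum-comm = Sums.∑-comm

    sum-mono : {f g : Row n} → (∀ i → f i ≤ g i) → sum f ≤ sum g
    sum-mono {zero}  h = ℚ.≤-refl
    sum-mono {suc n} h = ℚ.+-mono-≤ (h zero) (sum-mono (h ∘ suc))

    sum-zero : {f : Row n} → (∀ i → f i ≡ 0ℚ) → sum f ≡ 0ℚ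
    sum-zero {zero}  h = refl
    sum-zero {suc n} h = cong₂ _+_ (h zero) (sum-zero (h ∘ suc))

    0≤sum : {f : Row n} → (∀ i → 0ℚ ≤ f i) → 0ℚ ≤ sum f
    0≤sum {zero}  h = ℚ.≤-refl
    0≤sum {suc n} h = 0≤+ (h zero) (0≤sum (h ∘ suc))

    ∣sum∣≤ : {f : Row n} {b : ℚ} → (∀ i → ∣ f i ∣ ≤ b) → ∣ sum f ∣ ≤ ι n * b
    ∣sum∣≤ {zero}  {b = b} h = ℚ.≤-reflexive (sym (ℚ.*-zeroˡ b))
    ∣sum∣≤ {suc n} {b = b} h = ℚ.≤-trans (∣∣-+ (h zero) (∣sum∣≤ (h ∘ suc)))
      (ℚ.≤-reflexive (trans
        (solve 2 (λ b m → b :+ m :* b := (con 1ℚ :+ m) :* b) refl b (ι n))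
        (cong (_* b) (sym (ι-suc n)))))

    -- The expanded row u is kept apart from the minors h, so that another row can be put in its
    -- place while the minors stay.
    laplace : Row n → Row n → ℚ
    laplace u h = sum λ j → (- 1ℚ) ^ toℕ j * (u j * h j)

    minor : Matrix (suc n) → Row (suc n)
    minor M j = det λ p q → M (suc p) (punchIn j q)

    laplace-cong : {u u′ h h′ : Row n} → u ≗ u′ → h ≗ h′ → laplace u h ≡ laplace u′ h′
    laplace-cong eq eq′ = sum-cong λ j →
      cong₂ (λ a b → (- 1ℚ) ^ toℕ j * (a * b)) (eq j) (eq′ j)

    laplace-suc : (u h : Row (suc n)) →
      laplace u h ≡ u zero * h zero - laplace (u ∘ suc) (h ∘ suc)
    laplace-suc u h = cong₂ _+_ (ℚ.*-identityˡ (u zero * h zero)) $ trans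
      (sum-cong λ j → ℚ.*-assoc (- 1ℚ) ((- 1ℚ) ^ toℕ j) (u (suc j) * h (suc j)))
      (trans (sym (*-sum (- 1ℚ) λ j → (- 1ℚ) ^ toℕ j * (u (suc j) * h (suc j))))
        (solve 1 (λ x → con (- 1ℚ) :* x := :- x) refl (laplace (u ∘ suc) (h ∘ suc))))

    laplace-linear : (a : ℚ) (u h h′ : Row n) →
      laplace u (λ j → a * h j - h′ j) ≡ a * laplace u h - laplace u h′
    laplace-linear {zero}  a u h h′ = solve 1 (λ a → con 0ℚ := a :* con 0ℚ :- con 0ℚ) refl a
    laplace-linear {suc n} a u h h′ = begin
      laplace u (λ j → a * h j - h′ j)
        ≡⟨ laplace-suc u (λ j → a * h j - h′ j) ⟩
      u zero * (a * h zero - h′ zero) - laplace (u ∘ suc) (λ j → a * h (suc j) - h′ (suc j))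
        ≡⟨ cong (λ z → u zero * (a * h zero - h′ zero) - z)
             (laplace-linear a (u ∘ suc) (h ∘ suc) (h′ ∘ suc)) ⟩
      u zero * (a * h zero - h′ zero) - (a * x - x′)
        ≡⟨ solve 6 (λ a u h h′ x x′ → u :* (a :* h :- h′) :- (a :* x :- x′)
             := a :* (u :* h :- x) :- (u :* h′ :- x′)) refl a (u zero) (h zero) (h′ zero) x x′ ⟩
      a * (u zero * h zero - x) - (u zero * h′ zero - x′)
        ≡⟨ cong₂ (λ y y′ → a * y - y′) (laplace-suc u h) (laplace-suc u h′) ⟨
      a * laplace u h - laplace u h′ ∎
      where
      open ≡-Reasoning
      x  = laplace (u ∘ suc) (h ∘ suc)
      x′ = laplace (u ∘ suc) (h′ ∘ suc)

    -- Expansion along two rows at once. `D` stands for the determinant of the remaining rows as a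
    -- function of the choice of columns; column choices are functions compared pointwise, hence
    -- `Extensional`.
    laplace₂ : (u v : Row (suc (suc n))) → ((Fin n → Fin (suc (suc n))) → ℚ) → ℚ
    laplace₂ u v D = laplace u λ j → laplace (v ∘ punchIn j) λ q → D (punchIn j ∘ punchIn q)

    Extensional : ((Fin n → Fin (suc (suc n))) → ℚ) → Set
    Extensional D = ∀ f g → f ≗ g → D f ≡ D g

    lift : ∀ {m} → (Fin n → Fin m) → Fin (suc n) → Fin (suc m)
    lift f zero    = zero
    lift f (suc i) = suc (f i)

    -- Three cases for column zero: u takes it, v takes it, or neither does. The first two leave the
    -- same columns for `D`; in the third column zero survives in every remaining minor, which is
    -- what `lift` records.
    laplace₂-suc : (u v : Row (suc (suc (suc n)))) (D : _) → Extensional D →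
      laplace₂ u v D ≡
        u zero * laplace (v ∘ suc) (λ j → D (suc ∘ punchIn j))
        - (v zero * laplace (u ∘ suc) (λ j → D (suc ∘ punchIn j))
           - laplace₂ (u ∘ suc) (v ∘ suc) (D ∘ lift))
    laplace₂-suc {n} u v D ext = begin
      laplace₂ u v D
        ≡⟨ laplace-suc u inner ⟩
      u zero * inner zero - laplace (u ∘ suc) (inner ∘ suc)
        ≡⟨ cong (λ z → u zero * inner zero - z) (trans
             (laplace-cong {u = u ∘ suc} (λ _ → refl) inner-suc)
             (laplace-linear (v zero) (u ∘ suc) (λ j → D (suc ∘ punchIn j)) inner′)) ⟩
      u zero * inner zero
      - (v zero * laplace (u ∘ suc) (λ j → D (suc ∘ punchIn j)) - laplace (u ∘ suc) inner′) ∎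
      where
      open ≡-Reasoning

      inner : Row (suc (suc (suc n)))
      inner j = laplace (v ∘ punchIn j) λ q → D (punchIn j ∘ punchIn q)

      inner′ : Row (suc (suc n))
      inner′ j = laplace (v ∘ suc ∘ punchIn j) λ q → D (lift (punchIn j ∘ punchIn q))

      inner-suc : ∀ j → inner (suc j) ≡ v zero * D (suc ∘ punchIn j) - inner′ j
      inner-suc j = trans
        (laplace-suc (v ∘ punchIn (suc j)) λ q → D (punchIn (suc j) ∘ punchIn q))
        (cong (λ z → v zero * D (suc ∘ punchIn j) - z)
          (laplace-cong {u = v ∘ suc ∘ punchIn j} (λ _ → refl) λ q →
            ext (punchIn (suc j) ∘ punchIn (suc q)) (lift (punchIn j ∘ punchIn q))
              λ { zero → refl ; (suc _) → refl }))

    -- In `laplace₂-suc` the first two terms trade places with a change of sign when u and v are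
    -- swapped, and the last term is antisymmetric by induction on the number of columns.
    laplace₂-antisym : (u v : Row (suc (suc n))) (D : _) → Extensional D →
      laplace₂ u v D ≡ - laplace₂ v u D
    laplace₂-antisym {zero} u v D ext = begin
      laplace₂ u v D
        ≡⟨ expand u v ⟩
      u zero * (v (suc zero) * d) - u (suc zero) * (v zero * d)
        ≡⟨ solve 5 (λ a a′ b b′ d → a :* (b′ :* d) :- a′ :* (b :* d)
             := :- (b :* (a′ :* d) :- b′ :* (a :* d))) refl
             (u zero) (u (suc zero)) (v zero) (v (suc zero)) d ⟩
      - (v zero * (u (suc zero) * d) - v (suc zero) * (u zero * d))
        ≡⟨ cong -_ (expand v u) ⟨
      - laplace₂ v u D ∎
      where
      open ≡-Reasoning
      d = D λ ()

      laplace-one : (u h : Row 1) → h zero ≡ d → laplace u h ≡ u zero * d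
      laplace-one u h eq = trans
        (solve 2 (λ a b → con 1ℚ :* (a :* b) :+ con 0ℚ := a :* b) refl (u zero) (h zero))
        (cong (u zero *_) eq)

      expand : ∀ u v → laplace₂ u v D ≡ u zero * (v (suc zero) * d) - u (suc zero) * (v zero * d)
      expand u v = trans (laplace-suc u inner) (cong₂ (λ a b → u zero * a - b)
        (laplace-one (v ∘ suc) (λ q → D (punchIn zero ∘ punchIn q)) (ext _ _ λ ()))
        (trans (laplace-suc (u ∘ suc) (inner ∘ suc)) (trans
          (solve 1 (λ a → a :- con 0ℚ := a) refl (u (suc zero) * inner (suc zero)))
          (cong (u (suc zero) *_)
            (laplace-one (v ∘ punchIn (suc zero)) (λ q → D (punchIn (suc zero) ∘ punchIn q))
              (ext _ _ λ ()))))))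
        where
        inner : Row 2
        inner j = laplace (v ∘ punchIn j) λ q → D (punchIn j ∘ punchIn q)
    laplace₂-antisym {suc n} u v D ext = begin
      laplace₂ u v D
        ≡⟨ laplace₂-suc u v D ext ⟩
      u zero * X v - (v zero * X u - laplace₂ (u ∘ suc) (v ∘ suc) (D ∘ lift))
        ≡⟨ cong (λ z → u zero * X v - (v zero * X u - z))
             (laplace₂-antisym (u ∘ suc) (v ∘ suc) (D ∘ lift) λ f g eq →
               ext (lift f) (lift g) λ { zero → refl ; (suc i) → cong suc (eq i) }) ⟩
      u zero * X v - (v zero * X u - - S)
        ≡⟨ solve 3 (λ a b s → a :- (b :- :- s) := :- (b :- (a :- s))) refl
             (u zero * X v) (v zero * X u) S ⟩
      - (v zero * X u - (u zero * X v - S))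
        ≡⟨ cong -_ (laplace₂-suc v u D ext) ⟨
      - laplace₂ v u D ∎
      where
      open ≡-Reasoning
      X : Row _ → ℚ
      X w = laplace (w ∘ suc) (λ j → D (suc ∘ punchIn j))
      S = laplace₂ (v ∘ suc) (u ∘ suc) (D ∘ lift)

    det-cong : {M N : Matrix n} → (∀ i j → M i j ≡ N i j) → det M ≡ det N
    det-cong {zero}  eq = refl
    det-cong {suc n} {M} {N} eq = laplace-cong {u = M zero} (eq zero) λ j →
      det-cong λ p q → eq (suc p) (punchIn j q)

    swapTop : Matrix (suc (suc n)) → Matrix (suc (suc n))
    swapTop M zero          = M (suc zero)
    swapTop M (suc zero)    = M zero
    swapTop M (suc (suc i)) = M (suc (suc i))

    det-swapTop : (M : Matrix (suc (suc n))) → det (swapTop M) ≡ - det M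
    det-swapTop M = laplace₂-antisym (M (suc zero)) (M zero)
      (λ f → det λ p q → M (suc (suc p)) (f q))
      λ f g eq → det-cong λ p q → cong (M (suc (suc p))) (eq q)

    p≡-p⇒p≡0 : ∀ p → p ≡ - p → p ≡ 0ℚ
    p≡-p⇒p≡0 p eq = begin
      p                 ≡⟨ solve 1 (λ p → p := con ½ :* (p :+ p)) refl p ⟩
      ½ * (p + p)       ≡⟨ cong (λ z → ½ * (p + z)) eq ⟩
      ½ * (p - p)       ≡⟨ solve 1 (λ p → con ½ :* (p :- p) := con 0ℚ) refl p ⟩
      0ℚ                ∎
      where open ≡-Reasoning

    det-equalRows : (M : Matrix (suc n)) (i : Fin n) → M zero ≗ M (suc i) → det M ≡ 0ℚ
    det-equalRows M zero eq = p≡-p⇒p≡0 (det M) (trans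
      (det-cong {M = M} {N = swapTop M} λ { zero j → eq j ; (suc zero) j → sym (eq j) ;
        (suc (suc i)) j → refl })
      (det-swapTop M))
    -- Swapping the top rows moves row zero into all minors of the expansion, where it still equals
    -- another row; so every minor vanishes by induction.
    det-equalRows M (suc i) eq = trans
      (sym (trans (cong -_ (det-swapTop M)) (solve 1 (λ p → :- (:- p) := p) refl (det M))))
      (cong -_ (sum-zero λ j → trans
        (cong (λ z → (- 1ℚ) ^ toℕ j * (M (suc zero) j * z))
          (det-equalRows (λ p q → swapTop M (suc p) (punchIn j q)) i λ q → eq (punchIn j q)))
        (solve 2 (λ s a → s :* (a :* con 0ℚ) := con 0ℚ) refl ((- 1ℚ) ^ toℕ j) (M (suc zero) j))))

    cofactor : Matrix (suc n) → Row (suc n)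
    cofactor M j = (- 1ℚ) ^ toℕ j * minor M j

    cofactor-laplace : (M : Matrix (suc n)) (u : Row (suc n)) →
      sum (λ j → u j * cofactor M j) ≡ laplace u (minor M)
    cofactor-laplace M u = sum-cong λ j →
      solve 3 (λ u s m → u :* (s :* m) := s :* (u :* m)) refl (u j) ((- 1ℚ) ^ toℕ j) (minor M j)

    cofactor-zero : (M : Matrix (suc n)) → sum (λ j → M zero j * cofactor M j) ≡ det M
    cofactor-zero M = cofactor-laplace M (M zero)

    -- The sum is the determinant of the matrix whose row zero has been overwritten by row `suc i`,
    -- which has a repeated row.
    cofactor-suc : (M : Matrix (suc n)) (i : Fin n) →
      sum (λ j → M (suc i) j * cofactor M j) ≡ 0ℚ
    cofactor-suc M i = trans (cofactor-laplace M (M (suc i)))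
      (det-equalRows (λ { zero → M (suc i) ; (suc p) → M (suc p) }) i λ _ → refl)

    argmax : (v : Row (suc n)) → ∃[ i ] (∀ j → v j ≤ v i)
    argmax {zero} v = zero , λ { zero → ℚ.≤-refl }
    argmax {suc n} v with argmax (v ∘ suc)
    ... | i , max with ℚ.≤-total (v zero) (v (suc i))
    ...   | inj₁ le = suc i , λ { zero → le ; (suc j) → max j }
    ...   | inj₂ ge = zero , λ { zero → ℚ.≤-refl ; (suc j) → ℚ.≤-trans (max j) ge }

    0<^ : ∀ {p} n → 0ℚ < p → 0ℚ < p ^ n
    0<^ zero    0<p = 0<1
    0<^ (suc n) 0<p = 0<* 0<p (0<^ n 0<p)

    -- The cofactors of the first row form a vector v with M v = det M · e₀ and v₀ > 0 by induction;
    -- the maximum principle, applied where v is largest, bounds det M.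
    det-mMatrix : ∀ {δ} → 0ℚ < δ → (M : Matrix n) → (∀ i j → i ≢ j → M i j ≤ 0ℚ) →
      (∀ i → δ ≤ sum (M i)) → δ ^ n ≤ det M
    det-mMatrix {zero}  0<δ M off rows = ℚ.≤-refl
    det-mMatrix {suc n} {δ} 0<δ M off rows = go (argmax v)
      where
      v = cofactor M

      v₀ : δ ^ n ≤ v zero
      v₀ = subst (δ ^ n ≤_) (sym (ℚ.*-identityˡ (minor M zero)))
        (det-mMatrix 0<δ (λ p q → M (suc p) (suc q))
          (λ i j i≢j → off (suc i) (suc j) (i≢j ∘ Fin.suc-injective))
          -- Deleting column zero removes a nonpositive off-diagonal entry, so the row sums of the
          -- minor stay at least δ.
          λ i → ≤-by (0≤+ (≤⇒0≤ (rows (suc i))) (≤⇒0≤ (off (suc i) zero λ ())))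
            (solve 3 (λ δ a s → δ :+ ((a :+ s) :- δ :+ (con 0ℚ :- a)) := s) refl
              δ (M (suc i) zero) (sum λ j → M (suc i) (suc j))))

      atMax : ∀ i → (∀ j → v j ≤ v i) → v i * sum (M i) ≤ sum (λ j → M i j * v j)
      atMax i max = subst (_≤ sum λ j → M i j * v j) (sym (*-sum (v i) (M i)))
        (sum-mono term)
        where
        term : ∀ j → v i * M i j ≤ M i j * v j
        term j with i Fin.≟ j
        ... | yes refl = ℚ.≤-reflexive (ℚ.*-comm (v i) (M i j))
        ... | no i≢j = ≤-by (0≤* (≤⇒0≤ (off i j i≢j)) (≤⇒0≤ (max j)))
          (solve 3 (λ m a b → b :* m :+ (con 0ℚ :- m) :* (b :- a) := m :* a) refl
            (M i j) (v j) (v i))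

      lower : ∀ i → (∀ j → v j ≤ v i) → δ ^ suc n ≤ sum (λ j → M i j * v j)
      lower i max = ℚ.≤-trans
        (subst (_≤ v i * sum (M i)) (ℚ.*-comm (δ ^ n) δ)
          (*-mono-≤ (ℚ.<⇒≤ (0<^ n 0<δ)) (ℚ.<⇒≤ 0<δ) (ℚ.≤-trans v₀ (max zero)) (rows i)))
        (atMax i max)

      go : ∃[ i ] (∀ j → v j ≤ v i) → δ ^ suc n ≤ det M
      go (zero  , max) = subst (δ ^ suc n ≤_) (cofactor-zero M) (lower zero max)
      -- Outside row zero the product of M with v vanishes, whereas at a maximum of v it would be at
      -- least the positive number δ ^ suc n.
      go (suc i , max) = ⊥-elim (<⇒≱ (0<^ (suc n) 0<δ)
        (subst (δ ^ suc n ≤_) (cofactor-suc M i) (lower (suc i) max)))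

    ∣sign∣≤1 : ∀ m → ∣ (- 1ℚ) ^ m ∣ ≤ 1ℚ
    ∣sign∣≤1 zero    = ℚ.≤-refl
    ∣sign∣≤1 (suc m) = ∣∣-* {p = - 1ℚ} {q = (- 1ℚ) ^ m} {b = 1ℚ} {c = 1ℚ} ℚ.≤-refl (∣sign∣≤1 m)

    -- This is n! Kⁿ, with the factors arranged as in the expansion; 1ℚ bounds the sign.
    detBound : ℚ → ℕ → ℚ
    detBound K zero    = 1ℚ
    detBound K (suc n) = ι (suc n) * (1ℚ * (K * detBound K n))

    ∣det∣≤ : ∀ {K} (M : Matrix n) → (∀ i j → ∣ M i j ∣ ≤ K) → ∣ det M ∣ ≤ detBound K n
    ∣det∣≤ {zero}  M h = ℚ.≤-refl
    ∣det∣≤ {suc n} {K} M h = ∣sum∣≤ λ j → ∣∣-* (∣sign∣≤1 (toℕ j))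
      (∣∣-* (h zero j) (∣det∣≤ (λ p q → M (suc p) (punchIn j q)) λ p q → h (suc p) (punchIn j q)))

    -- Adding multiples of the other rows to row zero does not change the determinant, and w₀ = 1
    -- keeps row zero itself unscaled.
    det-combination : (M : Matrix (suc n)) (w : Row (suc n)) → w zero ≡ 1ℚ →
      det M ≡ sum λ j → sum (λ i → w i * M i j) * cofactor M j
    det-combination M w w₀ = begin
      det M
        ≡⟨ solve 1 (λ d → d := con 1ℚ :* d :+ con 0ℚ) refl (det M) ⟩
      1ℚ * det M + 0ℚ
        ≡⟨ cong₂ _+_ (cong₂ _*_ w₀ (cofactor-zero M))
             (sum-zero λ i → trans (cong (w (suc i) *_) (cofactor-suc M i)) (ℚ.*-zeroʳ (w (suc i)))) ⟨
      sum (λ i → w i * sum λ j → M i j * cofactor M j)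
        ≡⟨ sum-cong (λ i → *-sum (w i) λ j → M i j * cofactor M j) ⟩
      sum (λ i → sum λ j → w i * (M i j * cofactor M j))
        ≡⟨ sum-comm (λ i j → w i * (M i j * cofactor M j)) ⟩
      sum (λ j → sum λ i → w i * (M i j * cofactor M j))
        ≡⟨ sum-cong (λ j → trans
             (sum-cong λ i → sym (ℚ.*-assoc (w i) (M i j) (cofactor M j)))
             (sym (sum-* (λ i → w i * M i j) (cofactor M j)))) ⟩
      sum (λ j → sum (λ i → w i * M i j) * cofactor M j) ∎
      where open ≡-Reasoning

    -- An approximate left null vector forces a small determinant. The condition on toℕ i expresses
    -- that i is the first index when n is not literally a successor, as for n + n.
    ∣det∣≤residual : ∀ {K ρ} (M : Matrix n) (w : Row n) (i : Fin n) → toℕ i ≡ 0 → w i ≡ 1ℚ →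
      (∀ i j → ∣ M i j ∣ ≤ K) → (∀ j → ∣ sum (λ i → w i * M i j) ∣ ≤ ρ) →
      ∣ det M ∣ ≤ ι n * (ρ * (1ℚ * detBound K (ℕ.pred n)))
    ∣det∣≤residual M w zero _ w₀ h r = subst (λ z → ∣ z ∣ ≤ _) (sym (det-combination M w w₀))
      (∣sum∣≤ λ j → ∣∣-* (r j) (∣∣-* (∣sign∣≤1 (toℕ j))
        (∣det∣≤ (λ p q → M (suc p) (punchIn j q)) λ p q → h (suc p) (punchIn j q))))

  open Determinant

  -- Rational rotations

  -- (c + √-σ)ᵗ = f t + g t √-σ. With c = cos ψ and σ = sin² ψ this is f t = cos (t ψ) and
  -- g t = sin (t ψ) / sin ψ, while all values stay rational.
  module Rotation (c σ : ℚ) where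

    f g : ℕ → ℚ
    f zero    = 1ℚ
    f (suc t) = c * f t - σ * g t
    g zero    = 0ℚ
    g (suc t) = c * g t + f t

    -- This is cos (2tψ), hence close to cos (2πt/n) when ψ is close to π/n. The double angle makes
    -- 1 - F t equal to 2 sin² (tψ), see `F-g`.
    F : ℕ → ℚ
    F t = f (t ℕ.+ t)

    module Laws (c²+σ≡1 : c * c + σ ≡ 1ℚ) where

      f²+σg²≡1 : ∀ t → f t * f t + σ * (g t * g t) ≡ 1ℚ
      f²+σg²≡1 zero    = solve 1 (λ s → con 1ℚ :* con 1ℚ :+ s :* (con 0ℚ :* con 0ℚ) := con 1ℚ) refl σ
      f²+σg²≡1 (suc t) = trans
        (solve 4 (λ c s f g →
            (c :* f :- s :* g) :* (c :* f :- s :* g) :+ s :* ((c :* g :+ f) :* (c :* g :+ f))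
            := (c :* c :+ s) :* (f :* f :+ s :* (g :* g))) refl c σ (f t) (g t))
        (cong₂ _*_ c²+σ≡1 (f²+σg²≡1 t))

      g-suc-suc : ∀ t → g (suc (suc t)) ≡ (c + c) * g (suc t) - g t
      g-suc-suc t = trans
        (solve 4 (λ c s f g → c :* (c :* g :+ f) :+ (c :* f :- s :* g)
            := (c :+ c) :* (c :* g :+ f) :- (c :* c :+ s) :* g) refl c σ (f t) (g t))
        (cong (λ z → (c + c) * g (suc t) - z) (trans (cong (_* g t) c²+σ≡1) (ℚ.*-identityˡ (g t))))

      f-+ : ∀ x y → f (x ℕ.+ y) ≡ f x * f y - σ * (g x * g y)
      g-+ : ∀ x y → g (x ℕ.+ y) ≡ g x * f y + f x * g y
      f-+ zero y = solve 3 (λ s f g → f := con 1ℚ :* f :- s :* (con 0ℚ :* g)) refl σ (f y) (g y)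
      f-+ (suc x) y = trans (cong₂ (λ a b → c * a - σ * b) (f-+ x y) (g-+ x y))
        (solve 6 (λ c s f g f′ g′ →
            c :* (f :* f′ :- s :* (g :* g′)) :- s :* (g :* f′ :+ f :* g′)
            := (c :* f :- s :* g) :* f′ :- s :* ((c :* g :+ f) :* g′))
          refl c σ (f x) (g x) (f y) (g y))
      g-+ zero y = solve 2 (λ f g → g := con 0ℚ :* f :+ con 1ℚ :* g) refl (f y) (g y)
      g-+ (suc x) y = trans (cong₂ (λ a b → c * a + b) (g-+ x y) (f-+ x y))
        (solve 6 (λ c s f g f′ g′ →
            c :* (g :* f′ :+ f :* g′) :+ (f :* f′ :- s :* (g :* g′))
            := (c :* g :+ f) :* f′ :+ (c :* f :- s :* g) :* g′)
          refl c σ (f x) (g x) (f y) (g y))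

      f-unrotate : ∀ x v → f x ≡ f (x ℕ.+ v) * f v + σ * (g (x ℕ.+ v) * g v)
      f-unrotate x v = sym (trans
        (cong₂ (λ a b → a * f v + σ * (b * g v)) (f-+ x v) (g-+ x v))
        (trans
          (solve 5 (λ s f g f′ g′ →
              (f :* f′ :- s :* (g :* g′)) :* f′ :+ s :* ((g :* f′ :+ f :* g′) :* g′)
              := f :* (f′ :* f′ :+ s :* (g′ :* g′)))
            refl σ (f x) (g x) (f v) (g v))
          (trans (cong (f x *_) (f²+σg²≡1 v)) (ℚ.*-identityʳ (f x)))))

      -- The formula cos (α + β) + cos (α - β) = 2 cos α cos β: samples of a cosine satisfy the
      -- eigenvector equation of a cycle with step s.
      F-sum : ∀ x s → F (x ℕ.+ (s ℕ.+ s)) + F x ≡ ι 2 * F s * F (x ℕ.+ s)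
      F-sum x s = begin
        F (x ℕ.+ (s ℕ.+ s)) + F x
          ≡⟨ cong (λ t → f t + F x) (ℕ-shuffle x s) ⟩
        f (X ℕ.+ S ℕ.+ S) + f X
          ≡⟨ cong₂ _+_ (f-+ (X ℕ.+ S) S) (f-unrotate X S) ⟩
        (f (X ℕ.+ S) * f S - σ * (g (X ℕ.+ S) * g S)) + (f (X ℕ.+ S) * f S + σ * (g (X ℕ.+ S) * g S))
          ≡⟨ solve 3 (λ a b s → (a :* b :- s) :+ (a :* b :+ s) := con (ι 2) :* b :* a) refl
               (f (X ℕ.+ S)) (f S) (σ * (g (X ℕ.+ S) * g S)) ⟩
        ι 2 * F s * f (X ℕ.+ S)
          ≡⟨ cong (λ t → ι 2 * F s * f t) (ℕ-shuffle′ x s) ⟩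
        ι 2 * F s * F (x ℕ.+ s) ∎
        where
        open ≡-Reasoning
        X = x ℕ.+ x
        S = s ℕ.+ s
        ℕ-shuffle : ∀ x s → (x ℕ.+ (s ℕ.+ s)) ℕ.+ (x ℕ.+ (s ℕ.+ s)) ≡
          x ℕ.+ x ℕ.+ (s ℕ.+ s) ℕ.+ (s ℕ.+ s)
        ℕ-shuffle = ℕ-Solver.solve-∀
        ℕ-shuffle′ : ∀ x s → x ℕ.+ x ℕ.+ (s ℕ.+ s) ≡ (x ℕ.+ s) ℕ.+ (x ℕ.+ s)
        ℕ-shuffle′ = ℕ-Solver.solve-∀

      F-g : ∀ t → F t ≡ 1ℚ - ι 2 * (σ * (g t * g t))
      F-g t = trans (f-+ t t) (trans
        (solve 2 (λ a b → a :- b := (a :+ b) :- con (ι 2) :* b) refl (f t * f t) (σ * (g t * g t)))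
        (cong (_- ι 2 * (σ * (g t * g t))) (f²+σg²≡1 t)))

      -- A difference of cosines is a product of sines. The factor g n is tiny for the chosen c, so
      -- F is almost n-periodic.
      F-shift : ∀ t n → F (t ℕ.+ n) - F t ≡ - ι 2 * (σ * g (t ℕ.+ t ℕ.+ n)) * g n
      F-shift t n = trans
        (cong₂ _-_ (trans (cong f (shuffle t n)) (f-+ (T ℕ.+ n) n)) (f-unrotate T n))
        (solve 4 (λ a s b c → (a :- s :* (b :* c)) :- (a :+ s :* (b :* c))
            := :- con (ι 2) :* (s :* b) :* c) refl (f (T ℕ.+ n) * f n) σ (g (T ℕ.+ n)) (g n))
        where
        T = t ℕ.+ t
        shuffle : ∀ t n → (t ℕ.+ n) ℕ.+ (t ℕ.+ n) ≡ t ℕ.+ t ℕ.+ n ℕ.+ n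
        shuffle = ℕ-Solver.solve-∀

      ∣f∣≤1 : 0ℚ ≤ σ → ∀ t → ∣ f t ∣ ≤ 1ℚ
      ∣f∣≤1 0≤σ t = ∣∣≤1-of-sq (f t) (≤-by (0≤* 0≤σ (0≤sq (g t))) (f²+σg²≡1 t))

      ∣σg∣≤1 : 0ℚ ≤ σ → ∀ t → ∣ σ * g t ∣ ≤ 1ℚ
      ∣σg∣≤1 0≤σ t = ∣∣≤1-of-sq (σ * g t) (≤-by
        (0≤+ (0≤+ (0≤sq (c * f t)) (0≤* 0≤σ (0≤sq (f t)))) (0≤* 0≤σ (0≤sq (c * g t))))
        (trans
          (solve 4 (λ c s f g → s :* g :* (s :* g) :+ (c :* f :* (c :* f) :+ s :* (f :* f)
                :+ s :* (c :* g :* (c :* g)))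
              := (c :* c :+ s) :* (f :* f :+ s :* (g :* g))) refl c σ (f t) (g t))
          (cong₂ _*_ c²+σ≡1 (f²+σg²≡1 t))))

      F-almostPeriodic : 0ℚ ≤ σ → ∀ n t q → ∣ F (t ℕ.+ q ℕ.* n) - F t ∣ ≤ ι q * (ι 2 * ∣ g n ∣)
      F-almostPeriodic 0≤σ n t zero = ℚ.≤-reflexive (trans
        (cong ∣_∣ (trans (cong (λ s → F s - F t) (ℕ.+-identityʳ t)) (ℚ.+-inverseʳ (F t))))
        (sym (ℚ.*-zeroˡ (ι 2 * ∣ g n ∣))))
      F-almostPeriodic 0≤σ n t (suc q) = subst₂ _≤_
        (cong ∣_∣ (trans
          (cong (λ s → (F s - F (t ℕ.+ n)) + (F (t ℕ.+ n) - F t)) (ℕ.+-assoc t n (q ℕ.* n)))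
          (solve 3 (λ a b c → (a :- b) :+ (b :- c) := a :- c) refl
            (F (t ℕ.+ suc q ℕ.* n)) (F (t ℕ.+ n)) (F t))))
        (trans (solve 2 (λ q e → q :* e :+ e := (con 1ℚ :+ q) :* e) refl (ι q) (ι 2 * ∣ g n ∣))
          (cong (_* (ι 2 * ∣ g n ∣)) (sym (ι-suc q))))
        (∣∣-+ (F-almostPeriodic 0≤σ n (t ℕ.+ n) q) step)
        where
        step : ∣ F (t ℕ.+ n) - F t ∣ ≤ ι 2 * ∣ g n ∣
        step = subst (λ z → ∣ z ∣ ≤ ι 2 * ∣ g n ∣) (sym (F-shift t n))
          (∣∣-* (∣∣-* {p = - ι 2} {b = ι 2} {c = 1ℚ} ℚ.≤-refl (∣σg∣≤1 0≤σ (t ℕ.+ t ℕ.+ n))) ℚ.≤-refl)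

  -- Bisection

  archimedean : ∀ ε → 0ℚ < ε → ∃[ b ] 1ℚ ≤ ι b * ε
  archimedean (mkℚ (+ zero) _ _) (*<* (ℤ.+<+ ()))
  archimedean (mkℚ -[1+ _ ] _ _) (*<* ())
  archimedean ε@(mkℚ +[1+ a ] b _) _ = suc b , ℚ.toℚᵘ-cancel-≤
    (ℚᵘ.≤-respʳ-≃
      (ℚᵘ.≃-sym (ℚᵘ.≃-trans (ℚ.toℚᵘ-homo-* (ι (suc b)) ε)
        (ℚᵘ.*-cong (ιᵘ (suc b)) (ℚᵘ.≃-refl {toℚᵘ ε}))))
      (ℚᵘ.*≤* (subst₂ ℤ._≤_ (sym (ℤ.*-identityˡ _)) (sym (ℤ.*-identityʳ _))
        (subst₂ ℤ._≤_ (cong +_ (sym (ℕ.+-identityʳ (suc b)))) (ℤ.pos-* (suc b) (suc a))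
          (ℤ.+≤+ (ℕ.m≤m*n (suc b) (suc a)))))))

  shrink : ∀ {K ε} → 0ℚ < K → 0ℚ < ε → ∃[ η ] (0ℚ < η × K * η ≡ ε)
  shrink {K} {ε} 0<K 0<ε = 1/ K * ε , 0<* (ℚ.positive⁻¹ (1/ K) {{ℚ.1/pos⇒pos K}}) 0<ε
    , trans (sym (ℚ.*-assoc K (1/ K) ε)) (trans (cong (_* ε) (ℚ.*-inverseʳ K)) (ℚ.*-identityˡ ε))
    where
    instance
      _ = positive 0<K
      _ = ℚ.pos⇒nonZero K

  -- A change of a decidable property within width η replaces an exact root over ℚ. The end hi′,
  -- where P holds, later serves as the approximate root.
  record Bracket (P : ℚ → Set) (lo hi : ℚ) (η : ℚ) : Set where
    constructor bracket
    field
      {lo′ hi′} : ℚ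
      lo≤lo′    : lo ≤ lo′
      lo′≤hi′   : lo′ ≤ hi′
      hi′≤hi    : hi′ ≤ hi
      width     : hi′ ≤ lo′ + η
      ¬Plo      : ¬ P lo′
      Phi       : P hi′

  module _ {P : ℚ → Set} (P? : ∀ x → Dec (P x)) where

    private
      mid≥ : ∀ {a b} → a ≤ b → a ≤ ½ * (a + b)
      mid≥ {a} {b} a≤b = ≤-by (0≤* (ℚ.<⇒≤ 0<½) (≤⇒0≤ a≤b))
        (solve 2 (λ a b → a :+ con ½ :* (b :- a) := con ½ :* (a :+ b)) refl a b)

      mid≤ : ∀ {a b} → a ≤ b → ½ * (a + b) ≤ b
      mid≤ {a} {b} a≤b = ≤-by (0≤* (ℚ.<⇒≤ 0<½) (≤⇒0≤ a≤b))
        (solve 2 (λ a b → con ½ :* (a :+ b) :+ con ½ :* (b :- a) := b) refl a b)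

      -- The width hypothesis (hi - lo) ≤ b η is halved at least as fast as b decreases.
      go : ∀ b {lo hi η} → 0ℚ ≤ η → lo ≤ hi → hi ≤ lo + (1ℚ + ι b) * η →
        ¬ P lo → P hi → Bracket P lo hi η
      go zero {lo} {hi} {η} 0≤η lo≤hi w ¬p p = bracket ℚ.≤-refl lo≤hi ℚ.≤-refl
        (subst (hi ≤_) (solve 2 (λ l e → l :+ (con 1ℚ :+ con 0ℚ) :* e := l :+ e) refl lo η) w) ¬p p
      go (suc b) {lo} {hi} {η} 0≤η lo≤hi w ¬p p with P? (½ * (lo + hi))
      ... | yes q =
        let bracket l m h e ¬p′ p′ = go b 0≤η (mid≥ lo≤hi) width′ ¬p q
        in bracket l m (ℚ.≤-trans h (mid≤ lo≤hi)) e ¬p′ p′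
        where
        width′ : ½ * (lo + hi) ≤ lo + (1ℚ + ι b) * η
        width′ = ≤-by (0≤+ (0≤* (ℚ.<⇒≤ 0<½) (≤⇒0≤ w)) (0≤* (0≤* (ℚ.<⇒≤ 0<½) (0≤ι b)) 0≤η)) (trans
          (cong (λ z → ½ * (lo + hi) + (½ * (lo + (1ℚ + z) * η - hi) + ½ * ι b * η)) (ι-suc b))
          (solve 4 (λ l h b e → con ½ :* (l :+ h)
              :+ (con ½ :* (l :+ (con 1ℚ :+ (con 1ℚ :+ b)) :* e :- h) :+ con ½ :* b :* e)
              := l :+ (con 1ℚ :+ b) :* e) refl lo hi (ι b) η))
      ... | no ¬q =
        let bracket l m h e ¬p′ p′ = go b 0≤η (mid≤ lo≤hi) width′ ¬q p
        in bracket (ℚ.≤-trans (mid≥ lo≤hi) l) m h e ¬p′ p′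
        where
        width′ : hi ≤ ½ * (lo + hi) + (1ℚ + ι b) * η
        width′ = ≤-by (0≤+ (0≤* (ℚ.<⇒≤ 0<½) (≤⇒0≤ w)) (0≤* (0≤* (ℚ.<⇒≤ 0<½) (0≤ι b)) 0≤η)) (trans
          (cong (λ z → hi + (½ * (lo + (1ℚ + z) * η - hi) + ½ * ι b * η)) (ι-suc b))
          (solve 4 (λ l h b e → h
              :+ (con ½ :* (l :+ (con 1ℚ :+ (con 1ℚ :+ b)) :* e :- h) :+ con ½ :* b :* e)
              := con ½ :* (l :+ h) :+ (con 1ℚ :+ b) :* e) refl lo hi (ι b) η))

    bisect : ∀ {lo hi η} → 0ℚ < η → lo ≤ hi → ¬ P lo → P hi → Bracket P lo hi η
    bisect {lo} {hi} {η} 0<η lo≤hi ¬p p =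
      -- W = 1 + (hi - lo) is positive even if lo = hi, and b is chosen with b η ≥ W, so that b
      -- bounds the number of halvings needed.
      let 0<W = 0<+≤ 0<1 (≤⇒0≤ lo≤hi)
          θ , 0<θ , Wθ≡η = shrink 0<W 0<η
          b , 1≤bθ = archimedean θ 0<θ
      in go b (ℚ.<⇒≤ 0<η) lo≤hi (≤-by
           (0≤+ (0≤+ (0≤* (ℚ.<⇒≤ 0<W) (≤⇒0≤ 1≤bθ)) 0≤1) (ℚ.<⇒≤ 0<η))
           (trans (cong (λ z → hi + ((1ℚ + (hi - lo)) * (ι b * θ - 1ℚ) + 1ℚ + z)) (sym Wθ≡η))
             (trans (solve 4 (λ l h b t → let W = con 1ℚ :+ (h :- l) in
                 h :+ (W :* (b :* t :- con 1ℚ) :+ con 1ℚ :+ W :* t) := l :+ (con 1ℚ :+ b) :* (W :* t))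
               refl lo hi (ι b) θ)
               (cong (λ z → lo + (1ℚ + ι b) * z) Wθ≡η))))
           ¬p p

  -- The sine recurrence

  module Sine (c : ℚ) (c≤1 : c ≤ 1ℚ) (g : ℕ → ℚ) (g-zero : g 0 ≡ 0ℚ) (g-one : g 1 ≡ 1ℚ)
    (g-suc-suc : ∀ t → g (suc (suc t)) ≡ (c + c) * g (suc t) - g t) where

    d : ℕ → ℚ
    d t = g (suc t) - g t

    g-suc : ∀ t → g (suc t) ≡ g t + d t
    g-suc t = solve 2 (λ a b → b := a :+ (b :- a)) refl (g t) (g (suc t))

    d-zero : d 0 ≡ 1ℚ
    d-zero = cong₂ _-_ g-one g-zero

    -- The discrete form of g″ = -2 (1 - c) g: where g is nonnegative it is concave, which gives all
    -- the bounds below under `0≤g`.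
    d-suc : ∀ t → d (suc t) ≡ d t - ι 2 * (1ℚ - c) * g (suc t)
    d-suc t = trans (cong (_- g (suc t)) (g-suc-suc t))
      (solve 3 (λ c a b → ((c :+ c) :* b :- a) :- b := (b :- a) :- con (ι 2) :* (con 1ℚ :- c) :* b)
        refl c (g t) (g (suc t)))

    0≤δ : 0ℚ ≤ ι 2 * (1ℚ - c)
    0≤δ = 0≤* (0≤ι 2) (≤⇒0≤ c≤1)

    module _ {n : ℕ} (0≤g : ∀ s → s ℕ.≤ n → 0ℚ ≤ g s) where

      d-antitone : ∀ s k → s ℕ.+ k ℕ.< n → d (s ℕ.+ k) ≤ d s
      d-antitone s zero    _  = ℚ.≤-reflexive (cong d (ℕ.+-identityʳ s))
      d-antitone s (suc k) lt = ℚ.≤-trans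
        (subst (λ m → d m ≤ d (s ℕ.+ k)) (sym (ℕ.+-suc s k))
          (≤-by (0≤* 0≤δ (0≤g (suc (s ℕ.+ k)) (ℕ.<⇒≤ lt′)))
            (trans (cong (_+ ι 2 * (1ℚ - c) * g (suc (s ℕ.+ k))) (d-suc (s ℕ.+ k)))
              (solve 2 (λ a b → a :- b :+ b := a) refl (d (s ℕ.+ k))
                (ι 2 * (1ℚ - c) * g (suc (s ℕ.+ k)))))))
        (d-antitone s k (ℕ.<-trans (ℕ.n<1+n (s ℕ.+ k)) lt′))
        where
        lt′ : suc (s ℕ.+ k) ℕ.< n
        lt′ = subst (ℕ._< n) (ℕ.+-suc s k) lt

      g≤ι : ∀ t → t ℕ.≤ n → g t ≤ ι t
      g≤ι zero    _  = ℚ.≤-reflexive g-zero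
      g≤ι (suc t) lt = subst₂ _≤_ (sym (g-suc t))
        (trans (ℚ.+-comm (ι t) 1ℚ) (sym (ι-suc t)))
        (ℚ.+-mono-≤ (g≤ι t (ℕ.<⇒≤ lt)) (subst (d t ≤_) d-zero (d-antitone 0 t lt)))

      -- By concavity no later increment exceeds d t, and d t ≤ g t by the recurrence. This carries
      -- smallness of g at some t ≤ n over to g n.
      g-growth : ∀ t → 1 ℕ.≤ t → ∀ k → t ℕ.+ k ℕ.≤ n → g (t ℕ.+ k) ≤ ι (suc k) * g t
      g-growth t@(suc t′) 1≤t zero _ = ℚ.≤-reflexive
        (trans (cong g (ℕ.+-identityʳ t)) (sym (ℚ.*-identityˡ (g t))))
      g-growth t@(suc t′) 1≤t (suc k) le = subst₂ _≤_
        (sym (trans (cong g (ℕ.+-suc t k)) (g-suc (t ℕ.+ k))))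
        (trans (solve 2 (λ k g → k :* g :+ g := (con 1ℚ :+ k) :* g) refl (ι (suc k)) (g t))
          (cong (_* g t) (sym (ι-suc (suc k)))))
        (ℚ.+-mono-≤ (g-growth t 1≤t k (ℕ.<⇒≤ lt)) (ℚ.≤-trans (d-antitone t k lt) d≤g))
        where
        lt : t ℕ.+ k ℕ.< n
        lt = subst (ℕ._≤ n) (ℕ.+-suc t k) le
        t≤n : t ℕ.≤ n
        t≤n = ℕ.≤-trans (ℕ.m≤m+n t k) (ℕ.<⇒≤ lt)
        d≤g : d t ≤ g t
        d≤g = ≤-by (0≤+ (0≤* 0≤δ (0≤g t t≤n)) (0≤g t′ (ℕ.<⇒≤ t≤n)))
          (trans (cong (λ z → z - g t + (ι 2 * (1ℚ - c) * g t + g t′)) (g-suc-suc t′))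
            (solve 3 (λ c a b → (c :+ c) :* b :- a :- b :+ (con (ι 2) :* (con 1ℚ :- c) :* b :+ a) := b)
              refl c (g t′) (g t)))

      -- Supplies a lower bound for 1 - F j that does not depend on how precisely c was chosen.
      g-lower : ∀ t → suc (suc t) ℕ.≤ n → 1ℚ ≤ ι (suc t) * g (suc t)
      g-lower t lt = subst (λ z → z ≤ ι u * g u) g-one (descend t 0 refl)
        where
        u = suc t
        -- For s ≤ u the decrement g s - g (s+1) is at most that at u, hence at most g u.
        descend : ∀ k s → s ℕ.+ k ≡ t → g (suc s) ≤ ι (suc k) * g u
        descend zero s eq = ℚ.≤-reflexive
          (trans (cong (λ z → g (suc z)) (trans (sym (ℕ.+-identityʳ s)) eq))
            (sym (ℚ.*-identityˡ (g u))))
        descend (suc k) s eq = ≤-by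
          (0≤+ (0≤+ (≤⇒0≤ (descend k (suc s) (trans (sym (ℕ.+-suc s k)) eq)))
                    (≤⇒0≤ (subst (λ z → d z ≤ d (suc s)) eq′ (d-antitone (suc s) (suc k)
                      (subst (ℕ._< n) (sym eq′) lt)))))
               (0≤g (suc u) lt))
          (trans (solve 5 (λ a b k u v → a :+ ((k :* u :- b) :+ ((b :- a) :- (v :- u)) :+ v)
                   := (con 1ℚ :+ k) :* u) refl (g (suc s)) (g (suc (suc s))) (ι (suc k)) (g u)
                     (g (suc u)))
            (cong (_* g u) (sym (ι-suc (suc k)))))
          where
          eq′ : suc s ℕ.+ suc k ≡ u
          eq′ = cong suc eq

    -- The slope starts at 1 and loses δ g ≤ δ N per step, hence at most δ N² ≤ 1 in all; so it
    -- stays nonnegative and g never falls below g 1 = 1. This gives the upper end of the bisection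
    -- for c.
    g-positive : ∀ {N} → 0ℚ ≤ N → ι 2 * (1ℚ - c) * N * N ≤ 1ℚ → ∀ t → ι (suc t) ≤ N → 1ℚ ≤ g (suc t)
    g-positive {N} 0≤N δN²≤1 t le = proj₁ (go t le)
      where
      δ = ι 2 * (1ℚ - c)
      Inv : ℕ → Set
      Inv t = 1ℚ ≤ g (suc t) × g (suc t) ≤ ι (suc t) × d t ≤ 1ℚ × 1ℚ - ι t * (δ * N) ≤ d t
      go : ∀ t → ι (suc t) ≤ N → Inv t
      go zero le = ℚ.≤-reflexive (sym g-one) , ℚ.≤-reflexive g-one , ℚ.≤-reflexive d-zero
        , ℚ.≤-reflexive (trans (solve 1 (λ x → con 1ℚ :- con 0ℚ :* x := con 1ℚ) refl (δ * N))
          (sym d-zero))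
      go (suc t) le = g≥1 , g≤ , d≤1 , d≥
        where
        u = suc t
        step : ι u ≤ N
        step = ℚ.≤-trans (ι-mono (ℕ.n≤1+n u)) le
        ih = go t step
        g≥  = proj₁ ih
        g≤′ = proj₁ (proj₂ ih)
        0≤gu : 0ℚ ≤ g u
        0≤gu = ℚ.≤-trans 0≤1 g≥
        d≤1 : d u ≤ 1ℚ
        d≤1 = ≤-by (0≤+ (≤⇒0≤ (proj₁ (proj₂ (proj₂ ih)))) (0≤* 0≤δ 0≤gu))
          (trans (cong (_+ (1ℚ - d t + δ * g u)) (d-suc t))
            (solve 2 (λ a b → a :- b :+ (con 1ℚ :- a :+ b) := con 1ℚ) refl (d t) (δ * g u)))
        d≥ : 1ℚ - ι u * (δ * N) ≤ d u
        d≥ = ≤-by (0≤+ (≤⇒0≤ (proj₂ (proj₂ (proj₂ ih)))) (0≤* 0≤δ (≤⇒0≤ (ℚ.≤-trans g≤′ step))))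
          (trans (cong (λ z → 1ℚ - z * (δ * N) + (d t - (1ℚ - ι t * (δ * N)) + δ * (N - g u)))
            (ι-suc t))
            (trans (solve 5 (λ t e N d g → con 1ℚ :- (con 1ℚ :+ t) :* (e :* N)
                   :+ (d :- (con 1ℚ :- t :* (e :* N)) :+ e :* (N :- g)) := d :- e :* g)
                 refl (ι t) δ N (d t) (g u)) (sym (d-suc t))))
        0≤d : 0ℚ ≤ d u
        0≤d = ℚ.≤-trans (≤-by (0≤+ (0≤* (0≤* 0≤δ 0≤N) (≤⇒0≤ step)) (≤⇒0≤ δN²≤1))
          (solve 3 (λ u e N → con 0ℚ :+ (e :* N :* (N :- u) :+ (con 1ℚ :- e :* N :* N))
             := con 1ℚ :- u :* (e :* N)) refl (ι u) δ N)) d≥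
        g≥1 : 1ℚ ≤ g (suc u)
        g≥1 = ≤-by (0≤+ (≤⇒0≤ g≥) 0≤d)
          (solve 2 (λ a b → con 1ℚ :+ ((a :- con 1ℚ) :+ (b :- a)) := b) refl (g u) (g (suc u)))
        g≤ : g (suc u) ≤ ι (suc u)
        g≤ = ≤-by (0≤+ (≤⇒0≤ g≤′) (≤⇒0≤ d≤1))
          (trans (solve 3 (λ a b i → b :+ ((i :- a) :+ (con 1ℚ :- (b :- a))) := con 1ℚ :+ i) refl
            (g u) (g (suc u)) (ι u)) (sym (ι-suc u)))

    -- Barta's comparison with w = v² + (N² + 1) v, v = t (N - t), whose second difference is
    -- -12 v ≥ -(12 / N²) w: the Wronskian of g and w would decrease from 0.
    g-not-positive : ∀ {n} → 2 ℕ.≤ n → ι 2 * (1ℚ - c) * ι n * ι n ≡ ι 12 →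
      ¬ (∀ t → t ℕ.< n → 0ℚ < g (suc t))
    g-not-positive {suc zero}       (s≤s ()) _ _
    g-not-positive {n@(suc (suc m))} _ eq pos = <⇒≱ (0<* (pos (suc m) ℕ.≤-refl) (0<w))
      (subst (_≤ 0ℚ) last (decreasing (suc m) ℕ.≤-refl))
      where
      N = ι n
      δ = ι 2 * (1ℚ - c)
      v w : ℚ → ℚ
      v x = x * (N - x)
      -- The second difference of v² is 2 N² + 2 - 12 v and that of v is -2; the coefficient N² + 1
      -- cancels the constant.
      w x = v x * v x + (N * N + 1ℚ) * v x
      ω : ℕ → ℚ
      ω t = g (suc t) * w (ι t) - g t * w (ι (suc t))

      0≤v : ∀ {t} → t ℕ.≤ n → 0ℚ ≤ v (ι t)
      0≤v {t} le = 0≤* (0≤ι t) (≤⇒0≤ (ι-mono le))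

      0<w : 0ℚ < w (ι (suc m))
      0<w = 0<+ (0<* 0<v 0<v) (0<* (0<+ (0<* (0<ι {n} (s≤s z≤n)) (0<ι {n} (s≤s z≤n))) 0<1) 0<v)
        where
        0<v : 0ℚ < v (ι (suc m))
        0<v = 0<* (0<ι {suc m} (s≤s z≤n)) (<⇒0< (<-by 0<1
          (trans (ℚ.+-comm (ι (suc m)) 1ℚ) (sym (ι-suc (suc m))))))

      last : ω (suc m) ≡ g n * w (ι (suc m))
      last = solve 4 (λ a b x y → a :* x :- b :*
        (y :* (y :- y) :* (y :* (y :- y)) :+ (y :* y :+ con 1ℚ) :* (y :* (y :- y))) := a :* x)
          refl (g n) (g (suc m)) (w (ι (suc m))) N

      -- The increment of ω is g times -(second difference of w) - 2 (1 - c) w. With 2 (1 - c) N² =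
      -- 12 the terms linear in N² v cancel after multiplication by N², and -12 (v² + v) g is left.
      ω-suc : ∀ t → N * N * ω (suc t) ≡ N * N * ω t - ι 12 *
        (g (suc t) * (v (ι (suc t)) * v (ι (suc t)) + v (ι (suc t))))
      ω-suc t = trans
        (cong₂ (λ a b → N * N * (a * w (ι (suc t)) - g (suc t) * w b)) (g-suc-suc t)
          (trans (ι-suc (suc t)) (cong (λ x → 1ℚ + x) (ι-suc t))))
        (trans (cong (λ b → N * N * (((c + c) * g (suc t) - g t) * w b - g (suc t) * w
          (1ℚ + (1ℚ + ι t)))) (ι-suc t))
        (trans
          (solve 5 (λ N c x g g′ →
            let v = λ x → x :* (N :- x)
                w = λ x → v x :* v x :+ (N :* N :+ con 1ℚ) :* v x
                x′ = con 1ℚ :+ x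
                e = con (ι 2) :* (con 1ℚ :- c) :* N :* N
            in N :* N :* (((c :+ c) :* g′ :- g) :* w x′ :- g′ :* w (con 1ℚ :+ x′))
               := (N :* N :* (g′ :* w x :- g :* w x′)) :- g′ :*
                 (e :* w x′ :- con (ι 12) :* (N :* N :* v x′)))
            refl N c (ι t) (g t) (g (suc t)))
        (trans (cong (λ z → N * N * (g (suc t) * w (ι t) - g t * w (1ℚ + ι t)) - g (suc t) *
          (z * w (1ℚ + ι t) - ι 12 * (N * N * v (1ℚ + ι t)))) eq)
        (trans (solve 5 (λ N x g g′ a →
            let v = λ x → x :* (N :- x)
                w = λ x → v x :* v x :+ (N :* N :+ con 1ℚ) :* v x
                x′ = con 1ℚ :+ x
            in (N :* N :* (g′ :* w x :- g :* w x′)) :- g′ :* (a :* w x′ :- a :* (N :* N :* v x′))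
              := (N :* N :* (g′ :* w x :- g :* w x′)) :- a :* (g′ :* (v x′ :* v x′ :+ v x′)))
                refl N (ι t) (g t) (g (suc t)) (ι 12))
          (cong (λ b → N * N * (g (suc t) * w (ι t) - g t * w b) - ι 12 *
            (g (suc t) * (v b * v b + v b))) (sym (ι-suc t)))))))

      decreasing : ∀ t → t ℕ.< n → ω t ≤ 0ℚ
      decreasing zero _ = ℚ.≤-reflexive (trans
        (cong₂ (λ a b → a * w 0ℚ - b * w 1ℚ) g-one g-zero)
        (solve 1 (λ N →
            let v = λ x → x :* (N :- x)
                w = λ x → v x :* v x :+ (N :* N :+ con 1ℚ) :* v x
            in con 1ℚ :* w (con 0ℚ) :- con 0ℚ :* w (con 1ℚ) := con 0ℚ) refl N))
      decreasing (suc t) lt = *-cancel-≤ (0<* (0<ι {n} (s≤s z≤n)) (0<ι {n} (s≤s z≤n)))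
        (subst₂ _≤_ (sym (ω-suc t)) (sym (ℚ.*-zeroʳ (N * N)))
          (≤-by (0≤+ (0≤* (0≤* (0≤ι n) (0≤ι n)) (≤⇒0≤ (decreasing t (ℕ.<-trans (ℕ.n<1+n t) lt))))
                     (0≤* (0≤ι 12) (0≤* (ℚ.<⇒≤ (pos t (ℕ.<-trans (ℕ.n<1+n t) lt)))
                       (0≤+ (0≤* 0≤v′ 0≤v′) 0≤v′))))
            (solve 3 (λ a b o → (a :* o :- b) :+ (a :* (con 0ℚ :- o) :+ b) := con 0ℚ) refl (N * N)
              (ι 12 * (g (suc t) * (v (ι (suc t)) * v (ι (suc t)) + v (ι (suc t))))) (ω t))))
        where
        0≤v′ : 0ℚ ≤ v (ι (suc t))
        0≤v′ = 0≤v {suc t} (ℕ.<⇒≤ lt)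

  -- An approximate root of unity

  c²+1-c² : ∀ c → c * c + (1ℚ - c * c) ≡ 1ℚ
  c²+1-c² c = solve 1 (λ c → c :* c :+ (con 1ℚ :- c :* c) := con 1ℚ) refl c

  sine : ℚ → ℕ → ℚ
  sine c = Rotation.g c (1ℚ - c * c)

  sine-suc-suc : ∀ c t → sine c (suc (suc t)) ≡ (c + c) * sine c (suc t) - sine c t
  sine-suc-suc c = Rotation.Laws.g-suc-suc c (1ℚ - c * c) (c²+1-c² c)

  sine-one : ∀ c → sine c 1 ≡ 1ℚ
  sine-one = solve 1 (λ c → c :* con 0ℚ :+ con 1ℚ := con 1ℚ) refl

  0≤8^ : ∀ t → 0ℚ ≤ ι 8 ^ t
  0≤8^ t = ℚ.<⇒≤ (0<^ t (0<ι {8} (s≤s z≤n)))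

  8^-mono : ∀ t k → ι 8 ^ t ≤ ι 8 ^ (t ℕ.+ k)
  8^-mono zero    zero    = ℚ.≤-refl
  8^-mono zero    (suc k) = ≤-by (0≤+ (0≤* (0≤ι 7) (0≤8^ k)) (≤⇒0≤ (8^-mono zero k)))
    (solve 1 (λ x → con 1ℚ :+ (con (ι 7) :* x :+ (x :- con 1ℚ)) := con (ι 8) :* x) refl (ι 8 ^ k))
  8^-mono (suc t) k       = ℚ.*-monoˡ-≤-nonNeg (ι 8) (8^-mono t k)

  ∣sine∣≤ : ∀ {c} → ∣ c ∣ ≤ 1ℚ → ∀ t → ∣ sine c t ∣ ≤ ι 8 ^ t
  ∣sine∣≤ {c} h zero          = 0≤1
  ∣sine∣≤ {c} h (suc zero)    = subst (λ z → ∣ z ∣ ≤ ι 8 ^ 1) (sym (sine-one c))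
    (ι-mono {1} {8} (s≤s z≤n))
  ∣sine∣≤ {c} h (suc (suc t)) = subst (λ z → ∣ z ∣ ≤ ι 8 ^ suc (suc t)) (sym (sine-suc-suc c t))
    (ℚ.≤-trans
      (∣∣-+ (∣∣-* (∣∣-+ h h) (∣sine∣≤ h (suc t))) (∣∣-neg (∣sine∣≤ h t)))
      (≤-by (0≤* (0≤ι 47) (0≤8^ t))
        (solve 1 (λ x → (con 1ℚ :+ con 1ℚ) :* (con (ι 8) :* x) :+ x :+ con (ι 47) :* x
          := con (ι 8) :* (con (ι 8) :* x)) refl (ι 8 ^ t))))

  -- The base 8 is generous: the recurrence contributes 2 · 8 + 2 · 8 + 1 = 33 ≤ 8², the middle term
  -- coming from the change of c itself. The estimate compares the two ends of a bracket.
  sine-lipschitz : ∀ {c c′ h} → ∣ c ∣ ≤ 1ℚ → ∣ c′ ∣ ≤ 1ℚ → ∣ c - c′ ∣ ≤ h →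
    ∀ t → ∣ sine c t - sine c′ t ∣ ≤ ι 8 ^ t * h
  sine-lipschitz {h = h} p p′ q zero = ℚ.≤-trans (ℚ.0≤∣p∣ _)
    (ℚ.≤-trans q (ℚ.≤-reflexive (sym (ℚ.*-identityˡ h))))
  sine-lipschitz {c} {c′} {h} p p′ q (suc zero) = subst₂ (λ a b → ∣ a - b ∣ ≤ ι 8 ^ 1 * h)
    (sym (sine-one c)) (sym (sine-one c′))
    (0≤* (0≤8^ 1) (ℚ.≤-trans (ℚ.0≤∣p∣ (c - c′)) q))
  sine-lipschitz {c} {c′} {h} p p′ q (suc (suc t)) = subst (λ z → ∣ z ∣ ≤ ι 8 ^ suc (suc t) * h)
    (sym (trans (cong₂ _-_ (sine-suc-suc c t) (sine-suc-suc c′ t))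
      (solve 6 (λ c c′ a a′ b b′ → ((c :+ c) :* b :- a) :- ((c′ :+ c′) :* b′ :- a′)
          := (c :+ c) :* (b :- b′) :+ ((c :- c′) :+ (c :- c′)) :* b′ :+ :- (a :- a′))
        refl c c′ (sine c t) (sine c′ t) (sine c (suc t)) (sine c′ (suc t)))))
    (ℚ.≤-trans
      (∣∣-+ (∣∣-+ (∣∣-* (∣∣-+ p p) (sine-lipschitz p p′ q (suc t)))
                 (∣∣-* (∣∣-+ q q) (∣sine∣≤ p′ (suc t))))
            (∣∣-neg (sine-lipschitz p p′ q t)))
      (≤-by (0≤* (0≤ι 31) (0≤* (0≤8^ t) 0≤h))
        (solve 2 (λ x h → (con 1ℚ :+ con 1ℚ) :* (con (ι 8) :* x :* h) :+ (h :+ h) :* (con (ι 8) :* x)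
             :+ x :* h :+ con (ι 31) :* (x :* h) := con (ι 8) :* (con (ι 8) :* x) :* h) refl
               (ι 8 ^ t) h)))
    where
    0≤h : 0ℚ ≤ h
    0≤h = ℚ.≤-trans (ℚ.0≤∣p∣ (c - c′)) q

  -- c approximates cos (π / n), the largest zero of sine _ n.
  record Angle (n : ℕ) (ε : ℚ) : Set where
    field
      c        : ℚ
      0≤c      : 0ℚ ≤ c
      c≤1      : c ≤ 1ℚ
      1-c≤     : ι n * ι n * (1ℚ - c) ≤ ι 6
      1-c≥     : ½ ≤ ι n * ι n * (1ℚ - c)
      sine>0   : ∀ t → t ℕ.< n → 0ℚ < sine c (suc t)
      small    : sine c n ≤ ε

  module _ {n : ℕ} {ε r η : ℚ} (4≤n : 4 ℕ.≤ n) (0<r : 0ℚ < r)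
    (N²r≡1 : ι n * ι n * r ≡ 1ℚ) (0<η : 0ℚ < η) (Kη≡ε : ι n * ι 8 ^ n * η ≡ ε) where

    private
      0<N : 0ℚ < ι n
      0<N = 0<ι {n} (ℕ.≤-trans (s≤s z≤n) 4≤n)

      N² = ι n * ι n
      0<N² : 0ℚ < N²
      0<N² = 0<* 0<N 0<N
      0≤N² = ℚ.<⇒≤ 0<N²
      16≤N² : ι 16 ≤ N²
      16≤N² = *-mono-≤ {ι 4} {ι n} {ι 4} {ι n} (0≤ι 4) (0≤ι 4) (ι-mono 4≤n) (ι-mono 4≤n)

      0≤r : 0ℚ ≤ r
      0≤r = ℚ.<⇒≤ 0<r

      -- With r = 1/n², 2 (1 - c) n² equals 12 at `lo`, as `g-not-positive` requires, and 1 at `hi`,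
      -- as `g-positive` requires.
      lo = 1ℚ - ι 6 * r
      hi = 1ℚ - ½ * r

      0≤lo : 0ℚ ≤ lo
      0≤lo = *-cancel-≤ 0<N² (≤-by (0≤+ (≤⇒0≤ 16≤N²) (0≤ι 10)) (trans
        (solve 1 (λ A → A :* con 0ℚ :+ (A :- con (ι 16) :+ con (ι 10)) := A :- con
          (ι 6) :* con 1ℚ) refl N²)
        (trans (cong (λ z → N² - ι 6 * z) (sym N²r≡1))
          (solve 2 (λ A r → A :- con (ι 6) :* (A :* r) := A :* (con 1ℚ :- con (ι 6) :* r)) refl N² r))))

      lo≤hi : lo ≤ hi
      lo≤hi = ≤-by (0≤* (0≤* (0≤ι 11) (ℚ.<⇒≤ 0<½)) 0≤r)
        (solve 1 (λ r → con 1ℚ :- con (ι 6) :* r :+ con (ι 11) :* con ½ :* r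
          := con 1ℚ :- con ½ :* r) refl r)

      hi≤1 : hi ≤ 1ℚ
      hi≤1 = ≤-by (0≤* (ℚ.<⇒≤ 0<½) 0≤r) (solve 1 (λ x → con 1ℚ :- x :+ x := con 1ℚ) refl (½ * r))

      Positive′ : ℚ → Set
      Positive′ c = ∀ (i : Fin n) → 0ℚ < sine c (suc (toℕ i))

      0<sine? : ∀ c (i : Fin n) → Dec (0ℚ < sine c (suc (toℕ i)))
      0<sine? c i = 0ℚ ℚ.<? sine c (suc (toℕ i))

      unFin : ∀ {c} → Positive′ c → ∀ t → t ℕ.< n → 0ℚ < sine c (suc t)
      unFin {c} p t lt = subst (λ s → 0ℚ < sine c (suc s)) (Fin.toℕ-fromℕ< lt) (p (fromℕ< lt))

      ¬lo : ¬ Positive′ lo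
      ¬lo p = Sine.g-not-positive lo (ℚ.≤-trans lo≤hi hi≤1) (sine lo) refl (sine-one lo)
        (sine-suc-suc lo)
        (ℕ.≤-trans (s≤s (s≤s z≤n)) 4≤n)
        (trans (solve 2 (λ N r → con (ι 2) :* (con 1ℚ :- (con 1ℚ :- con (ι 6) :* r)) :* N :* N
            := con (ι 12) :* (N :* N :* r)) refl (ι n) r) (cong (ι 12 *_) N²r≡1))
        (unFin {lo} p)

      hiPositive : Positive′ hi
      hiPositive i = ℚ.<-≤-trans 0<1 (Sine.g-positive hi hi≤1 (sine hi) refl (sine-one hi)
        (sine-suc-suc hi) (0≤ι n)
        (ℚ.≤-reflexive (trans (solve 2 (λ N r → con (ι 2) :*
          (con 1ℚ :- (con 1ℚ :- con ½ :* r)) :* N :* N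
            := N :* N :* r) refl (ι n) r) N²r≡1))
        (toℕ i) (ι-mono (Fin.toℕ<n i)))


    module _ (b : Bracket Positive′ lo hi η) where
      open Bracket b

      private
        lo≤hi′ = ℚ.≤-trans lo≤lo′ lo′≤hi′
        hi′≤1 = ℚ.≤-trans hi′≤hi hi≤1

        positive′ : ∀ t → t ℕ.< n → 0ℚ < sine hi′ (suc t)
        positive′ = unFin {hi′} Phi

        0≤sine : ∀ s → s ℕ.≤ n → 0ℚ ≤ sine hi′ s
        0≤sine zero    _  = ℚ.≤-refl
        0≤sine (suc s) le = ℚ.<⇒≤ (positive′ s le)

        ∣∣≤1 : ∀ {x} → 0ℚ ≤ x → x ≤ 1ℚ → ∣ x ∣ ≤ 1ℚ
        ∣∣≤1 0≤x x≤1 = subst (_≤ 1ℚ) (sym (ℚ.0≤p⇒∣p∣≡p 0≤x)) x≤1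

        small′ : sine hi′ n ≤ ε
        small′ = small-at (Fin.¬∀⟶∃¬ n (λ i → 0ℚ < sine lo′ (suc (toℕ i))) (0<sine? lo′) ¬Plo)
          where
          small-at : ∃[ i ] ¬ (0ℚ < sine lo′ (suc (toℕ i))) → sine hi′ n ≤ ε
          -- At lo′ the sine is not positive at some s ≤ n. Hence it is at most 8ˢ η at hi′ and s by
          -- the Lipschitz bound, and at most n 8ⁿ η = ε at hi′ and n by `g-growth`.
          small-at (i , ¬0<) = subst₂ _≤_ (cong (sine hi′) s+k≡n)
            (trans (sym (ℚ.*-assoc (ι n) (ι 8 ^ n) η)) Kη≡ε)
            (ℚ.≤-trans
              (Sine.g-growth hi′ hi′≤1 (sine hi′) refl (sine-one hi′) (sine-suc-suc hi′) 0≤sine s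
                (s≤s z≤n) k (ℕ.≤-reflexive s+k≡n))
              (*-mono-≤ (0≤ι (suc k)) (0≤sine s s≤n) (ι-mono suc-k≤n)
                (ℚ.≤-trans
                  (≤-by (≤⇒0≤ (ℚ.≮⇒≥ ¬0<)) (solve 2 (λ a b → a :+ (con 0ℚ :- b) := a :- b) refl
                    (sine hi′ s) (sine lo′ s)))
                  (ℚ.≤-trans (p≤∣p∣ (sine hi′ s - sine lo′ s))
                    (ℚ.≤-trans
                      (sine-lipschitz (∣∣≤1 (ℚ.≤-trans 0≤lo lo≤hi′) hi′≤1)
                        (∣∣≤1 (ℚ.≤-trans 0≤lo lo≤lo′) (ℚ.≤-trans lo′≤hi′ hi′≤1)) near s)
                      (*-mono-≤ (0≤8^ s) (ℚ.<⇒≤ 0<η)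
                        (subst (λ z → ι 8 ^ s ≤ ι 8 ^ z) s+k≡n (8^-mono s k)) ℚ.≤-refl))))))
            where
            s = suc (toℕ i)
            s≤n : s ℕ.≤ n
            s≤n = Fin.toℕ<n i
            k = n ℕ.∸ s
            s+k≡n : s ℕ.+ k ≡ n
            s+k≡n = ℕ.m+[n∸m]≡n s≤n
            suc-k≤n : suc k ℕ.≤ n
            suc-k≤n = subst (suc k ℕ.≤_) s+k≡n (s≤s (ℕ.m≤n+m k (toℕ i)))
            near : ∣ hi′ - lo′ ∣ ≤ η
            near = subst (_≤ η) (sym (ℚ.0≤p⇒∣p∣≡p (≤⇒0≤ lo′≤hi′)))
              (≤-by (≤⇒0≤ width) (solve 3 (λ h l e → h :- l :+ (l :+ e :- h) := e) refl hi′ lo′ η))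

      angleFromBracket : Angle n ε
      angleFromBracket = record
        { c        = hi′
        ; 0≤c      = ℚ.≤-trans 0≤lo lo≤hi′
        ; c≤1      = hi′≤1
        ; 1-c≤     = ≤-by (0≤* 0≤N² (≤⇒0≤ lo≤hi′)) (trans
            (solve 3 (λ A r c → A :* (con 1ℚ :- c) :+ A :* (c :- (con 1ℚ :- con (ι 6) :* r))
              := con (ι 6) :* (A :* r)) refl N² r hi′)
            (cong (ι 6 *_) N²r≡1))
        ; 1-c≥     = ≤-by (0≤* 0≤N² (≤⇒0≤ hi′≤hi)) (trans
            (cong (λ z → ½ * z + N² * (hi - hi′)) (sym N²r≡1))
            (solve 3 (λ A r c → con ½ :* (A :* r) :+ A :* ((con 1ℚ :- con ½ :* r) :- c) := A :*
              (con 1ℚ :- c)) refl N² r hi′))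
        ; sine>0   = positive′
        ; small    = small′
        }

    angleFromScales : Angle n ε
    angleFromScales = angleFromBracket (bisect (λ c → Fin.all? (0<sine? c)) 0<η lo≤hi ¬lo hiPositive)

  angle : ∀ {n ε} → 4 ℕ.≤ n → 0ℚ < ε → Angle n ε
  angle {n} 4≤n 0<ε =
    let 0<N = 0<ι {n} (ℕ.≤-trans (s≤s z≤n) 4≤n)
        r , 0<r , N²r≡1 = shrink (0<* 0<N 0<N) 0<1
        η , 0<η , Kη≡ε  = shrink (0<* 0<N (0<^ n (0<ι {8} (s≤s z≤n)))) 0<ε
    in angleFromScales 4≤n 0<r N²r≡1 0<η Kη≡ε

  -- Adjacency matrices as sums over the edge list

  module Adjacency where

    private variable
      n : ℕ

    indicator : ∀ {p} {B : Set p} → Dec B → ℚ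
    indicator (yes _) = 1ℚ
    indicator (no _)  = 0ℚ

    δ : Fin n → Fin n → ℚ
    δ i j = indicator (i Fin.≟ j)

    δ-yes : {i j : Fin n} → i ≡ j → δ i j ≡ 1ℚ
    δ-yes {i = i} {j} eq with i Fin.≟ j
    ... | yes _ = refl
    ... | no ne = ⊥-elim (ne eq)

    δ-no : {i j : Fin n} → i ≢ j → δ i j ≡ 0ℚ
    δ-no {i = i} {j} ne with i Fin.≟ j
    ... | yes eq = ⊥-elim (ne eq)
    ... | no _   = refl

    δ-sym : (i j : Fin n) → δ i j ≡ δ j i
    δ-sym i j with i Fin.≟ j
    ... | yes refl = sym (δ-yes {i = i} refl)
    ... | no i≢j   = sym (δ-no (i≢j ∘ sym))

    sum-δ : ∀ {m} (h : Fin n → ℚ) (σ : Fin n → Fin m) (r : Fin m) (s : Fin n) → σ s ≡ r →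
      (∀ i → σ i ≡ r → i ≡ s) → sum (λ i → h i * δ r (σ i)) ≡ h s
    sum-δ h σ r s σs≡r unique = go h (λ i → δ r (σ i)) s (δ-yes (sym σs≡r)) λ i i≢s → δ-no
      (i≢s ∘ unique i ∘ sym)
      where
      go : ∀ {n} (h e : Fin n → ℚ) s → e s ≡ 1ℚ → (∀ i → i ≢ s → e i ≡ 0ℚ) → sum (λ i → h i * e i) ≡ h s
      go h e zero    e₁ e₀ = trans (cong₂ _+_ (cong (h zero *_) e₁)
          (sum-zero λ i → trans (cong (h (suc i) *_) (e₀ (suc i) λ ())) (ℚ.*-zeroʳ (h (suc i)))))
        (solve 1 (λ x → x :* con 1ℚ :+ con 0ℚ := x) refl (h zero))
      go h e (suc s) e₁ e₀ = trans (cong₂ _+_ (trans (cong (h zero *_) (e₀ zero λ ()))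
        (ℚ.*-zeroʳ (h zero)))
          (go (h ∘ suc) (e ∘ suc) s e₁ λ i i≢s → e₀ (suc i) (i≢s ∘ Fin.suc-injective)))
        (ℚ.+-identityˡ (h (suc s)))

    sum-δ-none : (h : Fin n → ℚ) {m : ℕ} (σ : Fin n → Fin m) (r : Fin m) → (∀ i → σ i ≢ r) →
      sum (λ i → h i * δ r (σ i)) ≡ 0ℚ
    sum-δ-none h σ r ne = sum-zero λ i → trans (cong (h i *_) (δ-no (ne i ∘ sym))) (ℚ.*-zeroʳ (h i))

    sum-+ : (f g : Fin n → ℚ) → sum (λ i → f i + g i) ≡ sum f + sum g
    sum-+ {zero}  f g = refl
    sum-+ {suc n} f g = trans (cong (λ x → f zero + g zero + x) (sum-+ (f ∘ suc) (g ∘ suc)))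
      (solve 4 (λ a b c d → a :+ b :+ (c :+ d) := a :+ c :+ (b :+ d)) refl
        (f zero) (g zero) (sum (f ∘ suc)) (sum (g ∘ suc)))

    sumOver : {A : Set} → (A → ℚ) → List A → ℚ
    sumOver h []       = 0ℚ
    sumOver h (x ∷ xs) = h x + sumOver h xs

    sumOver-++ : {A : Set} (h : A → ℚ) (xs ys : List A) → sumOver h
      (xs ++ ys) ≡ sumOver h xs + sumOver h ys
    sumOver-++ h []       ys = sym (ℚ.+-identityˡ _)
    sumOver-++ h (x ∷ xs) ys = trans (cong (λ y → h x + y) (sumOver-++ h xs ys))
      (sym (ℚ.+-assoc (h x) _ _))

    sumOver-tabulate : {A : Set} (h : A → ℚ) (f : Fin n → A) → sumOver h (tabulate f) ≡ sum (h ∘ f)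
    sumOver-tabulate {n = zero}  h f = refl
    sumOver-tabulate {n = suc n} h f = cong (λ x → h (f zero) + x) (sumOver-tabulate h (f ∘ suc))

    ι-length-filter : ∀ {p} {A : Set} {B : A → Set p} (B? : Decidable B) (xs : List A) →
      ι (length (filter B? xs)) ≡ sumOver (indicator ∘ B?) xs
    ι-length-filter B? []       = refl
    ι-length-filter B? (x ∷ xs) with B? x
    ... | yes _ = trans (ι-suc (length (filter B? xs))) (cong (λ x → 1ℚ + x) (ι-length-filter B? xs))
    ... | no  _ = trans (ι-length-filter B? xs) (sym (ℚ.+-identityˡ _))

    δ*δ-no : {p q u v : Fin n} → (p , q) ≢ (u , v) → δ p u * δ q v ≡ 0ℚ
    δ*δ-no {p = p} {q} {u} {v} ne with p Fin.≟ u | q Fin.≟ v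
    ... | yes refl | yes refl = ⊥-elim (ne refl)
    ... | yes _    | no _     = refl
    ... | no _     | d        = ℚ.*-zeroˡ (indicator d)

    -- For p ≢ q the two orientations exclude each other. A loop would satisfy the left side once
    -- but be counted twice on the right.
    indicator-joins : (p q u v : Fin n) → p ≢ q →
      (d : Dec ((p , q) ≡ (u , v) ⊎ (p , q) ≡ (v , u))) →
      indicator d ≡ δ u p * δ v q + δ u q * δ v p
    indicator-joins p q u v p≢q (yes (inj₁ refl)) = sym (cong₂ _+_
      (cong₂ _*_ (δ-yes {i = p} refl) (δ-yes {i = q} refl))
      (δ*δ-no {p = p} {q} λ { refl → p≢q refl }))
    indicator-joins p q u v p≢q (yes (inj₂ refl)) = sym (cong₂ _+_
      (δ*δ-no {p = q} {p} λ { refl → p≢q refl })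
      (cong₂ _*_ (δ-yes {i = q} refl) (δ-yes {i = p} refl)))
    indicator-joins p q u v p≢q (no ¬j) = sym (cong₂ _+_
      (δ*δ-no {p = u} {v} λ { refl → ¬j (inj₁ refl) })
      (δ*δ-no {p = u} {v} λ { refl → ¬j (inj₂ refl) }))

    module _ (w : Fin n → ℚ) (v : Fin n) where

      -- The contribution of one edge to the coordinate v of the row vector w A.
      transfer : Fin n × Fin n → ℚ
      transfer (p , q) = w p * δ v q + w q * δ v p

      sum-joins : ∀ p q → p ≢ q → (J : ∀ u → Dec ((p , q) ≡ (u , v) ⊎ (p , q) ≡ (v , u))) →
        sum (λ u → w u * indicator (J u)) ≡ transfer (p , q)
      sum-joins p q p≢q J = begin
        sum (λ u → w u * indicator (J u))
          ≡⟨ sum-cong (λ u → trans (cong (w u *_) (indicator-joins p q u v p≢q (J u)))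
               (solve 5 (λ w a b c d → w :* (a :* b :+ c :* d) := w :* a :* b :+ w :* c :* d) refl
                 (w u) (δ u p) (δ v q) (δ u q) (δ v p))) ⟩
        sum (λ u → w u * δ u p * δ v q + w u * δ u q * δ v p)
          ≡⟨ sum-+ (λ u → w u * δ u p * δ v q) (λ u → w u * δ u q * δ v p) ⟩
        sum (λ u → w u * δ u p * δ v q) + sum (λ u → w u * δ u q * δ v p)
          ≡⟨ cong₂ _+_ (sym (sum-* (λ u → w u * δ u p) (δ v q)))
            (sym (sum-* (λ u → w u * δ u q) (δ v p))) ⟩
        sum (λ u → w u * δ u p) * δ v q + sum (λ u → w u * δ u q) * δ v p
          ≡⟨ cong₂ (λ x y → x * δ v q + y * δ v p) (select p)
               (select q) ⟩
        transfer (p , q) ∎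
        where
        open ≡-Reasoning
        select : ∀ s → sum (λ u → w u * δ u s) ≡ w s
        select s = trans (sum-cong λ u → cong (w u *_) (δ-sym u s))
          (sum-δ w (λ u → u) s s refl λ _ eq → eq)

      sum-joinsOver : (es : List (Fin n × Fin n)) → All (λ (p , q) → p ≢ q) es →
        (J : ∀ u e → Dec (e ≡ (u , v) ⊎ e ≡ (v , u))) →
        sum (λ u → w u * sumOver (λ e → indicator (J u e)) es) ≡ sumOver transfer es
      sum-joinsOver []             _             J = sum-zero λ u → ℚ.*-zeroʳ (w u)
      sum-joinsOver ((p , q) ∷ es) (p≢q ∷ loopless) J = trans
        (sum-cong λ u → ℚ.*-distribˡ-+ (w u) (indicator (J u (p , q)))
          (sumOver (λ e → indicator (J u e)) es))
        (trans (sum-+ (λ u → w u * indicator (J u (p , q)))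
          (λ u → w u * sumOver (λ e → indicator (J u e)) es))
          (cong₂ _+_ (sum-joins p q p≢q λ u → J u (p , q)) (sum-joinsOver es loopless J)))

      -- The decision procedure J is a parameter because the one used by `multiplicity` is local to
      -- it; in `column` it is found by unification.
      sum-joins-filter : (es : List (Fin n × Fin n)) → All (λ (p , q) → p ≢ q) es →
        (J : ∀ u → Decidable (λ e → e ≡ (u , v) ⊎ e ≡ (v , u))) →
        sum (λ u → w u * ι (length (filter (J u) es))) ≡ sumOver transfer es
      sum-joins-filter es loopless J = trans
        (sum-cong λ u → cong (w u *_) (ι-length-filter (J u) es))
        (sum-joinsOver es loopless J)

    column : (G : Multigraph) (w : Fin (order G) → ℚ) (v : Fin (order G)) →
      All (λ (p , q) → p ≢ q) (edges G) →
      sum (λ u → w u * ι (multiplicity G u v)) ≡ sumOver (transfer w v) (edges G)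
    column G w v loopless = sum-joins-filter w v (edges G) loopless _

    toℕ-⊕ : .{{_ : ℕ.NonZero n}} (i : Fin n) (s : ℕ) → toℕ (i ⊕ s) ≡ (toℕ i ℕ.+ s) ℕ.% n
    toℕ-⊕ {suc n} i s = Fin.toℕ-fromℕ< (m%n<n (toℕ i ℕ.+ s) (suc n))

    ⊕-⊕ : .{{_ : ℕ.NonZero n}} (i : Fin n) (s t : ℕ) → s ℕ.+ t ≡ n → (i ⊕ s) ⊕ t ≡ i
    ⊕-⊕ {N} i s t eq = Fin.toℕ-injective (begin
      toℕ ((i ⊕ s) ⊕ t)                               ≡⟨ toℕ-⊕ (i ⊕ s) t ⟩
      (toℕ (i ⊕ s) ℕ.+ t) ℕ.% N                       ≡⟨ cong (λ z → (z ℕ.+ t) ℕ.% N) (toℕ-⊕ i s) ⟩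
      ((toℕ i ℕ.+ s) ℕ.% N ℕ.+ t) ℕ.% N               ≡⟨ %-distribˡ-+ ((toℕ i ℕ.+ s) ℕ.% N) t N ⟩
      ((toℕ i ℕ.+ s) ℕ.% N ℕ.% N ℕ.+ t ℕ.% N) ℕ.% N   ≡⟨ cong (λ z → (z ℕ.+ t ℕ.% N) ℕ.% N)
        (m%n%n≡m%n (toℕ i ℕ.+ s) N) ⟩
      ((toℕ i ℕ.+ s) ℕ.% N ℕ.+ t ℕ.% N) ℕ.% N         ≡⟨ %-distribˡ-+ (toℕ i ℕ.+ s) t N ⟨
      (toℕ i ℕ.+ s ℕ.+ t) ℕ.% N                       ≡⟨ cong (ℕ._% N)
        (trans (ℕ.+-assoc (toℕ i) s t) (cong (toℕ i ℕ.+_) eq)) ⟩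
      (toℕ i ℕ.+ N) ℕ.% N                             ≡⟨ [m+n]%n≡m%n (toℕ i) N ⟩
      toℕ i ℕ.% N                                     ≡⟨ m<n⇒m%n≡m (Fin.toℕ<n i) ⟩
      toℕ i                                           ∎)
      where
      open ≡-Reasoning

    ⊕-noFix : .{{_ : ℕ.NonZero n}} (i : Fin n) (s : ℕ) → 0 ℕ.< s → s ℕ.< n → i ≢ i ⊕ s
    ⊕-noFix {N} i s 0<s s<N eq = multiple ((toℕ i ℕ.+ s) ℕ./ N) (ℕ.+-cancelˡ-≡ (toℕ i) s _ (begin
      toℕ i ℕ.+ s  ≡⟨ m≡m%n+[m/n]*n (toℕ i ℕ.+ s) N ⟩
      (toℕ i ℕ.+ s) ℕ.% N ℕ.+ (toℕ i ℕ.+ s) ℕ./ N ℕ.* N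
        ≡⟨ cong (ℕ._+ (toℕ i ℕ.+ s) ℕ./ N ℕ.* N) (trans (sym (toℕ-⊕ i s)) (cong toℕ (sym eq))) ⟩
      toℕ i ℕ.+ (toℕ i ℕ.+ s) ℕ./ N ℕ.* N ∎))
      where
      open ≡-Reasoning
      multiple : ∀ q → s ≢ q ℕ.* N
      multiple zero    refl = ℕ.<-irrefl refl 0<s
      multiple (suc q) refl = ℕ.<⇒≱ s<N (ℕ.m≤m+n N (q ℕ.* N))

  open Adjacency

  ↑ˡ≢↑ʳ : ∀ {m n} (i : Fin m) (j : Fin n) → i ↑ˡ n ≢ m ↑ʳ j
  ↑ˡ≢↑ʳ {m} {n} i j eq = inj₁≢inj₂ (trans (sym (Fin.splitAt-↑ˡ m i n))
    (trans (cong (splitAt m) eq) (Fin.splitAt-↑ʳ m n j)))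
    where
    inj₁≢inj₂ : inj₁ i ≢ inj₂ j
    inj₁≢inj₂ ()

  -- Columns of the adjacency matrix of P(n,k)

  module Petersen {n k : ℕ} .{{_ : ℕ.NonZero n}} (1<n : 1 ℕ.< n) (1≤k : 1 ℕ.≤ k) (k<n : k ℕ.< n) where

    a b : Fin n → Fin (n ℕ.+ n)
    a i = i ↑ˡ n
    b i = n ↑ʳ i

    infixl 6 _⊖_
    _⊖_ : Fin n → ℕ → Fin n
    i ⊖ s = i ⊕ (n ℕ.∸ s)

    private
      loopless : All (λ (p , q) → p ≢ q) (edges (P n k))
      loopless = All.++⁺ (All.tabulate⁺ {f = λ i → a i , a (i ⊕ 1)} λ i → ⊕-noFix i 1
        (s≤s z≤n) 1<n ∘ Fin.↑ˡ-injective n i (i ⊕ 1))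
        (All.++⁺ (All.tabulate⁺ {f = λ i → a i , b i} λ i → ↑ˡ≢↑ʳ i i)
          (All.tabulate⁺ {f = λ i → b i , b (i ⊕ k)}
            λ i → ⊕-noFix i k 1≤k k<n ∘ Fin.↑ʳ-injective n i (i ⊕ k)))

      edgeSums : (w : Fin (n ℕ.+ n) → ℚ) (v : Fin (n ℕ.+ n)) →
        sum (λ u → w u * ι (multiplicity (P n k) u v)) ≡
          sum (λ i → transfer w v (a i , a (i ⊕ 1)))
          + (sum (λ i → transfer w v (a i , b i)) + sum (λ i → transfer w v (b i , b (i ⊕ k))))
      edgeSums w v = trans (column (P n k) w v loopless) (trans
        (sumOver-++ t (tabulate e₁) (tabulate e₂ ++ tabulate e₃))
        (cong₂ _+_ (sumOver-tabulate t e₁) (trans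
          (sumOver-++ t (tabulate e₂) (tabulate e₃))
          (cong₂ _+_ (sumOver-tabulate t e₂) (sumOver-tabulate t e₃)))))
        where
        t = transfer w v
        e₁ e₂ e₃ : Fin n → Fin (n ℕ.+ n) × Fin (n ℕ.+ n)
        e₁ i = a i , a (i ⊕ 1)
        e₂ i = a i , b i
        e₃ i = b i , b (i ⊕ k)

      module _ (c : Fin n → Fin (n ℕ.+ n)) (c-injective : ∀ i j → c i ≡ c j → i ≡ j)
        (w : Fin (n ℕ.+ n) → ℚ) where

        -- Treats the outer edges (s = 1) and the inner edges (s = k) alike: c r is the head of
        -- exactly one edge of the family and the tail of exactly one. For 2 s = n both neighbours
        -- coincide, which accounts for the double edge.
        cycle : ∀ r s → s ℕ.≤ n → sum (λ i → transfer w (c r) (c i , c (i ⊕ s))) ≡ w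
          (c (r ⊖ s)) + w (c (r ⊕ s))
        cycle r s s≤n = trans (sum-+ (λ i → w (c i) * δ (c r) (c (i ⊕ s)))
          (λ i → w (c (i ⊕ s)) * δ (c r) (c i)))
          (cong₂ _+_
            (sum-δ (w ∘ c) (λ i → c (i ⊕ s)) (c r) (r ⊖ s)
              (cong c (⊕-⊕ r (n ℕ.∸ s) s (ℕ.m∸n+n≡m s≤n)))
              λ i eq → trans (sym (⊕-⊕ i s (n ℕ.∸ s) (ℕ.m+[n∸m]≡n s≤n)))
                (cong (_⊖ s) (c-injective (i ⊕ s) r eq)))
            (sum-δ (λ i → w (c (i ⊕ s))) c (c r) r refl λ i eq → c-injective i r eq))

    column-a : (w : Fin (n ℕ.+ n) → ℚ) (r : Fin n) →
      sum (λ u → w u * ι (multiplicity (P n k) u (a r))) ≡ w (a (r ⊖ 1)) + w (a (r ⊕ 1)) + w (b r)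
    column-a w r = trans (edgeSums w (a r)) (trans
      (cong₂ _+_ (cycle a (Fin.↑ˡ-injective n) w r 1 (ℕ.<⇒≤ 1<n)) (cong₂ _+_
        (trans (sum-+ (λ i → w (a i) * δ (a r) (b i)) (λ i → w (b i) * δ (a r) (a i)))
          (cong₂ _+_ (sum-δ-none (w ∘ a) b (a r) λ i eq → ↑ˡ≢↑ʳ r i (sym eq))
            (sum-δ (w ∘ b) a (a r) r refl λ i eq → Fin.↑ˡ-injective n i r eq)))
        (trans (sum-+ (λ i → w (b i) * δ (a r) (b (i ⊕ k))) (λ i → w (b (i ⊕ k)) * δ (a r) (b i)))
          (cong₂ _+_ (sum-δ-none (w ∘ b) (λ i → b (i ⊕ k)) (a r) λ i eq → ↑ˡ≢↑ʳ r (i ⊕ k) (sym eq))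
            (sum-δ-none (λ i → w (b (i ⊕ k))) b (a r) λ i eq → ↑ˡ≢↑ʳ r i (sym eq))))))
      (solve 3 (λ x y z → x :+ y :+ (con 0ℚ :+ z :+ (con 0ℚ :+ con 0ℚ)) := x :+ y :+ z) refl
        (w (a (r ⊖ 1))) (w (a (r ⊕ 1))) (w (b r))))

    column-b : (w : Fin (n ℕ.+ n) → ℚ) (r : Fin n) →
      sum (λ u → w u * ι (multiplicity (P n k) u (b r))) ≡ w (b (r ⊖ k)) + w (b (r ⊕ k)) + w (a r)
    column-b w r = trans (edgeSums w (b r)) (trans
      (cong₂ _+_
        (trans (sum-+ (λ i → w (a i) * δ (b r) (a (i ⊕ 1))) (λ i → w (a (i ⊕ 1)) * δ (b r) (a i)))
          (cong₂ _+_ (sum-δ-none (w ∘ a) (λ i → a (i ⊕ 1)) (b r) λ i eq → ↑ˡ≢↑ʳ (i ⊕ 1) r eq)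
            (sum-δ-none (λ i → w (a (i ⊕ 1))) a (b r) λ i eq → ↑ˡ≢↑ʳ i r eq)))
        (cong₂ _+_
          (trans (sum-+ (λ i → w (a i) * δ (b r) (b i)) (λ i → w (b i) * δ (b r) (a i)))
            (cong₂ _+_ (sum-δ (w ∘ a) b (b r) r refl λ i eq → Fin.↑ʳ-injective n i r eq)
              (sum-δ-none (w ∘ b) a (b r) λ i eq → ↑ˡ≢↑ʳ i r eq)))
          (cycle b (Fin.↑ʳ-injective n) w r k (ℕ.<⇒≤ k<n))))
      (solve 3 (λ x y z → con 0ℚ :+ con 0ℚ :+ (z :+ con 0ℚ :+ (x :+ y)) := x :+ y :+ z) refl
        (w (b (r ⊖ k))) (w (b (r ⊕ k))) (w (a r))))

  -- From the real spectrum to the characteristic polynomial over ℚ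

  module Limit where

    private variable
      n : ℕ

    module Homomorphism {c ℓ} (R : RawRing c ℓ) (h : RawRing.Carrier R → ℚ)
      (h-+ : ∀ x y → h (RawRing._+_ R x y) ≡ h x + h y)
      (h-* : ∀ x y → h (RawRing._*_ R x y) ≡ h x * h y)
      (h-neg : ∀ x → h (RawRing.-_ R x) ≡ - h x)
      (h-0 : h (RawRing.0# R) ≡ 0ℚ) (h-1 : h (RawRing.1# R) ≡ 1ℚ) where

      private
        module R = RawRing R
        module R-Matrices = Matrices R

      sum-homo : (f : Fin n → R.Carrier) → h (R-Matrices.sum f) ≡ sum (h ∘ f)
      sum-homo {zero}  f = h-0
      sum-homo {suc n} f = trans (h-+ _ _) (cong (λ s → h (f zero) + s) (sum-homo (f ∘ suc)))

      product-homo : (f : Fin n → R.Carrier) → h (R-Matrices.product f) ≡ product (h ∘ f)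
      product-homo {zero}  f = h-1
      product-homo {suc n} f = trans (h-* _ _) (cong (λ s → h (f zero) * s) (product-homo (f ∘ suc)))

      ^-homo : ∀ x k → h (x R-Matrices.^ k) ≡ h x ^ k
      ^-homo x zero    = h-1
      ^-homo x (suc k) = trans (h-* _ _) (cong (λ s → h x * s) (^-homo x k))

      sign-homo : ∀ k → h ((R.- R.1#) R-Matrices.^ k) ≡ (- 1ℚ) ^ k
      sign-homo k = trans (^-homo (R.- R.1#) k) (cong (_^ k) (trans (h-neg R.1#) (cong -_ h-1)))

      det-homo : (M : R-Matrices.Matrix n) → h (R-Matrices.det M) ≡ det λ i j → h (M i j)
      det-homo {zero}  M = h-1
      det-homo {suc n} M = trans (sum-homo λ j → (R.- R.1#) R-Matrices.^ toℕ j R.*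
        (M zero j R.* R-Matrices.det λ p q → M (suc p) (punchIn j q)))
          (sum-cong {suc n} λ j → trans (h-* _ _)
        (cong₂ _*_ (sign-homo (toℕ j)) (trans (h-* _ _)
          (cong (h (M zero j) *_) (det-homo λ p q → M (suc p) (punchIn j q))))))

      charPoly-homo : (M : R-Matrices.Matrix n) (x : R.Carrier) →
        h (R-Matrices.charPoly M x) ≡ charPoly (λ i j → h (M i j)) (h x)
      charPoly-homo M x = trans (det-homo λ i j → R-Matrices.scalar x i j R.+ R.- M i j)
        (det-cong λ i j → trans (h-+ _ _)
        (cong₂ _+_ (if-homo (does (i Fin.≟ j))) (h-neg (M i j))))
        where
        if-homo : ∀ b → h (if b then x else R.0#) ≡ (if b then h x else 0ℚ)
        if-homo true  = refl
        if-homo false = h-0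

    -- The operations of `ℝ` act termwise, so taking the m-th term commutes with them
    -- definitionally, although it does not respect `_≈_`.
    module Seq (m : ℕ) = Homomorphism (CommutativeRing.rawRing ℝ-commutativeRing) (λ x → seq x m)
      (λ _ _ → refl) (λ _ _ → refl) (λ _ → refl) refl refl

    product-zero : (f : Fin n → ℚ) (i : Fin n) → f i ≡ 0ℚ → product f ≡ 0ℚ
    product-zero f zero    eq = trans (cong (_* product (f ∘ suc)) eq) (ℚ.*-zeroˡ (product (f ∘ suc)))
    product-zero f (suc i) eq = trans (cong (f zero *_) (product-zero (f ∘ suc) i eq))
      (ℚ.*-zeroʳ (f zero))

    ∣product∣≥ : ∀ {η} → 0ℚ ≤ η → (f : Fin n → ℚ) → (∀ i → η ≤ ∣ f i ∣) → η ^ n ≤ ∣ product f ∣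
    ∣product∣≥ {zero}      0≤η f h = ℚ.≤-refl
    ∣product∣≥ {suc n} {η} 0≤η f h = subst (η ^ suc n ≤_)
      (sym (ℚ.∣p*q∣≡∣p∣*∣q∣ (f zero) (product (f ∘ suc))))
      (*-mono-≤ 0≤η (0≤^ n) (h zero) (∣product∣≥ 0≤η (f ∘ suc) (h ∘ suc)))
      where
      0≤^ : ∀ k → 0ℚ ≤ η ^ k
      0≤^ zero    = 0≤1
      0≤^ (suc k) = 0≤* 0≤η (0≤^ k)

    _∧ᵉ_ : {A B : ℕ → Set} → Eventually A → Eventually B → Eventually λ m → A m × B m
    (M , a) ∧ᵉ (N , b) = M ℕ.⊔ N , λ m le → a m (ℕ.m⊔n≤o⇒m≤o M N le) , b m (ℕ.m⊔n≤o⇒n≤o M N le)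

    mapᵉ : {A B : ℕ → Set} → (∀ m → A m → B m) → Eventually A → Eventually B
    mapᵉ f (N , a) = N , λ m le → f m (a m le)

    allᵉ : {A : Fin n → ℕ → Set} → (∀ i → Eventually (A i)) → Eventually λ m → ∀ i → A i m
    allᵉ {zero}  h = 0 , λ _ _ ()
    allᵉ {suc n} h = mapᵉ (λ { m (a , as) zero → a ; m (a , as) (suc i) → as i })
      (h zero ∧ᵉ allᵉ (h ∘ suc))

    -- Since `D._≤_` is a negation, the bound comes from a decision at one index K past which both
    -- sequences move by at most ε/2, where ε = η/4: either the terms at K already give it, or y < x
    -- holds with margin ε.
    ≤⇒eventually : ∀ {x y} → x D.≤ y → ∀ η → 0ℚ < η → Eventually λ m → seq x m ≤ seq y m + η
    ≤⇒eventually {x} {y} x≤y η 0<η = decide (seq x K ℚ.≤? seq y K + ε + ε)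
      where
      ε = ½ * ½ * η
      0<ε : 0ℚ < ε
      0<ε = 0<* {½ * ½} (0<* 0<½ 0<½) 0<η
      0<ε/2 : 0ℚ < ½ * ε
      0<ε/2 = 0<* 0<½ 0<ε
      M = proj₁ (cauchy x (½ * ε) 0<ε/2)
      N = proj₁ (cauchy y (½ * ε) 0<ε/2)
      K = M ℕ.⊔ N
      hx : ∀ m → K ℕ.≤ m → ∣ seq x m - seq x K ∣ ≤ ½ * ε
      hx m le = proj₂ (cauchy x (½ * ε) 0<ε/2) m K (ℕ.≤-trans (ℕ.m≤m⊔n M N) le) (ℕ.m≤m⊔n M N)
      hy : ∀ m → K ℕ.≤ m → ∣ seq y m - seq y K ∣ ≤ ½ * ε
      hy m le = proj₂ (cauchy y (½ * ε) 0<ε/2) m K (ℕ.≤-trans (ℕ.m≤n⊔m M N) le) (ℕ.m≤n⊔m M N)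

      decide : Dec (seq x K ≤ seq y K + ε + ε) → Eventually λ m → seq x m ≤ seq y m + η
      decide (yes le) = K , λ m K≤m → ≤-by
        (0≤+ (0≤+ (0≤+ (≤⇒0≤ le) (≤⇒0≤ (∣-∣≤⇒≤ {seq x m} {seq x K} (hx m K≤m))))
          (≤⇒0≤ (∣-∣≤⇒≥ {seq y m} {seq y K} (hy m K≤m)))) (ℚ.<⇒≤ 0<ε))
        (solve 5 (λ x x′ y y′ e → let ε = con ½ :* con ½ :* e in
            x′ :+ ((y :+ ε :+ ε :- x) :+ (x :+ con ½ :* ε :- x′) :+ (y′ :+ con ½ :* ε :- y) :+ ε)
            := y′ :+ e) refl (seq x K) (seq x m) (seq y K) (seq y m) η)
      decide (no ¬le) = ⊥-elim (x≤y (ε , 0<ε , K , λ m K≤m → ≤-by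
        (0≤+ (0≤+ (≤⇒0≤ (ℚ.<⇒≤ (ℚ.≰⇒> ¬le))) (≤⇒0≤ (∣-∣≤⇒≥ {seq x m} {seq x K} (hx m K≤m))))
          (≤⇒0≤ (∣-∣≤⇒≤ {seq y m} {seq y K} (hy m K≤m))))
        (solve 5 (λ x x′ y y′ ε →
            y′ :+ ε :+ ((x :- (y :+ ε :+ ε)) :+ (x′ :+ con ½ :* ε :- x) :+
              (y :+ con ½ :* ε :- y′)) := x′)
          refl (seq x K) (seq x m) (seq y K) (seq y m) ε)))

    approximates : {M : D.Matrix n} {μ : Fin n → ℝ} → IsSpectrum M μ →
      (A : Matrix n) → (∀ m i j → seq (M i j) m ≡ A i j) → ∀ x ε → 0ℚ < ε →
      Eventually λ m → ∣ charPoly A (seq x m) - product (λ i → seq x m - seq (μ i) m) ∣ ≤ ε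
    approximates {M = M} {μ} spectrum A M≗A x ε 0<ε = mapᵉ (λ m → subst₂ (λ a b → ∣ a - b ∣ ≤ ε)
        (trans (Seq.charPoly-homo m M x)
          (det-cong λ i j → cong (λ e → scalar (seq x m) i j - e) (M≗A m i j)))
        (Seq.product-homo m (λ i → x D.- μ i)))
      (proj₂ spectrum x ε 0<ε)

    module Roots {N : ℕ} (μ : Fin N → ℝ) (p : ℚ → ℚ)
      (descending : ∀ i j → i Fin.≤ j → μ j D.≤ μ i)
      (close : ∀ x ε → 0ℚ < ε →
        Eventually λ m → ∣ p (seq x m) - product (λ i → seq x m - seq (μ i) m) ∣ ≤ ε) where

      -- The polynomial is evaluated at the moving point μ i. There one factor of the product is
      -- exactly zero at every index, so p is eventually at most half of η ^ N, which is impossible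
      -- beyond t + η.
      eigenvalue≤ : ∀ t → (∀ δ z → 0ℚ < δ → t + δ ≤ z → δ ^ N ≤ p z) →
        ∀ η → 0ℚ < η → ∀ i → Eventually λ m → seq (μ i) m ≤ t + η
      eigenvalue≤ t large η 0<η i = mapᵉ bound (close (μ i) (½ * η ^ N) (0<* 0<½ (0<^ N 0<η)))
        where
        bound : ∀ m → ∣ p (seq (μ i) m) - product (λ j → seq (μ i) m - seq (μ j) m) ∣ ≤ ½ * η ^ N →
          seq (μ i) m ≤ t + η
        bound m le = ℚ.≮⇒≥ λ t+η<μ → <⇒≱ (0<* 0<½ (0<^ N 0<η)) (≤-by
          (0≤+ (≤⇒0≤ (large η (seq (μ i) m) 0<η (ℚ.<⇒≤ t+η<μ)))
               (≤⇒0≤ (∣-∣≤⇒≤ {p (seq (μ i) m)} {0ℚ} (subst (λ z → ∣ p (seq (μ i) m) - z ∣ ≤ ½ * η ^ N)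
                 (product-zero (λ j → seq (μ i) m - seq (μ j) m) i (ℚ.+-inverseʳ (seq (μ i) m))) le))))
          (solve 2 (λ p e → con ½ :* e :+ ((p :- e) :+ (con 0ℚ :+ con ½ :* e :- p)) := con 0ℚ) refl
            (p (seq (μ i) m)) (η ^ N)))

      -- If all μ i were farther than η from z, the product would be at least η ^ N, while p z and
      -- the approximation error together reach only half of that. The index found may vary with m.
      nearRoot : ∀ η z → 0ℚ < η → ∣ p z ∣ ≤ ½ * ½ * η ^ N →
        Eventually λ m → ∃[ i ] ∣ z - seq (μ i) m ∣ ≤ η
      nearRoot η z 0<η small = mapᵉ find (close (D.fromℚ z) (½ * ½ * η ^ N)
        (0<* {½ * ½} (0<* 0<½ 0<½) (0<^ N 0<η)))
        where
        find : ∀ m → ∣ p z - product (λ j → z - seq (μ j) m) ∣ ≤ ½ * ½ * η ^ N →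
          ∃[ i ] ∣ z - seq (μ i) m ∣ ≤ η
        find m le = decide (Fin.any? λ i → ∣ z - seq (μ i) m ∣ ℚ.≤? η)
          where
          Π = product (λ j → z - seq (μ j) m)
          product≤ : ∣ Π ∣ ≤ ½ * ½ * η ^ N + ½ * ½ * η ^ N
          product≤ = subst (λ x → ∣ x ∣ ≤ ½ * ½ * η ^ N + ½ * ½ * η ^ N)
            (solve 2 (λ p q → p :+ :- (p :- q) := q) refl (p z) Π)
            (∣∣-+ small (∣∣-neg le))
          decide : Dec (∃[ i ] ∣ z - seq (μ i) m ∣ ≤ η) → ∃[ i ] ∣ z - seq (μ i) m ∣ ≤ η
          decide (yes found) = found
          decide (no none)   = ⊥-elim (<⇒≱ {0ℚ} {½ * η ^ N} (0<* 0<½ (0<^ N 0<η)) (≤-by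
            (0≤+ (≤⇒0≤ {η ^ N} {∣ Π ∣} (∣product∣≥ (ℚ.<⇒≤ 0<η) (λ j → z - seq (μ j) m) λ i →
                   ℚ.<⇒≤ (ℚ.≰⇒> λ le′ → none (i , le′))))
                 (≤⇒0≤ product≤))
            (solve 2 (λ e p → con ½ :* e :+ ((p :- e) :+
              (con ½ :* con ½ :* e :+ con ½ :* con ½ :* e :- p)) := con 0ℚ)
              refl (η ^ N) ∣ Π ∣)))

      -- Two distinct approximate roots y < t lie near two distinct μ's, one of which has index ≥ 1.
      gap≤ : ∀ t → (∀ δ z → 0ℚ < δ → t + δ ≤ z → δ ^ N ≤ p z) → ∀ η y → 0ℚ < η → y + ι 2 * η < t →
        ∣ p t ∣ ≤ ½ * ½ * η ^ N → ∣ p y ∣ ≤ ½ * ½ * η ^ N →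
        ∀ i₁ i₂ → toℕ i₂ ≡ 1 →
        Eventually λ m → seq (μ i₁) m - seq (μ i₂) m ≤ t - y + ι 3 * η
      gap≤ t large η y 0<η y<t small-t small-y i₁ i₂ i₂≡1 = mapᵉ bound
        (eigenvalue≤ t large η 0<η i₁ ∧ᵉ (nearRoot η t 0<η small-t ∧ᵉ (nearRoot η y 0<η small-y ∧ᵉ
          allᵉ λ j → sorted j)))
        where
        sorted : ∀ j → Eventually λ m → 1 ℕ.≤ toℕ j → seq (μ j) m ≤ seq (μ i₂) m + η
        sorted j with 1 ℕ.≤? toℕ j
        ... | yes 1≤j = mapᵉ (λ m le _ → le) (≤⇒eventually {μ j} {μ i₂}
              (descending i₂ j (subst (ℕ._≤ toℕ j) (sym i₂≡1) 1≤j)) η 0<η)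
        ... | no ¬1≤j = 0 , λ _ _ 1≤j → ⊥-elim (¬1≤j 1≤j)

        bound : ∀ m → seq (μ i₁) m ≤ t + η × (∃[ i ] ∣ t - seq (μ i) m ∣ ≤ η) ×
          (∃[ i ] ∣ y - seq (μ i) m ∣ ≤ η) × (∀ j → 1 ℕ.≤ toℕ j → seq (μ j) m ≤ seq (μ i₂) m + η) →
          seq (μ i₁) m - seq (μ i₂) m ≤ t - y + ι 3 * η
        bound m (μ₁≤ , (r , tr) , (q , yq) , sort) = ≤-by
          (0≤+ (≤⇒0≤ μ₁≤) (≤⇒0≤ y≤μ₂))
          (solve 5 (λ a b t y e → a :- b :+ ((t :+ e :- a) :+ (b :+ con (ι 2) :* e :- y))
              := t :- y :+ con (ι 3) :* e) refl (seq (μ i₁) m) (seq (μ i₂) m) t y η)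
          where
          from : ∀ j z → y ≤ z → ∣ z - seq (μ j) m ∣ ≤ η → 1 ℕ.≤ toℕ j → y ≤ seq (μ i₂) m + ι 2 * η
          from j z y≤z near 1≤j = ≤-by
            (0≤+ (0≤+ (≤⇒0≤ y≤z) (≤⇒0≤ (∣-∣≤⇒≤ {z} {seq (μ j) m} near))) (≤⇒0≤ (sort j 1≤j)))
            (solve 5 (λ y z a b e → y :+ ((z :- y) :+ (a :+ e :- z) :+ (b :+ e :- a)) := b :+ con
              (ι 2) :* e)
              refl y z (seq (μ j) m) (seq (μ i₂) m) η)
          y≤t : y ≤ t
          y≤t = ℚ.≤-trans (≤-by (0≤* (0≤ι 2) (ℚ.<⇒≤ 0<η)) refl) (ℚ.<⇒≤ y<t)

          y≤μ₂ : y ≤ seq (μ i₂) m + ι 2 * η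
          y≤μ₂ = choose (1 ℕ.≤? toℕ r) (1 ℕ.≤? toℕ q)
            where
            zero-index : ∀ (i : Fin N) → ¬ (1 ℕ.≤ toℕ i) → toℕ i ≡ 0
            zero-index i ¬1≤i = ℕ.n<1⇒n≡0 (ℕ.≰⇒> ¬1≤i)
            choose : Dec (1 ℕ.≤ toℕ r) → Dec (1 ℕ.≤ toℕ q) → y ≤ seq (μ i₂) m + ι 2 * η
            choose (yes 1≤r) _         = from r t y≤t tr 1≤r
            choose (no _)    (yes 1≤q) = from q y ℚ.≤-refl yq 1≤q
            choose (no ¬1≤r) (no ¬1≤q) = ⊥-elim (<⇒≱ y<t (≤-by
              (0≤+ (≤⇒0≤ (∣-∣≤⇒≤ {t} {seq (μ r) m} tr))
                   (≤⇒0≤ (∣-∣≤⇒≥ {y} {seq (μ r) m} (subst (λ s → ∣ y - seq (μ s) m ∣ ≤ η) q≡r yq))))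
              (solve 4 (λ t y a e → t :+ ((a :+ e :- t) :+ (y :+ e :- a)) := y :+ con (ι 2) :* e)
                refl t y (seq (μ r) m) η)))
              where
              q≡r : q ≡ r
              q≡r = Fin.toℕ-injective (trans (zero-index q ¬1≤q) (sym (zero-index r ¬1≤r)))

  open Limit

  -- Approximate periodicity

  module Periodic {n : ℕ} .{{_ : ℕ.NonZero n}} {c σ : ℚ} (c²+σ≡1 : c * c + σ ≡ 1ℚ) (0≤σ : 0ℚ ≤ σ) where

    open Rotation c σ
    open Laws c²+σ≡1

    e : ℚ
    e = ι 2 * ∣ g n ∣

    0≤e : 0ℚ ≤ e
    0≤e = 0≤* (0≤ι 2) (ℚ.0≤∣p∣ (g n))

    ∣F∣≤1 : ∀ t → ∣ F t ∣ ≤ 1ℚ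
    ∣F∣≤1 t = ∣f∣≤1 0≤σ (t ℕ.+ t)

    shift≤ : ∀ t q {K} → q ℕ.≤ K → ∣ F (t ℕ.+ q ℕ.* n) - F t ∣ ≤ ι K * e
    shift≤ t q {K} q≤K = ℚ.≤-trans (F-almostPeriodic 0≤σ n t q)
      (*-mono-≤ (0≤ι q) 0≤e (ι-mono q≤K) ℚ.≤-refl)

    congruent≤ : ∀ x y p q → x ℕ.+ p ℕ.* n ≡ y ℕ.+ q ℕ.* n → ∣ F x - F y ∣ ≤ (ι p + ι q) * e
    congruent≤ x y p q eq = subst₂ _≤_
      (cong ∣_∣ (trans (cong (λ z → - (F z - F x) + (F (y ℕ.+ q ℕ.* n) - F y)) eq)
        (solve 3 (λ a b c → :- (c :- a) :+ (c :- b) := a :- b) refl (F x) (F y) (F (y ℕ.+ q ℕ.* n)))))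
      (sym (ℚ.*-distribʳ-+ e (ι p) (ι q)))
      (∣∣-+ (∣∣-neg (F-almostPeriodic 0≤σ n x p)) (F-almostPeriodic 0≤σ n y q))

    -- The case x ≡ -d uses that cosine is even, without negative arguments: in F (x + 2d) + F x = 2
    -- F d F (x + d), F (x + d) is close to F 0 = 1 and F (x + 2d) to F d. The factor 3 is 2 + 1
    -- from these two approximations.
    near≤ : ∀ x d p q → x ℕ.+ p ℕ.* n ≡ d ℕ.+ q ℕ.* n ⊎ x ℕ.+ d ℕ.+ p ℕ.* n ≡ q ℕ.* n →
      ∣ F x - F d ∣ ≤ ι 3 * (ι p + ι q) * e
    near≤ x d p q (inj₁ eq) = ℚ.≤-trans (congruent≤ x d p q eq)
      (≤-by (0≤* (0≤ι 2) (0≤* (0≤+ (0≤ι p) (0≤ι q)) 0≤e))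
        (solve 2 (λ a e → a :* e :+ con (ι 2) :* (a :* e) := con (ι 3) :* a :* e) refl (ι p + ι q) e))
    near≤ x d p q (inj₂ eq) = subst₂ _≤_
      (cong ∣_∣ (trans
        (cong (λ z → ι 2 * F d * (F (x ℕ.+ d) - 1ℚ) + - (F (x ℕ.+ (d ℕ.+ d)) - F d) + z)
          (sym (trans (cong₂ _-_ (F-sum x d) refl) (ℚ.+-inverseʳ (ι 2 * F d * F (x ℕ.+ d))))))
        (solve 4 (λ a b u v → con (ι 2) :* b :* (u :- con 1ℚ) :+ :- (v :- b)
             :+ (v :+ a :- con (ι 2) :* b :* u) := a :- b) refl
          (F x) (F d) (F (x ℕ.+ d)) (F (x ℕ.+ (d ℕ.+ d))))))
      (solve 2 (λ a e → con (ι 2) :* con 1ℚ :* (a :* e) :+ a :* e :+ con 0ℚ := con (ι 3) :* a :* e)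
        refl (ι p + ι q) e)
      (∣∣-+ (∣∣-+ (∣∣-* (∣∣-* {p = ι 2} {b = ι 2} ℚ.≤-refl (∣F∣≤1 d))
          (congruent≤ (x ℕ.+ d) 0 p q eq))
        (∣∣-neg (congruent≤ (x ℕ.+ (d ℕ.+ d)) d p q
          (trans (shuffle x d (p ℕ.* n)) (cong (d ℕ.+_) eq)))))
        ℚ.≤-refl)
      where
      shuffle : ∀ x d p → x ℕ.+ (d ℕ.+ d) ℕ.+ p ≡ d ℕ.+ (x ℕ.+ d ℕ.+ p)
      shuffle = ℕ-Solver.solve-∀

    module _ (j : ℕ) where

      -- A crude bound for the number of periods removed when the argument j x is reduced, for x ≤ 3
      -- n.
      L : ℕ
      L = j ℕ.* (3 ℕ.* n)

      wrap : ∀ x → x ℕ.≤ 3 ℕ.* n → ∣ F (j ℕ.* x) - F (j ℕ.* (x ℕ.% n)) ∣ ≤ ι L * e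
      wrap x x≤3n = subst (λ z → ∣ F z - F (j ℕ.* (x ℕ.% n)) ∣ ≤ ι L * e)
        (sym (trans (cong (j ℕ.*_) (m≡m%n+[m/n]*n x n)) (distrib j (x ℕ.% n) (x ℕ./ n) n)))
        (shift≤ (j ℕ.* (x ℕ.% n)) (j ℕ.* (x ℕ./ n)) (ℕ.*-monoʳ-≤ j (begin
          x ℕ./ n                       ≤⟨ ℕ.m≤m*n (x ℕ./ n) n ⟩
          x ℕ./ n ℕ.* n                 ≤⟨ ℕ.m≤n+m (x ℕ./ n ℕ.* n) (x ℕ.% n) ⟩
          x ℕ.% n ℕ.+ x ℕ./ n ℕ.* n     ≡⟨ m≡m%n+[m/n]*n x n ⟨
          x                             ≤⟨ x≤3n ⟩
          3 ℕ.* n                       ∎)))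
        where
        open ℕ.≤-Reasoning
        distrib : ∀ j r q n → j ℕ.* (r ℕ.+ q ℕ.* n) ≡ j ℕ.* r ℕ.+ j ℕ.* q ℕ.* n
        distrib = ℕ-Solver.solve-∀

      G : Fin n → ℚ
      G i = F (j ℕ.* toℕ i)

      G-sum : ∀ (r : Fin n) s → s ℕ.≤ n →
        ∣ ι 2 * F (j ℕ.* s) * G r - (G (r ⊕ (n ℕ.∸ s)) + G (r ⊕ s)) ∣ ≤ ι 4 * (ι L * e)
      G-sum r s s≤n = subst₂ _≤_
        (cong ∣_∣ (trans
          (cong (λ z → ι 2 * F (j ℕ.* s) * - (F (j ℕ.* x₃) - G r)
              + (F (j ℕ.* x₂) - G (r ⊕ s)) + (F (j ℕ.* x₁) - G (r ⊕ (n ℕ.∸ s))) - z)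
            (sym (trans (cong₂ _-_ sum≡ refl) (ℚ.+-inverseʳ (ι 2 * F (j ℕ.* s) * F (j ℕ.* x₃))))))
          (solve 7 (λ u x₁ x₂ x₃ a b r → u :* :- (x₃ :- r) :+ (x₂ :- b) :+ (x₁ :- a)
              :- (x₂ :+ x₁ :- u :* x₃) := u :* r :- (a :+ b)) refl
            (ι 2 * F (j ℕ.* s)) (F (j ℕ.* x₁)) (F (j ℕ.* x₂)) (F (j ℕ.* x₃))
            (G (r ⊕ (n ℕ.∸ s))) (G (r ⊕ s)) (G r))))
        (solve 1 (λ l → con (ι 2) :* con 1ℚ :* l :+ l :+ l :+ con 0ℚ := con (ι 4) :* l) refl (ι L * e))
        (∣∣-+ (∣∣-+ (∣∣-+
            (∣∣-* (∣∣-* {p = ι 2} {b = ι 2} ℚ.≤-refl (∣F∣≤1 (j ℕ.* s)))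
              (∣∣-neg (at x₃ r (trans ([m+n]%n≡m%n (toℕ r) n) (m<n⇒m%n≡m (Fin.toℕ<n r))) x₃≤)))
            (at x₂ (r ⊕ s) (trans ([m+n]%n≡m%n (toℕ r ℕ.+ s) n) (sym (toℕ-⊕ r s))) x₂≤))
            (at x₁ (r ⊕ (n ℕ.∸ s)) (sym (toℕ-⊕ r (n ℕ.∸ s))) x₁≤))
          (ℚ.≤-refl {0ℚ}))
        where
        -- Representatives of r - s, r + s and r, with x₁ and x₂ at distance s on either side of x₃,
        -- so that `F-sum` applies exactly before they are reduced modulo n.
        x₁ = toℕ r ℕ.+ (n ℕ.∸ s)
        x₂ = toℕ r ℕ.+ s ℕ.+ n
        x₃ = toℕ r ℕ.+ n
        r≤n = ℕ.<⇒≤ (Fin.toℕ<n r)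
        x₃≤ : x₃ ℕ.≤ 3 ℕ.* n
        x₃≤ = ℕ.+-mono-≤ r≤n (ℕ.m≤m+n n (n ℕ.+ 0))
        x₂≤ : x₂ ℕ.≤ 3 ℕ.* n
        x₂≤ = ℕ.≤-trans (ℕ.+-monoˡ-≤ n (ℕ.+-mono-≤ r≤n s≤n)) (ℕ.≤-reflexive (three n))
          where
          three : ∀ n → n ℕ.+ n ℕ.+ n ≡ 3 ℕ.* n
          three = ℕ-Solver.solve-∀
        x₁≤ : x₁ ℕ.≤ 3 ℕ.* n
        x₁≤ = ℕ.≤-trans (ℕ.+-monoʳ-≤ (toℕ r) (ℕ.m∸n≤m n s)) x₃≤
        at : ∀ x i → x ℕ.% n ≡ toℕ i → x ℕ.≤ 3 ℕ.* n → ∣ F (j ℕ.* x) - G i ∣ ≤ ι L * e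
        at x i eq x≤ = subst (λ z → ∣ F (j ℕ.* x) - F (j ℕ.* z) ∣ ≤ ι L * e) eq (wrap x x≤)
        sum≡ : F (j ℕ.* x₂) + F (j ℕ.* x₁) ≡ ι 2 * F (j ℕ.* s) * F (j ℕ.* x₃)
        sum≡ = trans
          (cong (λ z → F z + F (j ℕ.* x₁)) (trans (cong (λ m → j ℕ.* (toℕ r ℕ.+ s ℕ.+ m))
            (sym (ℕ.m∸n+n≡m s≤n)))
            (shuffle₂ j (toℕ r) s (n ℕ.∸ s))))
          (trans (F-sum (j ℕ.* x₁) (j ℕ.* s))
            (cong (λ z → ι 2 * F (j ℕ.* s) * F z) (trans (shuffle₃ j (toℕ r) s (n ℕ.∸ s))
              (cong (λ m → j ℕ.* (toℕ r ℕ.+ m)) (ℕ.m∸n+n≡m s≤n)))))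
          where
          shuffle₂ : ∀ j r s t → j ℕ.* (r ℕ.+ s ℕ.+ (t ℕ.+ s)) ≡ j ℕ.* (r ℕ.+ t) ℕ.+
            (j ℕ.* s ℕ.+ j ℕ.* s)
          shuffle₂ = ℕ-Solver.solve-∀
          shuffle₃ : ∀ j r s t → j ℕ.* (r ℕ.+ t) ℕ.+ j ℕ.* s ≡ j ℕ.* (r ℕ.+ (t ℕ.+ s))
          shuffle₃ = ℕ-Solver.solve-∀

  -- Approximate eigenvectors

  multiplicity-sym : (G : Multigraph) (u v : Fin (order G)) → multiplicity G u v ≡ multiplicity G v u
  multiplicity-sym G u v = cong length (List.filter-≐ _ _ (Sum.swap , Sum.swap) (edges G))

  scalar-δ : ∀ {n} (z : ℚ) (i j : Fin n) → scalar z i j ≡ z * δ j i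
  scalar-δ z i j with i Fin.≟ j
  ... | yes refl = sym (trans (cong (z *_) (δ-yes {i = i} refl)) (ℚ.*-identityʳ z))
  ... | no i≢j   = sym (trans (cong (z *_) (δ-no (i≢j ∘ sym))) (ℚ.*-zeroʳ z))

  term≤sum : ∀ {n} (f : Fin n → ℚ) → (∀ i → 0ℚ ≤ f i) → ∀ i → f i ≤ sum f
  term≤sum f 0≤f zero    = ≤-by (0≤sum (0≤f ∘ suc)) refl
  term≤sum f 0≤f (suc i) = ℚ.≤-trans (term≤sum (f ∘ suc) (0≤f ∘ suc) i)
    (≤-by (0≤f zero) (ℚ.+-comm (sum (f ∘ suc)) (f zero)))

  sum-scalar : ∀ {n} (z : ℚ) (A : Matrix n) (w : Fin n → ℚ) (v : Fin n) →
    sum (λ u → w u * (scalar z u v + - A u v)) ≡ z * w v - sum (λ u → w u * A u v)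
  sum-scalar z A w v = begin
    sum (λ u → w u * (scalar z u v + - A u v))
      ≡⟨ sum-cong (λ u → trans (cong (λ s → w u * (s + - A u v)) (scalar-δ z u v))
           (solve 4 (λ w z d a → w :* (z :* d :+ :- a) := z :* (w :* d) :+ con (- 1ℚ) :* (w :* a)) refl
             (w u) z (δ v u) (A u v))) ⟩
    sum (λ u → z * (w u * δ v u) + - 1ℚ * (w u * A u v))
      ≡⟨ sum-+ (λ u → z * (w u * δ v u)) (λ u → - 1ℚ * (w u * A u v)) ⟩
    sum (λ u → z * (w u * δ v u)) + sum (λ u → - 1ℚ * (w u * A u v))
      ≡⟨ cong₂ _+_ (sym (*-sum z λ u → w u * δ v u)) (sym (*-sum (- 1ℚ) λ u → w u * A u v)) ⟩
    z * sum (λ u → w u * δ v u) + - 1ℚ * sum (λ u → w u * A u v)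
      ≡⟨ cong₂ (λ x y → z * x + y) (sum-δ w (λ u → u) v v refl λ _ eq → eq)
           (solve 1 (λ x → con (- 1ℚ) :* x := :- x) refl (sum λ u → w u * A u v)) ⟩
    z * w v - sum (λ u → w u * A u v) ∎
    where open ≡-Reasoning

  0<detBound : ∀ {K} → 0ℚ < K → ∀ n → 0ℚ < detBound K n
  0<detBound 0<K zero    = 0<1
  0<detBound 0<K (suc n) = 0<* (0<ι {suc n} (s≤s z≤n)) (0<* 0<1 (0<* 0<K (0<detBound 0<K n)))

  module PetersenMatrix {n k : ℕ} .{{_ : ℕ.NonZero n}} (1<n : 1 ℕ.< n) (1≤k : 1 ℕ.≤ k)
    (k<n : k ℕ.< n) where

    open Petersen 1<n 1≤k k<n

    A : Matrix (n ℕ.+ n)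
    A u v = ι (multiplicity (P n k) u v)

    vertex-cases : (X : Fin (n ℕ.+ n) → Set) → (∀ r → X (a r)) → (∀ r → X (b r)) → ∀ v → X v
    vertex-cases X xa xb v = go (splitAt n v) refl
      where
      go : ∀ s → splitAt n v ≡ s → X v
      go (inj₁ r) eq = subst X (Fin.splitAt⁻¹-↑ˡ eq) (xa r)
      go (inj₂ r) eq = subst X (Fin.splitAt⁻¹-↑ʳ eq) (xb r)

    cubic : ∀ v → sum (λ u → 1ℚ * A u v) ≡ ι 3
    cubic = vertex-cases (λ v → sum (λ u → 1ℚ * A u v) ≡ ι 3) (column-a (λ _ → 1ℚ))
      (column-b (λ _ → 1ℚ))

    0≤A : ∀ u v → 0ℚ ≤ A u v
    0≤A u v = 0≤ι (multiplicity (P n k) u v)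

    A≤3 : ∀ u v → A u v ≤ ι 3
    A≤3 u v = subst₂ _≤_ (ℚ.*-identityˡ (A u v)) (cubic v)
      (term≤sum (λ u → 1ℚ * A u v) (λ u → 0≤* 0≤1 (0≤A u v)) u)

    entry≤ : ∀ z → ∣ z ∣ ≤ ι 3 → ∀ u v → ∣ scalar z u v + - A u v ∣ ≤ ι 6
    entry≤ z ∣z∣≤3 u v = ∣∣-+ {scalar z u v} {b = ι 3} {c = ι 3} (scalar≤ (does (u Fin.≟ v)))
      (∣∣-neg (subst (_≤ ι 3) (sym (ℚ.0≤p⇒∣p∣≡p (0≤A u v))) (A≤3 u v)))
      where
      scalar≤ : ∀ t → ∣ (if t then z else 0ℚ) ∣ ≤ ι 3
      scalar≤ true  = ∣z∣≤3
      scalar≤ false = 0≤ι 3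

    -- Cubicity is known for columns while `det-mMatrix` asks for row sums; the symmetry of the
    -- multiplicities bridges the two.
    charPoly-large : ∀ δ z → 0ℚ < δ → ι 3 + δ ≤ z → δ ^ (n ℕ.+ n) ≤ charPoly A z
    charPoly-large δ′ z 0<δ z≥ = det-mMatrix 0<δ (λ u v → scalar z u v + - A u v) off rows
      where
      off : ∀ u v → u ≢ v → scalar z u v + - A u v ≤ 0ℚ
      off u v u≢v = ≤-by (0≤A u v) (trans
        (cong (λ s → s + - A u v + A u v) (trans (scalar-δ z u v) (cong (z *_) (δ-no (u≢v ∘ sym)))))
        (solve 2 (λ z a → z :* con 0ℚ :+ :- a :+ a := con 0ℚ) refl z (A u v)))
      rows : ∀ u → δ′ ≤ sum (λ v → scalar z u v + - A u v)
      rows u = subst (δ′ ≤_)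
        (sym (trans
          (sum-cong λ v → trans
            (cong₂ (λ s t → s + - t) (trans (scalar-δ z u v)
              (trans (cong (z *_) (δ-sym v u)) (sym (scalar-δ z v u))))
              (cong ι (multiplicity-sym (P n k) u v)))
            (sym (ℚ.*-identityˡ (scalar z v u + - A v u))))
          (trans (sum-scalar z A (λ _ → 1ℚ) u) (cong (λ s → z * 1ℚ - s) (cubic u)))))
        (≤-by (≤⇒0≤ z≥) (solve 3 (λ d z t → d :+ (z :- (t :+ d)) := z :* con 1ℚ :- t) refl δ′ z (ι 3)))

    origin : Fin n
    origin = fromℕ< (ℕ.<⇒≤ 1<n)

    toℕ-origin : toℕ origin ≡ 0
    toℕ-origin = Fin.toℕ-fromℕ< (ℕ.<⇒≤ 1<n)

    -- Converts a residual into a bound for the characteristic polynomial. It depends on n only, so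
    -- residuals can be chosen small relative to it.
    scale : ℚ
    scale = ι (n ℕ.+ n) * (1ℚ * detBound (ι 6) (ℕ.pred (n ℕ.+ n)))

    charPoly-small : ∀ z (w : Fin (n ℕ.+ n) → ℚ) ρ → ∣ z ∣ ≤ ι 3 → w (a origin) ≡ 1ℚ →
      (∀ v → ∣ z * w v - sum (λ u → w u * A u v) ∣ ≤ ρ) → ∣ charPoly A z ∣ ≤ scale * ρ
    charPoly-small z w ρ ∣z∣≤3 w₀ residual = subst (∣ charPoly A z ∣ ≤_)
      (solve 3 (λ N r D → N :* (r :* (con 1ℚ :* D)) := N :* (con 1ℚ :* D) :* r) refl
        (ι (n ℕ.+ n)) ρ (detBound (ι 6) (ℕ.pred (n ℕ.+ n))))
      (∣det∣≤residual (λ u v → scalar z u v + - A u v) w (a origin)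
        (trans (Fin.toℕ-↑ˡ origin n) toℕ-origin) w₀ (entry≤ z ∣z∣≤3)
        λ v → subst (λ s → ∣ s ∣ ≤ ρ) (sym (sum-scalar z A w v)) (residual v))

    0<scale : 0ℚ < scale
    0<scale = 0<* (0<ι {n ℕ.+ n} (ℕ.m≤n⇒m≤n+o n (ℕ.<⇒≤ 1<n)))
      (0<* 0<1 (0<detBound (0<ι {6} (s≤s z≤n)) (ℕ.pred (n ℕ.+ n))))

    charPoly-3 : ∣ charPoly A (ι 3) ∣ ≤ 0ℚ
    charPoly-3 = subst (∣ charPoly A (ι 3) ∣ ≤_) (ℚ.*-zeroʳ scale)
      (charPoly-small (ι 3) (λ _ → 1ℚ) 0ℚ ℚ.≤-refl refl λ v →
        ℚ.≤-reflexive (cong (λ s → ∣ ι 3 * 1ℚ - s ∣) (cubic v)))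

    module Wave {c σ : ℚ} (c²+σ≡1 : c * c + σ ≡ 1ℚ) (0≤σ : 0ℚ ≤ σ) (j d p q : ℕ)
      (near : j ℕ.* k ℕ.+ p ℕ.* n ≡ d ℕ.+ q ℕ.* n ⊎ j ℕ.* k ℕ.+ d ℕ.+ p ℕ.* n ≡ q ℕ.* n) where

      open Rotation c σ
      open Periodic {n} {c} {σ} c²+σ≡1 0≤σ

      c₁ c₂ : ℚ
      c₁ = F j
      c₂ = F d

      -- The first summand is the cost of reducing indices modulo n, the second that of replacing F
      -- (j k) by F d in `G-sum₂`.
      C : ℚ
      C = ι 4 * ι (L j) + ι 2 * (ι 3 * (ι p + ι q))

      G-sum₁ : ∀ r → ∣ ι 2 * c₁ * G j r - (G j (r ⊖ 1) + G j (r ⊕ 1)) ∣ ≤ C * e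
      G-sum₁ r = ℚ.≤-trans
        (subst (λ s → ∣ ι 2 * F s * G j r - (G j (r ⊖ 1) + G j (r ⊕ 1)) ∣ ≤ ι 4 * (ι (L j) * e))
          (ℕ.*-identityʳ j) (G-sum j r 1 (ℕ.<⇒≤ 1<n)))
        (≤-by (0≤* (0≤* (0≤ι 2) (0≤* (0≤ι 3) (0≤+ (0≤ι p) (0≤ι q)))) 0≤e)
          (solve 3 (λ l m e → con (ι 4) :* (l :* e) :+ m :* e := (con (ι 4) :* l :+ m) :* e) refl
            (ι (L j)) (ι 2 * (ι 3 * (ι p + ι q))) e))

      G-sum₂ : ∀ r → ∣ ι 2 * c₂ * G j r - (G j (r ⊖ k) + G j (r ⊕ k)) ∣ ≤ C * e
      G-sum₂ r = subst₂ _≤_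
        (cong ∣_∣ (solve 4 (λ u v g s → (con (ι 2) :* u :* g :- s) :+ con (ι 2) :* :- (u :- v) :* g
            := con (ι 2) :* v :* g :- s) refl (F (j ℕ.* k)) c₂ (G j r) (G j (r ⊖ k) + G j (r ⊕ k))))
        (solve 3 (λ l m e → con (ι 4) :* (l :* e) :+ con (ι 2) :* (con (ι 3) :* m :* e) :* con 1ℚ
            := (con (ι 4) :* l :+ con (ι 2) :* (con (ι 3) :* m)) :* e) refl (ι (L j)) (ι p + ι q) e)
        (∣∣-+ (G-sum j r k (ℕ.<⇒≤ k<n))
          (∣∣-* (∣∣-* {p = ι 2} {b = ι 2} ℚ.≤-refl (∣∣-neg (near≤ (j ℕ.* k) d p q near)))
            (∣F∣≤1 (j ℕ.* toℕ r))))

      -- For y an eigenvalue of the block ((2 c₁, 1), (1, 2 c₂)), up to an error in its characteristic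
      -- equation, w = (F(ji), (y - 2 c₁) F(ji)) is an approximate eigenvector.
      charPoly-wave : ∀ y ρ → ∣ y ∣ ≤ ι 3 → ∣ (y - ι 2 * c₁) * (y - ι 2 * c₂) - 1ℚ ∣ ≤ ρ →
        ∣ charPoly A y ∣ ≤ scale * (ι 5 * (C * e) + ρ)
      charPoly-wave y ρ ∣y∣≤3 block = charPoly-small y w _ ∣y∣≤3
        (trans (w-a origin) (trans (cong (λ t → F (j ℕ.* t)) toℕ-origin) (cong F (ℕ.*-zeroʳ j))))
        (vertex-cases (λ v → ∣ y * w v - sum (λ u → w u * A u v) ∣ ≤ ι 5 * (C * e) + ρ) at-a at-b)
        where
        β = y - ι 2 * c₁
        w : Fin (n ℕ.+ n) → ℚ
        w v = [ G j , (λ r → β * G j r) ]′ (splitAt n v)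

        w-a : ∀ r → w (a r) ≡ G j r
        w-a r = cong [ G j , (λ r → β * G j r) ]′ (Fin.splitAt-↑ˡ n r n)
        w-b : ∀ r → w (b r) ≡ β * G j r
        w-b r = cong [ G j , (λ r → β * G j r) ]′ (Fin.splitAt-↑ʳ n n r)

        0≤ρ : 0ℚ ≤ ρ
        0≤ρ = ℚ.≤-trans (ℚ.0≤∣p∣ _) block

        0≤Ce : 0ℚ ≤ C * e
        0≤Ce = ℚ.≤-trans (ℚ.0≤∣p∣ _) (G-sum₁ origin)

        ∣β∣≤5 : ∣ β ∣ ≤ ι 5
        ∣β∣≤5 = ∣∣-+ {b = ι 3} {c = ι 2} ∣y∣≤3 (∣∣-neg
          (∣∣-* {p = ι 2} {b = ι 2} {c = 1ℚ} ℚ.≤-refl (∣F∣≤1 j)))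

        -- The factor β on the inner vertices is chosen so that at outer vertices y and β cancel,
        -- leaving only the residual of the outer cycle. At inner vertices the defect of the block
        -- equation remains as well.
        at-a : ∀ r → ∣ y * w (a r) - sum (λ u → w u * A u (a r)) ∣ ≤ ι 5 * (C * e) + ρ
        at-a r = ℚ.≤-trans
          (subst (λ s → ∣ s ∣ ≤ C * e)
            (sym (trans
              (cong₂ (λ s t → y * s - t) (w-a r) (trans (column-a w r)
                (cong₂ _+_ (cong₂ _+_ (w-a (r ⊖ 1)) (w-a (r ⊕ 1))) (w-b r))))
              (solve 5 (λ y c g g₁ g₂ → y :* g :- (g₁ :+ g₂ :+ (y :- con (ι 2) :* c) :* g)
                  := con (ι 2) :* c :* g :- (g₁ :+ g₂)) refl y c₁ (G j r) (G j (r ⊖ 1)) (G j (r ⊕ 1)))))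
            (G-sum₁ r))
          (≤-by (0≤+ (0≤* (0≤ι 4) 0≤Ce) 0≤ρ)
            (solve 2 (λ a b → a :+ (con (ι 4) :* a :+ b) := con (ι 5) :* a :+ b) refl (C * e) ρ))

        at-b : ∀ r → ∣ y * w (b r) - sum (λ u → w u * A u (b r)) ∣ ≤ ι 5 * (C * e) + ρ
        at-b r = subst₂ (λ s t → ∣ s ∣ ≤ t)
          (sym (trans
            (cong₂ (λ s t → y * s - t) (w-b r) (trans (column-b w r)
              (cong₂ _+_ (cong₂ _+_ (w-b (r ⊖ k)) (w-b (r ⊕ k))) (w-a r))))
            (solve 6 (λ y b c g g₁ g₂ → y :* (b :* g) :- (b :* g₁ :+ b :* g₂ :+ g)
                := b :* (con (ι 2) :* c :* g :- (g₁ :+ g₂)) :+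
                  (b :* (y :- con (ι 2) :* c) :- con 1ℚ) :* g) refl
              y β c₂ (G j r) (G j (r ⊖ k)) (G j (r ⊕ k)))))
          (cong (λ x → ι 5 * (C * e) + x) (ℚ.*-identityʳ ρ))
          (∣∣-+ (∣∣-* ∣β∣≤5 (G-sum₂ r)) (∣∣-* block (∣F∣≤1 (j ℕ.* toℕ r))))

  -- Approximate eigenvalues

  block : ℚ → ℚ → ℚ → ℚ
  block c₁ c₂ y = (y - ι 2 * c₁) * (y - ι 2 * c₂) - 1ℚ

  -- At 1 + c₁ + c₂ the block polynomial is -(c₁ - c₂)² ≤ 0. At 3 - κ/2 it is at least κ/4 + 3κ(1 -
  -- κ)/4 > 0, because κ ≤ 1 - c₁ and c₂ ≤ 1. Bisection between them keeps y both large enough for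
  -- the gap and away from 3.
  blockRoot : ∀ {c₁ c₂ κ ε} → ∣ c₁ ∣ ≤ 1ℚ → ∣ c₂ ∣ ≤ 1ℚ → 0ℚ < κ → κ ≤ 1ℚ → κ ≤ 1ℚ - c₁ → 0ℚ < ε →
    ∃[ y ] (1ℚ + c₁ + c₂ ≤ y × y ≤ ι 3 - ½ * κ × ∣ block c₁ c₂ y ∣ ≤ ε)
  blockRoot {c₁} {c₂} {κ} {ε} ∣c₁∣≤1 ∣c₂∣≤1 0<κ κ≤1 κ≤1-c₁ 0<ε =
    let η , 0<η , 10η≡ε = shrink (0<ι {10} (s≤s z≤n)) 0<ε
    in rootIn η (ℚ.<⇒≤ 0<η) 10η≡ε (bisect (λ y → 0ℚ ℚ.<? block c₁ c₂ y) 0<η lo≤hi ¬lo 0<hi)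
    where
    lo = 1ℚ + c₁ + c₂
    hi = ι 3 - ½ * κ
    0≤κ = ℚ.<⇒≤ 0<κ
    0≤½ = ℚ.<⇒≤ 0<½

    0≤1-c : ∀ {c} → ∣ c ∣ ≤ 1ℚ → 0ℚ ≤ 1ℚ - c
    0≤1-c {c} h = ≤⇒0≤ (ℚ.≤-trans (p≤∣p∣ c) h)

    0≤1+c : ∀ {c} → ∣ c ∣ ≤ 1ℚ → 0ℚ ≤ 1ℚ + c
    0≤1+c {c} h = 0≤-by (≤⇒0≤ (ℚ.≤-trans (p≤∣p∣ (- c)) (∣∣-neg {c} h)))
      (solve 1 (λ c → con 1ℚ :- :- c := con 1ℚ :+ c) refl c)

    lo≤hi : lo ≤ hi
    lo≤hi = ≤-by (0≤+ (0≤+ (≤⇒0≤ κ≤1-c₁) (0≤1-c ∣c₂∣≤1)) (0≤* 0≤½ 0≤κ))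
      (solve 3 (λ a b κ → con 1ℚ :+ a :+ b :+ ((con 1ℚ :- a :- κ) :+ (con 1ℚ :- b) :+ con ½ :* κ)
        := con (ι 3) :- con ½ :* κ) refl c₁ c₂ κ)

    ¬lo : ¬ (0ℚ < block c₁ c₂ lo)
    ¬lo 0<lo = <⇒≱ 0<lo (≤-by (0≤sq (c₁ - c₂))
      (solve 2 (λ a b → let y = con 1ℚ :+ a :+ b in
          (y :- con (ι 2) :* a) :* (y :- con (ι 2) :* b) :- con 1ℚ :+ (a :- b) :* (a :- b) := con 0ℚ)
        refl c₁ c₂))

    0<hi : 0ℚ < block c₁ c₂ hi
    0<hi = <-by
      (0<+≤ (0<+≤ (0<+≤ (0<* 0<½ (0<* 0<½ 0<κ))
          (0≤* (0≤* 0≤½ (0≤* 0≤½ (0≤ι 3))) (0≤* 0≤κ (≤⇒0≤ κ≤1))))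
          (0≤* (0≤* (0≤ι 2) (≤⇒0≤ κ≤1-c₁))
            (0≤+ (0≤+ 0≤½ (0≤* 0≤½ (≤⇒0≤ κ≤1))) (0≤* (0≤ι 2) (0≤1-c ∣c₂∣≤1)))))
          (0≤* (0≤* (0≤ι 2) (0≤1-c ∣c₂∣≤1)) (0≤+ 0≤1 (0≤* (0≤* 0≤½ (0≤ι 3)) 0≤κ))))
      (solve 3 (λ a b κ →
          let A = con 1ℚ :- a :- κ
              B = con 1ℚ :- b
              y = con (ι 3) :- con ½ :* κ
          in con 0ℚ :+ (con ½ :* (con ½ :* κ) :+ con ½ :* (con ½ :* con (ι 3)) :* (κ :* (con 1ℚ :- κ))
               :+ con (ι 2) :* A :* (con ½ :+ con ½ :* (con 1ℚ :- κ) :+ con (ι 2) :* B)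
               :+ con (ι 2) :* B :* (con 1ℚ :+ con ½ :* con (ι 3) :* κ))
             := (y :- con (ι 2) :* a) :* (y :- con (ι 2) :* b) :- con 1ℚ)
        refl c₁ c₂ κ)

    rootIn : ∀ η → 0ℚ ≤ η → ι 10 * η ≡ ε → Bracket (λ y → 0ℚ < block c₁ c₂ y) lo hi η →
      ∃[ y ] (lo ≤ y × y ≤ hi × ∣ block c₁ c₂ y ∣ ≤ ε)
    rootIn η 0≤η 10η≡ε br = y , ℚ.≤-trans lo≤lo′ lo′≤hi′ , hi′≤hi
      , subst (_≤ ε) (sym (ℚ.0≤p⇒∣p∣≡p (ℚ.<⇒≤ Phi))) (≤-by
          (0≤+ (≤⇒0≤ (ℚ.≮⇒≥ ¬Plo)) (≤⇒0≤ product≤))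
          (trans (solve 5 (λ a b x y η →
              (y :- con (ι 2) :* a) :* (y :- con (ι 2) :* b) :- con 1ℚ
              :+ ((con 0ℚ :- ((x :- con (ι 2) :* a) :* (x :- con (ι 2) :* b) :- con 1ℚ))
                  :+ (η :* con (ι 10) :- (y :- x) :* (y :+ x :- con (ι 2) :* a :- con (ι 2) :* b)))
              := con (ι 10) :* η) refl c₁ c₂ x y η) 10η≡ε))
      where
      open Bracket br
      x = lo′
      y = hi′
      y≤3 : y ≤ ι 3
      y≤3 = ℚ.≤-trans hi′≤hi (≤-by (0≤* 0≤½ 0≤κ)
        (solve 1 (λ a → con (ι 3) :- a :+ a := con (ι 3)) refl (½ * κ)))
      -- The difference quotient of the block polynomial between x and y. It is at most 3 + 3 + 2 +
      -- 2 = 10, which is why η was taken as ε/10.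
      slope = y + x - ι 2 * c₁ - ι 2 * c₂
      0≤slope : 0ℚ ≤ slope
      0≤slope = 0≤-by (0≤+ (0≤+ (0≤+ (≤⇒0≤ lo≤lo′) (≤⇒0≤ lo≤lo′)) (≤⇒0≤ lo′≤hi′)) (0≤ι 2))
        (solve 4 (λ a b x y → let l = con 1ℚ :+ a :+ b in (x :- l) :+ (x :- l) :+ (y :- x) :+ con (ι 2)
          := y :+ x :- con (ι 2) :* a :- con (ι 2) :* b) refl c₁ c₂ x y)
      slope≤10 : slope ≤ ι 10
      slope≤10 = ≤-by
        (0≤+ (0≤+ (0≤+ (≤⇒0≤ y≤3) (≤⇒0≤ (ℚ.≤-trans lo′≤hi′ y≤3))) (0≤* (0≤ι 2) (0≤1+c ∣c₁∣≤1)))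
          (0≤* (0≤ι 2) (0≤1+c ∣c₂∣≤1)))
        (solve 4 (λ a b x y → y :+ x :- con (ι 2) :* a :- con (ι 2) :* b
            :+ ((con (ι 3) :- y) :+ (con (ι 3) :- x) :+ con (ι 2) :* (con 1ℚ :+ a) :+ con (ι 2) :*
              (con 1ℚ :+ b))
            := con (ι 10)) refl c₁ c₂ x y)
      product≤ : (y - x) * slope ≤ η * ι 10
      product≤ = *-mono-≤ (≤⇒0≤ lo′≤hi′) 0≤slope
        (≤-by (≤⇒0≤ width) (solve 3 (λ x y η → y :- x :+ (x :+ η :- y) := η) refl x y η)) slope≤10

  module _ {n k Q : ℕ} .{{_ : ℕ.NonZero n}} (4≤n : 4 ℕ.≤ n) (1≤k : 1 ℕ.≤ k) (k<n : k ℕ.< n)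
    (1≤Q : 1 ℕ.≤ Q) (Q²≤n : Q ℕ.* Q ℕ.≤ n) where

    open PetersenMatrix {n} {k} (ℕ.≤-trans (s≤s (s≤s z≤n)) 4≤n) 1≤k k<n

    ApproxEigenvalue : ℚ → ℚ → Set
    ApproxEigenvalue θ ε =
      ∃[ y ] (θ ≤ ι 3 - y × ι Q * ι Q * (ι 3 - y) ≤ ι 48 × ∣ charPoly A y ∣ ≤ ε)

    private
      N = ι n

      1≤n : 1 ℕ.≤ n
      1≤n = ℕ.≤-trans (s≤s z≤n) 4≤n

      0<N : 0ℚ < N
      0<N = 0<ι {n} 1≤n

      module FromAngle (j d p q : ℕ) (1≤j : 1 ℕ.≤ j) (j≤Q : j ℕ.≤ Q) (dQ≤n : d ℕ.* Q ℕ.≤ n)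
        (near : j ℕ.* k ℕ.+ p ℕ.* n ≡ d ℕ.+ q ℕ.* n ⊎ j ℕ.* k ℕ.+ d ℕ.+ p ℕ.* n ≡ q ℕ.* n)
        {κ : ℚ} (0<κ : 0ℚ < κ) (N⁴κ≡1 : N * N * (N * N) * κ ≡ 1ℚ)
        {ε₁ : ℚ} (ang : Angle n ε₁) where

        open Angle ang

        σ = 1ℚ - c * c

        c²+σ≡1 : c * c + σ ≡ 1ℚ
        c²+σ≡1 = c²+1-c² c

        0≤σ : 0ℚ ≤ σ
        0≤σ = 0≤-by (0≤* (≤⇒0≤ c≤1) (0≤+ 0≤1 0≤c))
          (solve 1 (λ c → (con 1ℚ :- c) :* (con 1ℚ :+ c) := con 1ℚ :- c :* c) refl c)

        ½≤N²σ : ½ ≤ N * N * σ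
        ½≤N²σ = ℚ.≤-trans 1-c≥ (≤-by (0≤* (0≤* (0≤ι n) (0≤ι n)) (0≤* 0≤c (≤⇒0≤ c≤1)))
          (solve 2 (λ A c → A :* (con 1ℚ :- c) :+ A :* (c :* (con 1ℚ :- c)) := A :* (con 1ℚ :- c :* c))
            refl (N * N) c))

        N²σ≤12 : N * N * σ ≤ ι 12
        N²σ≤12 = ≤-by (0≤+ (0≤* (0≤ι 2) (≤⇒0≤ 1-c≤)) (0≤* (0≤* (0≤ι n) (0≤ι n)) (0≤sq (1ℚ - c))))
          (solve 2 (λ A c → A :* (con 1ℚ :- c :* c) :+ (con (ι 2) :* (con (ι 6) :- A :* (con 1ℚ :- c))
              :+ A :* ((con 1ℚ :- c) :* (con 1ℚ :- c))) := con (ι 12)) refl (N * N) c)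

        open Rotation c σ using (g; F)
        open Rotation.Laws c σ c²+σ≡1 using (F-g; ∣f∣≤1)
        open Wave {c} {σ} c²+σ≡1 0≤σ j d p q near
        module S = Sine c c≤1 (sine c) refl (sine-one c) (sine-suc-suc c)

        0≤g : ∀ s → s ℕ.≤ n → 0ℚ ≤ g s
        0≤g zero    _  = ℚ.≤-refl
        0≤g (suc s) le = ℚ.<⇒≤ (sine>0 s le)

        ∣F∣≤1 : ∀ t → ∣ F t ∣ ≤ 1ℚ
        ∣F∣≤1 t = ∣f∣≤1 0≤σ (t ℕ.+ t)

        j<n : j ℕ.< n
        j<n = ℕ.≰⇒> λ n≤j → ℕ.<⇒≱ (ℕ.≤-trans (s≤s (s≤s z≤n)) 4≤n) (ℕ.*-cancelˡ-≤ n
          (ℕ.≤-trans (ℕ.*-mono-≤ (ℕ.≤-trans n≤j j≤Q) (ℕ.≤-trans n≤j j≤Q))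
            (ℕ.≤-trans Q²≤n (ℕ.≤-reflexive (sym (ℕ.*-identityʳ n))))))

        d≤n : d ℕ.≤ n
        d≤n = ℕ.≤-trans (ℕ.m≤m*n d Q {{ℕ.>-nonZero 1≤Q}}) dQ≤n

        1≤Ng : 1ℚ ≤ N * g j
        1≤Ng = lower j 1≤j j<n
          where
          lower : ∀ j → 1 ℕ.≤ j → j ℕ.< n → 1ℚ ≤ N * g j
          lower (suc t) _ lt = ℚ.≤-trans (S.g-lower {n} 0≤g t lt)
            (*-mono-≤ (0≤ι (suc t)) (0≤g (suc t) (ℕ.<⇒≤ lt)) (ι-mono (ℕ.<⇒≤ lt)) ℚ.≤-refl)

        -- Here 1 - c₁ = 2 σ g(j)², and N² σ ≥ 1/2 together with N g(j) ≥ 1 gives N⁴ (1 - c₁) ≥ 1;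
        -- hence the choice κ = 1/N⁴.
        κ≤1-c₁ : κ ≤ 1ℚ - c₁
        κ≤1-c₁ = *-cancel-≤ (0<* (0<* 0<N 0<N) (0<* 0<N 0<N)) (subst₂ _≤_ (sym N⁴κ≡1)
          (trans (solve 3 (λ N s g → con (ι 2) :* (N :* N :* s :* (N :* g :* (N :* g)))
                   := N :* N :* (N :* N) :* (con 1ℚ :- (con 1ℚ :- con (ι 2) :* (s :* (g :* g)))))
                     refl N σ (g j))
            (cong (λ z → N * N * (N * N) * (1ℚ - z)) (sym (F-g j))))
          (*-mono-≤ {ι 2} {ι 2} {½ * (1ℚ * 1ℚ)} (0≤ι 2) (ℚ.<⇒≤ 0<½) ℚ.≤-refl
            (*-mono-≤ {½} {N * N * σ} {1ℚ * 1ℚ} (ℚ.<⇒≤ 0<½) 0≤1 ½≤N²σ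
              (*-mono-≤ 0≤1 0≤1 1≤Ng 1≤Ng))))

        1≤N² : 1ℚ ≤ N * N
        1≤N² = *-mono-≤ {1ℚ} {N} {1ℚ} {N} 0≤1 0≤1 (1≤ι 1≤n) (1≤ι 1≤n)

        κ≤1 : κ ≤ 1ℚ
        κ≤1 = *-cancel-≤ (0<* (0<* 0<N 0<N) (0<* 0<N 0<N)) (subst₂ _≤_ (sym N⁴κ≡1)
          (sym (ℚ.*-identityʳ (N * N * (N * N)))) (*-mono-≤ {1ℚ} {N * N} {1ℚ} {N * N} 0≤1 0≤1 1≤N² 1≤N²))

        Qg≤N : ∀ t → t ℕ.≤ n → t ℕ.* Q ℕ.≤ n → (g t * ι Q) * (g t * ι Q) ≤ N * N
        Qg≤N t t≤n tQ≤n = *-mono-≤ 0≤gQ 0≤gQ gQ≤N gQ≤N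
          where
          0≤gQ : 0ℚ ≤ g t * ι Q
          0≤gQ = 0≤* (0≤g t t≤n) (0≤ι Q)
          gQ≤N : g t * ι Q ≤ N
          gQ≤N = ℚ.≤-trans (*-mono-≤ (0≤g t t≤n) (0≤ι Q) (S.g≤ι {n} 0≤g t t≤n) ℚ.≤-refl)
            (subst (_≤ N) (ι-* t Q) (ι-mono tQ≤n))

        -- From 3 - y ≤ 2 σ (g(j)² + g(d)²), where Q g(t) ≤ Q t ≤ n for t = j and t = d, and n² σ ≤
        -- 12.
        Q²gap≤48 : ∀ y → 1ℚ + c₁ + c₂ ≤ y → ι Q * ι Q * (ι 3 - y) ≤ ι 48
        Q²gap≤48 y lo≤y = ≤-by
          (0≤+ (0≤+ (0≤* (0≤* (0≤ι Q) (0≤ι Q)) (≤⇒0≤ lo≤y)) (0≤* (0≤ι 4) (≤⇒0≤ N²σ≤12)))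
            (0≤* (0≤* (0≤ι 2) 0≤σ) (0≤+ (≤⇒0≤ (Qg≤N j (ℕ.<⇒≤ j<n) jQ≤n)) (≤⇒0≤ (Qg≤N d d≤n dQ≤n)))))
          (trans (cong (λ z → ι Q * ι Q * (ι 3 - y) + (ι Q * ι Q * (y - z) + ι 4 * (ι 12 - N * N * σ)
                  + ι 2 * σ * ((N * N - (g j * ι Q) * (g j * ι Q)) +
                    (N * N - (g d * ι Q) * (g d * ι Q)))))
               (cong₂ (λ u v → 1ℚ + u + v) (F-g j) (F-g d)))
            (solve 6 (λ Q y N s g h → Q :* Q :* (con (ι 3) :- y)
                :+ (Q :* Q :* (y :- (con 1ℚ :+ (con 1ℚ :- con (ι 2) :* (s :* (g :* g)))
                      :+ (con 1ℚ :- con (ι 2) :* (s :* (h :* h)))))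
                    :+ con (ι 4) :* (con (ι 12) :- N :* N :* s)
                    :+ con (ι 2) :* s :* ((N :* N :- (g :* Q) :* (g :* Q)) :+
                      (N :* N :- (h :* Q) :* (h :* Q))))
                := con (ι 48)) refl (ι Q) y N σ (g j) (g d)))
          where
          jQ≤n : j ℕ.* Q ℕ.≤ n
          jQ≤n = ℕ.≤-trans (ℕ.*-monoˡ-≤ Q j≤Q) Q²≤n

        C′ : ℚ
        C′ = ι 4 * ι (j ℕ.* (3 ℕ.* n)) + ι 2 * (ι 3 * (ι p + ι q))

        result : ∀ {ε ρ} → 0ℚ < ρ → scale * ρ ≡ ε → (1ℚ + ι 5 * C′ * ι 2) * ε₁ ≡ ½ * ρ →
          ApproxEigenvalue (½ * κ) ε
        result {ε} {ρ} 0<ρ scaleρ≡ε ε₁≡ρ =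
          let y , lo≤y , y≤hi , small-block = blockRoot {c₁} {c₂} {κ} {½ * ρ}
                (∣F∣≤1 j) (∣F∣≤1 d) 0<κ κ≤1 κ≤1-c₁ (0<* 0<½ 0<ρ)
          in y
           , ≤-by (≤⇒0≤ y≤hi) (solve 2 (λ k y → k :+ (con (ι 3) :- k :- y) := con (ι 3) :- y) refl
             (½ * κ) y)
           , Q²gap≤48 y lo≤y
           , ℚ.≤-trans (charPoly-wave y (½ * ρ) (∣y∣≤3 y lo≤y y≤hi) small-block)
               (subst (scale * (ι 5 * (C′ * (ι 2 * ∣ g n ∣)) + ½ * ρ) ≤_) scaleρ≡ε
                 (ℚ.*-monoˡ-≤-nonNeg scale {{nonNegative (ℚ.<⇒≤ 0<scale)}} error≤))
          where
          0≤gn : 0ℚ ≤ g n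
          0≤gn = 0≤g n ℕ.≤-refl

          0≤C′ : 0ℚ ≤ C′
          0≤C′ = 0≤+ (0≤* (0≤ι 4) (0≤ι (j ℕ.* (3 ℕ.* n))))
            (0≤* (0≤ι 2) (0≤* (0≤ι 3) (0≤+ (0≤ι p) (0≤ι q))))

          error≤ : ι 5 * (C′ * (ι 2 * ∣ g n ∣)) + ½ * ρ ≤ ρ
          error≤ = subst (λ x → ι 5 * (C′ * (ι 2 * x)) + ½ * ρ ≤ ρ) (sym (ℚ.0≤p⇒∣p∣≡p 0≤gn)) (≤-by
            (0≤+ (0≤* (0≤* (0≤* (0≤ι 5) 0≤C′) (0≤ι 2)) (≤⇒0≤ small)) (ℚ.≤-trans 0≤gn small))
            (trans (solve 4 (λ C x e r → con (ι 5) :* (C :* (con (ι 2) :* x)) :+ r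
                  :+ (con (ι 5) :* C :* con (ι 2) :* (e :- x) :+ e)
                  := (con 1ℚ :+ con (ι 5) :* C :* con (ι 2)) :* e :+ r) refl C′ (g n) ε₁ (½ * ρ))
              (trans (cong (_+ ½ * ρ) ε₁≡ρ) (solve 1 (λ r → con ½ :* r :+ con ½ :* r := r) refl ρ))))

          ∣y∣≤3 : ∀ y → 1ℚ + c₁ + c₂ ≤ y → y ≤ ι 3 - ½ * κ → ∣ y ∣ ≤ ι 3
          ∣y∣≤3 y lo≤y y≤hi = ∣∣≤-intro
            (≤-by (0≤+ (≤⇒0≤ y≤hi) (0≤* (ℚ.<⇒≤ 0<½) (ℚ.<⇒≤ 0<κ)))
              (solve 2 (λ y k → y :+ (con (ι 3) :- k :- y :+ k) := con (ι 3)) refl y (½ * κ)))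
            (≤-by (0≤+ (0≤+ (0≤+ (≤⇒0≤ lo≤y) (≤⇒0≤ (∣-∣≤⇒≥ {c₁} {0ℚ} (c-0 j))))
              (≤⇒0≤ (∣-∣≤⇒≥ {c₂} {0ℚ} (c-0 d)))) (0≤ι 2))
              (solve 3 (λ a b y → :- y :+ ((y :- (con 1ℚ :+ a :+ b)) :+ (a :+ con 1ℚ :- con 0ℚ)
                :+ (b :+ con 1ℚ :- con 0ℚ) :+ con (ι 2)) := con (ι 3)) refl c₁ c₂ y))
            where
            c-0 : ∀ t → ∣ F t - 0ℚ ∣ ≤ 1ℚ
            c-0 t = subst (λ z → ∣ z ∣ ≤ 1ℚ) (sym (ℚ.+-identityʳ (F t))) (∣F∣≤1 t)

    -- θ stands outside the quantifier over ε: sharpening the approximation must not let y drift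
    -- towards 3.
    approxEigenvalue : ∃[ θ ] (0ℚ < θ × (∀ ε → 0ℚ < ε → ApproxEigenvalue θ ε))
    approxEigenvalue =
      let j , d , 1≤j , j≤Q , dQ≤n , p , q , near = dirichlet n k Q 1≤Q
          κ , 0<κ , N⁴κ≡1 = shrink (0<* (0<* 0<N 0<N) (0<* 0<N 0<N)) 0<1
      in ½ * κ , 0<* 0<½ 0<κ , λ ε 0<ε →
        -- Half of ρ is reserved for the defect of the block equation, the other half for the
        -- failure of exact periodicity, which is controlled by ε₁.
        let ρ , 0<ρ , scaleρ≡ε = shrink 0<scale 0<ε
            ε₁ , 0<ε₁ , ε₁≡ρ = shrink (0<C j p q) (0<* 0<½ 0<ρ)
        in FromAngle.result j d p q 1≤j j≤Q dQ≤n near 0<κ N⁴κ≡1 (angle 4≤n 0<ε₁) 0<ρ scaleρ≡ε ε₁≡ρ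
      where
      0<C : ∀ j p q → 0ℚ < 1ℚ + ι 5 * (ι 4 * ι (j ℕ.* (3 ℕ.* n)) + ι 2 * (ι 3 * (ι p + ι q))) * ι 2
      0<C j p q = 0<+≤ 0<1 (0≤* (0≤* (0≤ι 5)
        (0≤+ (0≤* (0≤ι 4) (0≤ι (j ℕ.* (3 ℕ.* n)))) (0≤* (0≤ι 2) (0≤* (0≤ι 3) (0≤+ (0≤ι p) (0≤ι q))))))
        (0≤ι 2))

  -- The spectral gap

  0≤1/ : ∀ d .{{_ : ℕ.NonZero d}} → 0ℚ ≤ + 1 / d
  0≤1/ d = ℚ.nonNegative⁻¹ (+ 1 / d) {{ℚ.normalize-nonNeg 1 d}}

  1/-antitone : ∀ {d d′} .{{_ : ℕ.NonZero d}} .{{_ : ℕ.NonZero d′}} → d ℕ.≤ d′ → + 1 / d′ ≤ + 1 / d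
  1/-antitone {d} {d′} d≤d′ = subst₂ _≤_
    (trans (cong (+ 1 / d′ *_) (1/d*d d)) (ℚ.*-identityʳ (+ 1 / d′)))
    (trans (solve 3 (λ x y e → x :* (y :* e) := y :* (x :* e)) refl (+ 1 / d′) (+ 1 / d) (ι d′))
      (trans (cong (+ 1 / d *_) (1/d*d d′)) (ℚ.*-identityʳ (+ 1 / d))))
    (*-mono-≤ (0≤1/ d′) (0≤* (0≤1/ d) (0≤ι d)) ℚ.≤-refl
      (*-mono-≤ (0≤1/ d) (0≤ι d) ℚ.≤-refl (ι-mono d≤d′)))

  leibniz-bounds : ∀ k m → 0ℚ ≤ leibniz k m × leibniz k m ≤ odd⁻¹ k
  leibniz-bounds k zero    = ℚ.≤-refl , 0≤1/ (suc (2 ℕ.* k))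
  leibniz-bounds k (suc m) =
    let 0≤t , t≤ = leibniz-bounds (suc k) m
    in ≤⇒0≤ (ℚ.≤-trans t≤ (1/-antitone (s≤s (ℕ.*-monoʳ-≤ 2 (ℕ.n≤1+n k)))))
     , ≤-by 0≤t (solve 2 (λ a t → a :- t :+ t := a) refl (odd⁻¹ k) (leibniz (suc k) m))

  -- After an even number of terms the tail of the alternating series is nonnegative.
  leibniz-8 : ∀ m → 8 ℕ.≤ m → leibniz 0 8 ≤ leibniz 0 m
  leibniz-8 m 8≤m = subst (λ m → leibniz 0 8 ≤ leibniz 0 m) (ℕ.m+[n∸m]≡n 8≤m)
    (≤-by (proj₁ (leibniz-bounds 8 (m ℕ.∸ 8)))
      (solve 1 (λ x → con (leibniz 0 8) :+ x :=
          con (odd⁻¹ 0) :- (con (odd⁻¹ 1) :- (con (odd⁻¹ 2) :- (con (odd⁻¹ 3)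
          :- (con (odd⁻¹ 4) :- (con (odd⁻¹ 5) :- (con (odd⁻¹ 6) :- (con (odd⁻¹ 7) :- x)))))))) refl
        (leibniz 8 (m ℕ.∸ 8))))

  -- Sixteen times the eighth partial sum is about 12.07; eight is the smallest even number of terms
  -- for which this exceeds 12.
  leibniz-8≥ : ι 12 + + 5 / 100 ≤ ι 4 * (ι 4 * leibniz 0 8)
  leibniz-8≥ = ℚ.≤ᵇ⇒≤ tt

  0<1/ : ∀ d .{{_ : ℕ.NonZero d}} → 0ℚ < + 1 / d
  0<1/ d = ℚ.positive⁻¹ (+ 1 / d) {{ℚ.normalize-pos 1 d}}

  below : ∀ {p q} → 0ℚ < p → 0ℚ < q → ∃[ r ] (0ℚ < r × r ≤ p × r ≤ q)
  below {p} {q} 0<p 0<q with ℚ.≤-total p q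
  ... | inj₁ p≤q = p , 0<p , ℚ.≤-refl , p≤q
  ... | inj₂ q≤p = q , 0<q , q≤p , ℚ.≤-refl

  -- (D + 1)² g ≤ 48 gives D g ≤ 12 since (D + 1)² ≥ 4 D.
  gap≤12/D : ∀ {D u g} → 0ℚ ≤ u → u * D ≡ 1ℚ → 0ℚ ≤ g → (1ℚ + D) * (1ℚ + D) * g ≤ ι 48 → g ≤ ι 12 * u
  gap≤12/D {D} {u} {g} 0≤u uD≡1 0≤g h = *-cancel-≤ (0<ι {4} (s≤s z≤n)) (≤-by
    (0≤* 0≤u (0≤+ (≤⇒0≤ h) (0≤* 0≤g (0≤sq (D - 1ℚ)))))
    (trans (cong (λ z → ι 4 * z + u * (ι 48 - (1ℚ + D) * (1ℚ + D) * g + g * ((D - 1ℚ) * (D - 1ℚ))))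
        (trans (sym (ℚ.*-identityˡ g)) (cong (_* g) (sym uD≡1))))
      (solve 3 (λ D u g → con (ι 4) :* (u :* D :* g)
          :+ u :* (con (ι 48) :- (con 1ℚ :+ D) :* (con 1ℚ :+ D) :* g :+ g :*
            ((D :- con 1ℚ) :* (D :- con 1ℚ)))
          := con (ι 4) :* (con (ι 12) :* u)) refl D u g)))

  -- The margin of 5/100 from `leibniz-8≥` is split: 3 η uses up 3/100 u, and 1/50 u is left as the
  -- witness of strict inequality.
  assemble : ∀ {x y η u l} → 0ℚ ≤ u → ι 3 - y ≤ ι 12 * u → η ≤ + 1 / 100 * u → x ≤ ι 3 - y + ι 3 * η →
    leibniz 0 8 ≤ l → x + + 1 / 50 * u ≤ ι 4 * (ι 4 * l) * u
  assemble {x} {y} {η} {u} {l} 0≤u gap≤ η≤ x≤ l≥ = ≤-by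
    (0≤+ (0≤+ (0≤+ (0≤+ (≤⇒0≤ x≤) (≤⇒0≤ gap≤)) (0≤* (0≤ι 3) (≤⇒0≤ η≤)))
      (0≤* 0≤u (≤⇒0≤ leibniz-8≥))) (0≤* (0≤ι 16) (0≤* 0≤u (≤⇒0≤ l≥))))
    (solve 6 (λ x y η u l l₈ →
        x :+ con (+ 1 / 50) :* u :+ ((con (ι 3) :- y :+ con (ι 3) :* η :- x)
          :+ (con (ι 12) :* u :- (con (ι 3) :- y)) :+ con (ι 3) :* (con (+ 1 / 100) :* u :- η)
          :+ u :* (con (ι 4) :* (con (ι 4) :* l₈) :- (con (ι 12) :+ con (+ 5 / 100)))
          :+ con (ι 16) :* (u :* (l :- l₈)))
        := con (ι 4) :* (con (ι 4) :* l) :* u) refl x y η u l (leibniz 0 8))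

  module _ {N d : ℕ} .{{_ : ℕ.NonZero d}} (μ : Fin N → ℝ) (p : ℚ → ℚ)
    (descending : ∀ i j → i Fin.≤ j → μ j D.≤ μ i)
    (close : ∀ x ε → 0ℚ < ε →
      Eventually λ m → ∣ p (seq x m) - product (λ i → seq x m - seq (μ i) m) ∣ ≤ ε)
    (large : ∀ δ z → 0ℚ < δ → ι 3 + δ ≤ z → δ ^ N ≤ p z)
    (root-3 : ∣ p (ι 3) ∣ ≤ 0ℚ)
    {θ : ℚ} (0<θ : 0ℚ < θ)
    (approximate : ∀ ε → 0ℚ < ε →
      ∃[ y ] (θ ≤ ι 3 - y × ι (suc d) * ι (suc d) * (ι 3 - y) ≤ ι 48 × ∣ p y ∣ ≤ ε)) where

    gap< : ∀ i₁ i₂ → toℕ i₂ ≡ 1 → Eventually λ m →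
      seq (μ i₁) m - seq (μ i₂) m + + 1 / 50 * (+ 1 / d) ≤ ι 4 * (ι 4 * leibniz 0 m) * (+ 1 / d)
    gap< i₁ i₂ i₂≡1 =
      -- The bound u/100 is the share of η in the margin of `assemble`; the bound θ/4 gives 2 η < θ,
      -- so that y + 2 η < 3 separates the two approximate roots. The required accuracy of y depends
      -- on η, so y comes afterwards.
      let η , 0<η , η≤u , η≤θ = below (0<* (0<1/ 100) 0<u) (0<* 0<½ (0<* 0<½ 0<θ))
          0<ε = 0<* {½ * ½} (0<* 0<½ 0<½) (0<^ N 0<η)
          y , θ≤3-y , Q²gap≤48 , small = approximate (½ * ½ * η ^ N) 0<ε
          y<3 = <-by (0<+≤ (0<+≤ (0<* 0<½ 0<θ) (≤⇒0≤ θ≤3-y)) (0≤* (0≤ι 2) (≤⇒0≤ η≤θ)))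
            (solve 3 (λ y η θ → y :+ con (ι 2) :* η :+ (con ½ :* θ :+ (con (ι 3) :- y :- θ)
                :+ con (ι 2) :* (con ½ :* (con ½ :* θ) :- η)) := con (ι 3)) refl y η θ)
          3-y≤ = gap≤12/D (ℚ.<⇒≤ 0<u) (1/d*d d) (ℚ.≤-trans (ℚ.<⇒≤ 0<θ) θ≤3-y)
            (subst (λ q → q * q * (ι 3 - y) ≤ ι 48) (ι-suc d) Q²gap≤48)
      in mapᵉ (λ m (x≤ , 8≤m) → assemble {y = y} (ℚ.<⇒≤ 0<u) 3-y≤ η≤u x≤ (leibniz-8 m 8≤m))
        (gap≤ (ι 3) large η y 0<η y<3 (ℚ.≤-trans root-3 (ℚ.<⇒≤ 0<ε)) small i₁ i₂ i₂≡1
          ∧ᵉ (8 , λ _ 8≤m → 8≤m))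
      where
      0<u = 0<1/ d
      open Roots μ p descending close

  module _ {n k d : ℕ} .{{_ : ℕ.NonZero n}} .{{_ : ℕ.NonZero d}} (4≤n : 4 ℕ.≤ n) (1≤k : 1 ℕ.≤ k)
    (k<n : k ℕ.< n) (Q²≤n : suc d ℕ.* suc d ℕ.≤ n) (μ : Fin (n ℕ.+ n) → ℝ)
    (spectrum : IsSpectrum (D.adjacencyMatrix (P n k)) μ) where

    open PetersenMatrix {n} {k} (ℕ.≤-trans (s≤s (s≤s z≤n)) 4≤n) 1≤k k<n

    private
      close : ∀ x ε → 0ℚ < ε →
        Eventually λ m → ∣ charPoly A (seq x m) - product (λ i → seq x m - seq (μ i) m) ∣ ≤ ε
      close = approximates {M = D.adjacencyMatrix (P n k)} {μ} spectrum A λ _ _ _ → refl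

      roots : ∃[ θ ] (0ℚ < θ × (∀ ε → 0ℚ < ε →
        ∃[ y ] (θ ≤ ι 3 - y × ι (suc d) * ι (suc d) * (ι 3 - y) ≤ ι 48 × ∣ charPoly A y ∣ ≤ ε)))
      roots = approxEigenvalue {n} {k} {suc d} 4≤n 1≤k k<n (s≤s z≤n) Q²≤n

    petersenGap< : ∀ i₁ i₂ → toℕ i₂ ≡ 1 → Eventually λ m →
      seq (μ i₁) m - seq (μ i₂) m + + 1 / 50 * (+ 1 / d) ≤ ι 4 * (ι 4 * leibniz 0 m) * (+ 1 / d)
    petersenGap< = gap< {d = d} μ (charPoly A) (proj₁ spectrum) close charPoly-large charPoly-3
      (proj₁ (proj₂ roots)) (proj₂ (proj₂ roots))

open import Defs
open Bounds using (0<*; 0<1/; petersenGap<)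

theorem1p1 : (n k : ℕ) (4≤n : 4 ℕ.≤ n) → 1 ℕ.≤ k → 2 ℕ.* k ℕ.≤ n →
    (μ : Fin (n ℕ.+ n) → ℝ) → IsSpectrum (adjacencyMatrix (P n k)) μ →
    (i₁ i₂ : Fin (n ℕ.+ n)) → toℕ i₁ ≡ 0 → toℕ i₂ ≡ 1 →
    μ i₁ - μ i₂ < _/_ (fromℕ 4 * π) (⌊√ n ⌋ ℕ.∸ 1) {{⌊√⌋∸1-nonZero 4≤n}}
theorem1p1 n@(suc _) k 4≤n 1≤k 2k≤n μ spectrum i₁ i₂ _ i₂≡1 =
  -- The m-th term of 4 π / d is by definition the right side of `petersenGap<`, so the eventual
  -- inequality is the one demanded by `_<_`.
  + 1 ℚ./ 50 ℚ.* (+ 1 ℚ./ d) , 0<* (0<1/ 50) (0<1/ d)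
  , petersenGap< {d = d} 4≤n 1≤k k<n Q²≤n μ spectrum i₁ i₂ i₂≡1
  where
  d = ⌊√ n ⌋ ℕ.∸ 1

  instance
    d-nonZero : ℕ.NonZero d
    d-nonZero = ⌊√⌋∸1-nonZero 4≤n

  k<n : k ℕ.< n
  k<n = ℕ.<-≤-trans (ℕ.m<m+n k (ℕ.≤-trans 1≤k (ℕ.m≤m+n k 0))) 2k≤n

  suc-d : ∀ q → .{{ℕ.NonZero (q ℕ.∸ 1)}} → suc (q ℕ.∸ 1) ≡ q
  suc-d (suc q) = _≡_.refl

  Q²≤n : suc d ℕ.* suc d ℕ.≤ n
  Q²≤n = subst (λ q → q ℕ.* q ℕ.≤ n) (sym (suc-d ⌊√ n ⌋)) (⌊√⌋-lower n)
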